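{- For all formulas $F,G$ of the language $F::=X\mid F\otimes F\mid 1\mid F\multimap F\mid F\&F\mid\top$, $F=_{\mathcal{S}}G$ holds if and only if, in every symmetric monoidal closed category with finite products and for every interpretation of the atoms as objects, the interpretations of $F$ and $G$ are isomorphic. (That is, $\mathcal{S}$ is sound and complete for isomorphisms in symmetric monoidal closed categories with finite products.)
   Context: Formulas are interpreted in a symmetric monoidal closed category with finite products by interpreting $\otimes$ as the monoidal product, $1$ as its unit, $F\multimap G$ as the internal hom, $\&$ as binary product and $\top$ as terminal object; atoms are interpreted as arbitrary objects. The equational theory $\mathcal{S}$ is the congruence generated by: $F\otimes(G\otimes H)=(F\otimes G)\otimes H$; $F\otimes G=G\otimes F$; $F\otimes1=F$; $(F\otimes G)\multimap H=F\multimap(G\multimap H)$; $1\multimap F=F$; $F\&(G\&H)=(F\&G)\&H$; $F\&G=G\&F$; $F\&\top=F$; $F\multimap(G\&H)=(F\multimap G)\&(F\multimap H)$; $F\multimap\top=\top$. -}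

module Defs where

open import Level using (Level; _⊔_; suc; Setω)
open import Relation.Binary using (IsEquivalence)

record Category (o ℓ e : Level) : Set (suc (o ⊔ ℓ ⊔ e)) where
  infixr 9 _∘_
  infix  4 _≈_
  infix  5 _⇒_
  field
    Obj   : Set o
    _⇒_   : Obj → Obj → Set ℓ
    _≈_   : ∀ {A B} → A ⇒ B → A ⇒ B → Set e
    ≈-equiv : ∀ {A B} → IsEquivalence (_≈_ {A} {B})
    id    : ∀ {A} → A ⇒ A
    _∘_   : ∀ {A B C} → B ⇒ C → A ⇒ B → A ⇒ C
    assoc : ∀ {A B C D} {f : A ⇒ B} {g : B ⇒ C} {h : C ⇒ D} →
            (h ∘ g) ∘ f ≈ h ∘ (g ∘ f)
    identityˡ : ∀ {A B} {f : A ⇒ B} → id ∘ f ≈ f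
    identityʳ : ∀ {A B} {f : A ⇒ B} → f ∘ id ≈ f
    ∘-resp-≈  : ∀ {A B C} {f h : B ⇒ C} {g i : A ⇒ B} →
                f ≈ h → g ≈ i → f ∘ g ≈ h ∘ i

record SMCCProd (o ℓ e : Level) : Set (suc (o ⊔ ℓ ⊔ e)) where
  infixr 10 _⊗₀_ _⊗₁_
  infixr 11 _×_
  field
    category : Category o ℓ e
  open Category category public
  field
    _⊗₀_ : Obj → Obj → Obj
    _⊗₁_ : ∀ {A B C D} → A ⇒ B → C ⇒ D → (A ⊗₀ C) ⇒ (B ⊗₀ D)
    ⊗-identity : ∀ {A C} → id {A} ⊗₁ id {C} ≈ id
    ⊗-homomorphism : ∀ {A B C D E F} {f : A ⇒ B} {g : B ⇒ C} {h : D ⇒ E} {k : E ⇒ F} →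
                     (g ∘ f) ⊗₁ (k ∘ h) ≈ (g ⊗₁ k) ∘ (f ⊗₁ h)
    ⊗-resp-≈ : ∀ {A B C D} {f f′ : A ⇒ B} {g g′ : C ⇒ D} →
               f ≈ f′ → g ≈ g′ → f ⊗₁ g ≈ f′ ⊗₁ g′
    unit : Obj
    α⇒ : ∀ {A B C} → (A ⊗₀ B) ⊗₀ C ⇒ A ⊗₀ (B ⊗₀ C)
    α⇐ : ∀ {A B C} → A ⊗₀ (B ⊗₀ C) ⇒ (A ⊗₀ B) ⊗₀ C
    α-isoˡ : ∀ {A B C} → α⇐ {A} {B} {C} ∘ α⇒ ≈ id
    α-isoʳ : ∀ {A B C} → α⇒ {A} {B} {C} ∘ α⇐ ≈ id
    α-natural : ∀ {A B C D E F} {f : A ⇒ B} {g : C ⇒ D} {h : E ⇒ F} →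
                α⇒ ∘ ((f ⊗₁ g) ⊗₁ h) ≈ (f ⊗₁ (g ⊗₁ h)) ∘ α⇒
    λ⇒ : ∀ {A} → unit ⊗₀ A ⇒ A
    λ⇐ : ∀ {A} → A ⇒ unit ⊗₀ A
    λ-isoˡ : ∀ {A} → λ⇐ {A} ∘ λ⇒ ≈ id
    λ-isoʳ : ∀ {A} → λ⇒ {A} ∘ λ⇐ ≈ id
    λ-natural : ∀ {A B} {f : A ⇒ B} → λ⇒ ∘ (id {unit} ⊗₁ f) ≈ f ∘ λ⇒
    ρ⇒ : ∀ {A} → A ⊗₀ unit ⇒ A
    ρ⇐ : ∀ {A} → A ⇒ A ⊗₀ unit
    ρ-isoˡ : ∀ {A} → ρ⇐ {A} ∘ ρ⇒ ≈ id
    ρ-isoʳ : ∀ {A} → ρ⇒ {A} ∘ ρ⇐ ≈ id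
    ρ-natural : ∀ {A B} {f : A ⇒ B} → ρ⇒ ∘ (f ⊗₁ id {unit}) ≈ f ∘ ρ⇒
    σ : ∀ {A B} → A ⊗₀ B ⇒ B ⊗₀ A
    σ-natural : ∀ {A B C D} {f : A ⇒ B} {g : C ⇒ D} →
                σ ∘ (f ⊗₁ g) ≈ (g ⊗₁ f) ∘ σ
    σ-involutive : ∀ {A B} → σ {B} {A} ∘ σ {A} {B} ≈ id
    pentagon : ∀ {A B C D} →
      (id {A} ⊗₁ α⇒ {B} {C} {D}) ∘ α⇒ {A} {B ⊗₀ C} {D} ∘ (α⇒ {A} {B} {C} ⊗₁ id {D})
        ≈ α⇒ {A} {B} {C ⊗₀ D} ∘ α⇒ {A ⊗₀ B} {C} {D}
    triangle : ∀ {A B} →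
      (id {A} ⊗₁ λ⇒ {B}) ∘ α⇒ {A} {unit} {B} ≈ ρ⇒ {A} ⊗₁ id {B}
    hexagon : ∀ {A B C} →
      α⇒ {B} {C} {A} ∘ σ {A} {B ⊗₀ C} ∘ α⇒ {A} {B} {C}
        ≈ (id {B} ⊗₁ σ {A} {C}) ∘ α⇒ {B} {A} {C} ∘ (σ {A} {B} ⊗₁ id {C})
    [_,_] : Obj → Obj → Obj
    eval : ∀ {B C} → [ B , C ] ⊗₀ B ⇒ C
    curry : ∀ {A B C} → A ⊗₀ B ⇒ C → A ⇒ [ B , C ]
    curry-β : ∀ {A B C} {f : A ⊗₀ B ⇒ C} → eval ∘ (curry f ⊗₁ id) ≈ f
    curry-unique : ∀ {A B C} {f : A ⊗₀ B ⇒ C} {g : A ⇒ [ B , C ]} →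
                   eval ∘ (g ⊗₁ id) ≈ f → g ≈ curry f
    terminal : Obj
    ! : ∀ {A} → A ⇒ terminal
    !-unique : ∀ {A} (f : A ⇒ terminal) → f ≈ !
    _×_ : Obj → Obj → Obj
    π₁ : ∀ {A B} → A × B ⇒ A
    π₂ : ∀ {A B} → A × B ⇒ B
    ⟨_,_⟩ : ∀ {A B C} → C ⇒ A → C ⇒ B → C ⇒ A × B
    project₁ : ∀ {A B C} {f : C ⇒ A} {g : C ⇒ B} → π₁ ∘ ⟨ f , g ⟩ ≈ f
    project₂ : ∀ {A B C} {f : C ⇒ A} {g : C ⇒ B} → π₂ ∘ ⟨ f , g ⟩ ≈ g
    ⟨⟩-unique : ∀ {A B C} {f : C ⇒ A} {g : C ⇒ B} {h : C ⇒ A × B} →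
                π₁ ∘ h ≈ f → π₂ ∘ h ≈ g → h ≈ ⟨ f , g ⟩

record _≅_[_] {o ℓ e} {C : Category o ℓ e} (A B : Category.Obj C) : Set (ℓ ⊔ e) where
  open Category C
  field
    to   : A ⇒ B
    from : B ⇒ A
    isoˡ : from ∘ to ≈ id
    isoʳ : to ∘ from ≈ id

Iso : ∀ {o ℓ e} (C : Category o ℓ e) → Category.Obj C → Category.Obj C → Set (ℓ ⊔ e)
Iso C A B = _≅_[_] {C = C} A B

infixr 6 _⊗_
infixr 5 _&_
infixr 4 _⊸_

data Formula (X : Set) : Set where
  atom : X → Formula X
  _⊗_  : Formula X → Formula X → Formula X
  𝟏    : Formula X
  _⊸_  : Formula X → Formula X → Formula X
  _&_  : Formula X → Formula X → Formula X
  𝟙⊤   : Formula X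

infix 3 _=S_

data _=S_ {X : Set} : Formula X → Formula X → Set where
  refl  : ∀ {F} → F =S F
  sym   : ∀ {F G} → F =S G → G =S F
  trans : ∀ {F G H} → F =S G → G =S H → F =S H
  ⊗-cong : ∀ {F F′ G G′} → F =S F′ → G =S G′ → F ⊗ G =S F′ ⊗ G′
  ⊸-cong : ∀ {F F′ G G′} → F =S F′ → G =S G′ → (F ⊸ G) =S (F′ ⊸ G′)
  &-cong : ∀ {F F′ G G′} → F =S F′ → G =S G′ → F & G =S F′ & G′
  ⊗-assoc : ∀ {F G H} → F ⊗ (G ⊗ H) =S (F ⊗ G) ⊗ H
  ⊗-comm  : ∀ {F G} → F ⊗ G =S G ⊗ F
  ⊗-unit  : ∀ {F} → F ⊗ 𝟏 =S F
  curry-ax : ∀ {F G H} → ((F ⊗ G) ⊸ H) =S (F ⊸ (G ⊸ H))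
  ⊸-unit  : ∀ {F} → (𝟏 ⊸ F) =S F
  &-assoc : ∀ {F G H} → F & (G & H) =S (F & G) & H
  &-comm  : ∀ {F G} → F & G =S G & F
  &-unit  : ∀ {F} → F & 𝟙⊤ =S F
  ⊸-&     : ∀ {F G H} → (F ⊸ (G & H)) =S ((F ⊸ G) & (F ⊸ H))
  ⊸-⊤     : ∀ {F} → (F ⊸ 𝟙⊤) =S 𝟙⊤

⟦_⟧_[_] : ∀ {o ℓ e} {X : Set} →
      Formula X → (C : SMCCProd o ℓ e) → (X → SMCCProd.Obj C) → SMCCProd.Obj C
⟦ atom x ⟧ C [ ρ ] = ρ x
⟦ F ⊗ G ⟧ C [ ρ ] = SMCCProd._⊗₀_ C (⟦ F ⟧ C [ ρ ]) (⟦ G ⟧ C [ ρ ])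
⟦ 𝟏 ⟧ C [ ρ ] = SMCCProd.unit C
⟦ F ⊸ G ⟧ C [ ρ ] = SMCCProd.[_,_] C (⟦ F ⟧ C [ ρ ]) (⟦ G ⟧ C [ ρ ])
⟦ F & G ⟧ C [ ρ ] = SMCCProd._×_ C (⟦ F ⟧ C [ ρ ]) (⟦ G ⟧ C [ ρ ])
⟦ 𝟙⊤ ⟧ C [ ρ ] = SMCCProd.terminal C

IsoInAllModels : {X : Set} → Formula X → Formula X → Setω
IsoInAllModels {X} F G =
  ∀ {o ℓ e} (C : SMCCProd o ℓ e) (ρ : X → SMCCProd.Obj C) →
  Iso (SMCCProd.category C) (⟦ F ⟧ C [ ρ ]) (⟦ G ⟧ C [ ρ ])

record _⇔ω_ (A : Set) (B : Setω) : Setω where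
  field
    to   : A → B
    from : B → A

{-# OPTIONS --safe #-}
module Submission where

-- Soundness: each axiom of S is an isomorphism, mostly read off from a natural bijection of
-- generalised elements.
--
-- Completeness is obtained from a single model.  Modulo S every formula is a tensor of primes, a
-- prime being a product of branches A₁ ⊗ ⋯ ⊗ Aₘ ⊸ h with the Aᵢ prime and h an atom or a tensor.
-- The model consists of pointed sets A with a degree map to a finite commutative monoid and an
-- operator p, glued to the predicates "definable by a cut-free proof".  Gluing makes both halves
-- of an isomorphism denotations of cut-free proofs f and g.  In the model every prime has
-- elements in two colours, told apart by Boolean tests.  Testing g ∘ f = id and f ∘ g = id on
-- such elements shows that f and g cannot begin by eliminating a hypothesis (this would lose
-- information), that they match the primes of both sides one to one, and that within a matched
-- pair they match the branches, and then the arguments and heads, which are smaller.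
--
-- Degrees and p are there for the units.  The monoid has two elements of square zero besides 1
-- and 0, so that ⊤, which is interpreted by the monoid itself, has two colours and ⊤ ⊗ ⊤ differs
-- from ⊤.  The tensor unit {0, 1, p} maps to the monoid by p ↦ 0, so that 1 & 1 → 1 is not
-- injective and A ⊸ 1 is not trivial.

open import Level using (Level; 0ℓ) renaming (suc to lsuc)
open import Relation.Binary using (IsEquivalence; Setoid)
import Relation.Binary.Reasoning.Setoid as SetoidReasoning
open import Defs

-- Gluing does the work of cut elimination: definability is preserved by all the structure, so the
-- two halves of an isomorphism are read back as proofs, and no equational theory of proofs is
-- developed. Equality in a tensor is a quotient that cannot be inverted, so maps are observed
-- through Boolean tests. Two tests combine to a test of a tensor only if they reject every `p a`,
-- because `p` moves between the factors. The price is that no test accepts the element p of 1. It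
-- is seen by weak tests, which turn into tests at arguments of degree other than 1, where `p` gives
-- zero, or beside a further component. Hence proofs are tested only on inputs of such degrees, and
-- the units need separate cases. Of g ∘ f = id only what tests on such inputs can see is retained.
-- In this weak form the identity passes to tensor factors, to branches, and to their arguments and
-- heads.

module Soundness {o ℓ e : Level} (C : SMCCProd o ℓ e) where
  open SMCCProd C

  private
    homSetoid : Obj → Obj → Setoid ℓ e
    homSetoid A B = record { isEquivalence = ≈-equiv {A} {B} }

    module Eq {A B : Obj} = Setoid (homSetoid A B)
    module Chain {A B : Obj} = SetoidReasoning (homSetoid A B)
    open Chain

    _≅_ : Obj → Obj → Set _
    _≅_ = Iso category

    postcomp : ∀ {A B D} {f : B ⇒ D} {g h : A ⇒ B} → g ≈ h → f ∘ g ≈ f ∘ h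
    postcomp = ∘-resp-≈ Eq.refl

    precomp : ∀ {A B D} {f : A ⇒ B} {g h : B ⇒ D} → g ≈ h → g ∘ f ≈ h ∘ f
    precomp q = ∘-resp-≈ q Eq.refl

    cancelʳ : ∀ {A B D} {f : B ⇒ D} {g : A ⇒ B} {h : B ⇒ A} → g ∘ h ≈ id → (f ∘ g) ∘ h ≈ f
    cancelʳ q = Eq.trans assoc (Eq.trans (postcomp q) identityʳ)

    cancelˡ : ∀ {A B D} {f : A ⇒ D} {g : B ⇒ D} {h : D ⇒ B} → g ∘ h ≈ id → g ∘ (h ∘ f) ≈ f
    cancelˡ q = Eq.trans (Eq.sym assoc) (Eq.trans (precomp q) identityˡ)

    uncurry : ∀ {A B D} → A ⇒ [ B , D ] → A ⊗₀ B ⇒ D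
    uncurry g = eval ∘ (g ⊗₁ id)

    uncurry-resp : ∀ {A B D} {f g : A ⇒ [ B , D ]} → f ≈ g → uncurry f ≈ uncurry g
    uncurry-resp q = postcomp (⊗-resp-≈ q Eq.refl)

    curry-resp : ∀ {A B D} {f g : A ⊗₀ B ⇒ D} → f ≈ g → curry f ≈ curry g
    curry-resp q = curry-unique (Eq.trans curry-β q)

    curry-η : ∀ {A B D} {g : A ⇒ [ B , D ]} → curry (uncurry g) ≈ g
    curry-η = Eq.sym (curry-unique Eq.refl)

    ⊗-∘ˡ : ∀ {A B D E} {f : B ⇒ D} {g : A ⇒ B} → (f ∘ g) ⊗₁ id {E} ≈ (f ⊗₁ id) ∘ (g ⊗₁ id)
    ⊗-∘ˡ = Eq.trans (⊗-resp-≈ Eq.refl (Eq.sym identityˡ)) ⊗-homomorphism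

    uncurry-∘ : ∀ {A B D E} {f : B ⇒ [ D , E ]} {g : A ⇒ B} →
                uncurry (f ∘ g) ≈ uncurry f ∘ (g ⊗₁ id)
    uncurry-∘ = Eq.trans (postcomp ⊗-∘ˡ) (Eq.sym assoc)

    curry-∘ : ∀ {A B D E} {f : B ⊗₀ D ⇒ E} {g : A ⇒ B} →
              curry f ∘ g ≈ curry (f ∘ (g ⊗₁ id))
    curry-∘ = curry-unique (Eq.trans uncurry-∘ (precomp curry-β))

    slide : ∀ {A B D E} {f : A ⇒ B} {g : D ⇒ E} → (f ⊗₁ id) ∘ (id ⊗₁ g) ≈ (id ⊗₁ g) ∘ (f ⊗₁ id)
    slide {f = f} {g} = begin
      (f ⊗₁ id) ∘ (id ⊗₁ g)  ≈⟨ ⊗-homomorphism ⟨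
      (f ∘ id) ⊗₁ (id ∘ g)   ≈⟨ ⊗-resp-≈ (Eq.trans identityʳ (Eq.sym identityˡ))
                                        (Eq.trans identityˡ (Eq.sym identityʳ)) ⟩
      (id ∘ f) ⊗₁ (g ∘ id)   ≈⟨ ⊗-homomorphism ⟩
      (id ⊗₁ g) ∘ (f ⊗₁ id)  ∎

    ⟨⟩-resp : ∀ {A B D} {f f′ : A ⇒ B} {g g′ : A ⇒ D} → f ≈ f′ → g ≈ g′ → ⟨ f , g ⟩ ≈ ⟨ f′ , g′ ⟩
    ⟨⟩-resp q r = ⟨⟩-unique (Eq.trans project₁ q) (Eq.trans project₂ r)

    ⟨⟩-∘ : ∀ {A B D E} {f : B ⇒ D} {g : B ⇒ E} {h : A ⇒ B} → ⟨ f ∘ h , g ∘ h ⟩ ≈ ⟨ f , g ⟩ ∘ h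
    ⟨⟩-∘ = Eq.sym (⟨⟩-unique (Eq.trans (Eq.sym assoc) (precomp project₁))
                             (Eq.trans (Eq.sym assoc) (precomp project₂)))

    π-ext : ∀ {A B D} {f g : A ⇒ B × D} → π₁ ∘ f ≈ π₁ ∘ g → π₂ ∘ f ≈ π₂ ∘ g → f ≈ g
    π-ext q r = Eq.trans (⟨⟩-unique q r) (Eq.sym (⟨⟩-unique Eq.refl Eq.refl))

    -- Naturality is required of `φ` only: `ψ` inherits it as the inverse, which the detour through
    -- `ψ (φ _)` in `isoˡ` exploits.
    yoneda : ∀ {A B}
      (φ : ∀ {Z} → Z ⇒ A → Z ⇒ B) (ψ : ∀ {Z} → Z ⇒ B → Z ⇒ A) →
      (∀ {Z} {f g : Z ⇒ A} → f ≈ g → φ f ≈ φ g) →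
      (∀ {Z} {f g : Z ⇒ B} → f ≈ g → ψ f ≈ ψ g) →
      (∀ {Y Z} {f : Z ⇒ A} {g : Y ⇒ Z} → φ (f ∘ g) ≈ φ f ∘ g) →
      (∀ {Z} {f : Z ⇒ A} → ψ (φ f) ≈ f) →
      (∀ {Z} {f : Z ⇒ B} → φ (ψ f) ≈ f) →
      A ≅ B
    yoneda φ ψ φ≈ ψ≈ nat ψφ φψ = record
      { to = φ id
      ; from = ψ id
      ; isoˡ = begin
          ψ id ∘ φ id            ≈⟨ ψφ ⟨
          ψ (φ (ψ id ∘ φ id))    ≈⟨ ψ≈ nat ⟩
          ψ (φ (ψ id) ∘ φ id)    ≈⟨ ψ≈ (precomp φψ) ⟩
          ψ (id ∘ φ id)          ≈⟨ ψ≈ identityˡ ⟩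
          ψ (φ id)               ≈⟨ ψφ ⟩
          id                     ∎
      ; isoʳ = begin
          φ id ∘ ψ id            ≈⟨ nat ⟨
          φ (id ∘ ψ id)          ≈⟨ φ≈ identityˡ ⟩
          φ (ψ id)               ≈⟨ φψ ⟩
          id                     ∎
      }

  -- The isomorphisms behind the axioms

  ≅-refl : ∀ {A} → A ≅ A
  ≅-refl = record { to = id ; from = id ; isoˡ = identityˡ ; isoʳ = identityˡ }

  ≅-sym : ∀ {A B} → A ≅ B → B ≅ A
  ≅-sym i = record { to = from ; from = to ; isoˡ = isoʳ ; isoʳ = isoˡ }
    where open _≅_[_] i

  ≅-trans : ∀ {A B D} → A ≅ B → B ≅ D → A ≅ D
  ≅-trans i j = record
    { to = J.to ∘ I.to
    ; from = I.from ∘ J.from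
    ; isoˡ = Eq.trans assoc (Eq.trans (postcomp (cancelˡ J.isoˡ)) I.isoˡ)
    ; isoʳ = Eq.trans assoc (Eq.trans (postcomp (cancelˡ I.isoʳ)) J.isoʳ)
    }
    where
    module I = _≅_[_] i
    module J = _≅_[_] j

  ⊗-≅ : ∀ {A A′ B B′} → A ≅ A′ → B ≅ B′ → (A ⊗₀ B) ≅ (A′ ⊗₀ B′)
  ⊗-≅ i j = record
    { to = I.to ⊗₁ J.to
    ; from = I.from ⊗₁ J.from
    ; isoˡ = Eq.trans (Eq.sym ⊗-homomorphism) (Eq.trans (⊗-resp-≈ I.isoˡ J.isoˡ) ⊗-identity)
    ; isoʳ = Eq.trans (Eq.sym ⊗-homomorphism) (Eq.trans (⊗-resp-≈ I.isoʳ J.isoʳ) ⊗-identity)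
    }
    where
    module I = _≅_[_] i
    module J = _≅_[_] j

  ⊸-≅ : ∀ {A A′ B B′} → A ≅ A′ → B ≅ B′ → [ A , B ] ≅ [ A′ , B′ ]
  ⊸-≅ i j = yoneda
    (λ f → curry ((J.to ∘ uncurry f) ∘ (id ⊗₁ I.from)))
    (λ f → curry ((J.from ∘ uncurry f) ∘ (id ⊗₁ I.to)))
    (λ q → curry-resp (precomp (postcomp (uncurry-resp q))))
    (λ q → curry-resp (precomp (postcomp (uncurry-resp q))))
    (λ {_} {_} {f} {g} → Eq.trans (curry-resp (begin
      (J.to ∘ uncurry (f ∘ g)) ∘ (id ⊗₁ I.from)       ≈⟨ precomp (postcomp uncurry-∘) ⟩
      (J.to ∘ (uncurry f ∘ (g ⊗₁ id))) ∘ (id ⊗₁ I.from) ≈⟨ precomp assoc ⟨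
      ((J.to ∘ uncurry f) ∘ (g ⊗₁ id)) ∘ (id ⊗₁ I.from) ≈⟨ assoc ⟩
      (J.to ∘ uncurry f) ∘ ((g ⊗₁ id) ∘ (id ⊗₁ I.from)) ≈⟨ postcomp slide ⟩
      (J.to ∘ uncurry f) ∘ ((id ⊗₁ I.from) ∘ (g ⊗₁ id)) ≈⟨ assoc ⟨
      ((J.to ∘ uncurry f) ∘ (id ⊗₁ I.from)) ∘ (g ⊗₁ id) ∎)) (Eq.sym curry-∘))
    (Eq.trans (curry-resp (undo I.isoˡ J.isoˡ)) curry-η)
    (Eq.trans (curry-resp (undo I.isoʳ J.isoʳ)) curry-η)
    where
    module I = _≅_[_] i
    module J = _≅_[_] j
    undo : ∀ {Z A A′ B B′} {f : Z ⇒ [ A , B ]} {u : B ⇒ B′} {u′ : B′ ⇒ B} {v : A′ ⇒ A} {v′ : A ⇒ A′} →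
           v ∘ v′ ≈ id → u′ ∘ u ≈ id →
           (u′ ∘ uncurry (curry ((u ∘ uncurry f) ∘ (id ⊗₁ v)))) ∘ (id ⊗₁ v′) ≈ uncurry f
    undo {f = f} {u} {u′} {v} {v′} q r = begin
      (u′ ∘ uncurry (curry ((u ∘ uncurry f) ∘ (id ⊗₁ v)))) ∘ (id ⊗₁ v′)
        ≈⟨ precomp (postcomp curry-β) ⟩
      (u′ ∘ ((u ∘ uncurry f) ∘ (id ⊗₁ v))) ∘ (id ⊗₁ v′)
        ≈⟨ precomp assoc ⟨
      ((u′ ∘ (u ∘ uncurry f)) ∘ (id ⊗₁ v)) ∘ (id ⊗₁ v′)
        ≈⟨ precomp (precomp (cancelˡ r)) ⟩
      (uncurry f ∘ (id ⊗₁ v)) ∘ (id ⊗₁ v′)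
        ≈⟨ cancelʳ (Eq.trans (Eq.sym ⊗-homomorphism)
                    (Eq.trans (⊗-resp-≈ identityˡ q) ⊗-identity)) ⟩
      uncurry f ∎

  ×-≅ : ∀ {A A′ B B′} → A ≅ A′ → B ≅ B′ → (A × B) ≅ (A′ × B′)
  ×-≅ i j = record
    { to = ⟨ I.to ∘ π₁ , J.to ∘ π₂ ⟩
    ; from = ⟨ I.from ∘ π₁ , J.from ∘ π₂ ⟩
    ; isoˡ = undo I.isoˡ J.isoˡ
    ; isoʳ = undo I.isoʳ J.isoʳ
    }
    where
    module I = _≅_[_] i
    module J = _≅_[_] j
    undo : ∀ {A A′ B B′} {u : A ⇒ A′} {u′ : A′ ⇒ A} {v : B ⇒ B′} {v′ : B′ ⇒ B} →
           u′ ∘ u ≈ id → v′ ∘ v ≈ id → ⟨ u′ ∘ π₁ , v′ ∘ π₂ ⟩ ∘ ⟨ u ∘ π₁ , v ∘ π₂ ⟩ ≈ id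
    undo q r = π-ext
      (Eq.trans (Eq.sym assoc) (Eq.trans (precomp project₁) (Eq.trans assoc
        (Eq.trans (postcomp project₁) (Eq.trans (cancelˡ q) (Eq.sym identityʳ))))))
      (Eq.trans (Eq.sym assoc) (Eq.trans (precomp project₂) (Eq.trans assoc
        (Eq.trans (postcomp project₂) (Eq.trans (cancelˡ r) (Eq.sym identityʳ))))))

  curry-≅ : ∀ {A B D} → [ A ⊗₀ B , D ] ≅ [ A , [ B , D ] ]
  curry-≅ = yoneda
    (λ f → curry (curry (uncurry f ∘ α⇒)))
    (λ f → curry (uncurry (uncurry f) ∘ α⇐))
    (λ q → curry-resp (curry-resp (precomp (uncurry-resp q))))
    (λ q → curry-resp (precomp (uncurry-resp (uncurry-resp q))))
    (λ {_} {_} {f} {g} → Eq.trans (curry-resp (Eq.trans (curry-resp (begin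
      uncurry (f ∘ g) ∘ α⇒                ≈⟨ precomp uncurry-∘ ⟩
      (uncurry f ∘ (g ⊗₁ id)) ∘ α⇒        ≈⟨ assoc ⟩
      uncurry f ∘ ((g ⊗₁ id) ∘ α⇒)        ≈⟨ postcomp (precomp (⊗-resp-≈ Eq.refl (Eq.sym ⊗-identity))) ⟩
      uncurry f ∘ ((g ⊗₁ (id ⊗₁ id)) ∘ α⇒) ≈⟨ postcomp α-natural ⟨
      uncurry f ∘ (α⇒ ∘ ((g ⊗₁ id) ⊗₁ id)) ≈⟨ assoc ⟨
      (uncurry f ∘ α⇒) ∘ ((g ⊗₁ id) ⊗₁ id) ∎)) (Eq.sym curry-∘))) (Eq.sym curry-∘))
    (λ {_} {f} → Eq.trans (curry-resp (begin
      uncurry (uncurry (curry (curry (uncurry f ∘ α⇒)))) ∘ α⇐ ≈⟨ precomp (uncurry-resp curry-β) ⟩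
      uncurry (curry (uncurry f ∘ α⇒)) ∘ α⇐                   ≈⟨ precomp curry-β ⟩
      (uncurry f ∘ α⇒) ∘ α⇐                                   ≈⟨ cancelʳ α-isoʳ ⟩
      uncurry f                                               ∎)) curry-η)
    (λ {_} {f} → Eq.trans (curry-resp (Eq.trans (curry-resp (begin
      uncurry (curry (uncurry (uncurry f) ∘ α⇐)) ∘ α⇒ ≈⟨ precomp curry-β ⟩
      (uncurry (uncurry f) ∘ α⇐) ∘ α⇒                 ≈⟨ cancelʳ α-isoˡ ⟩
      uncurry (uncurry f)                             ∎)) curry-η)) curry-η)

  unit-≅ : ∀ {A} → A ≅ [ unit , A ]
  unit-≅ = yoneda
    (λ f → curry (f ∘ ρ⇒))
    (λ f → uncurry f ∘ ρ⇐)
    (λ q → curry-resp (precomp q))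
    (λ q → precomp (uncurry-resp q))
    (Eq.trans (curry-resp (Eq.trans assoc (Eq.trans (postcomp (Eq.sym ρ-natural)) (Eq.sym assoc))))
              (Eq.sym curry-∘))
    (Eq.trans (precomp curry-β) (cancelʳ ρ-isoʳ))
    (Eq.trans (curry-resp (cancelʳ ρ-isoˡ)) curry-η)

  ×-hom-≅ : ∀ {A B D} → [ A , B × D ] ≅ ([ A , B ] × [ A , D ])
  ×-hom-≅ = yoneda
    (λ f → ⟨ curry (π₁ ∘ uncurry f) , curry (π₂ ∘ uncurry f) ⟩)
    (λ f → curry ⟨ uncurry (π₁ ∘ f) , uncurry (π₂ ∘ f) ⟩)
    (λ q → ⟨⟩-resp (curry-resp (postcomp (uncurry-resp q))) (curry-resp (postcomp (uncurry-resp q))))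
    (λ q → curry-resp (⟨⟩-resp (uncurry-resp (postcomp q)) (uncurry-resp (postcomp q))))
    (Eq.trans (⟨⟩-resp nat nat) ⟨⟩-∘)
    (Eq.trans (curry-resp (Eq.sym (⟨⟩-unique
      (Eq.sym (Eq.trans (uncurry-resp project₁) curry-β))
      (Eq.sym (Eq.trans (uncurry-resp project₂) curry-β))))) curry-η)
    (Eq.sym (⟨⟩-unique
      (Eq.sym (Eq.trans (curry-resp (Eq.trans (postcomp curry-β) project₁)) curry-η))
      (Eq.sym (Eq.trans (curry-resp (Eq.trans (postcomp curry-β) project₂)) curry-η))))
    where
    nat : ∀ {Y Z A B D} {k : B ⇒ D} {f : Z ⇒ [ A , B ]} {g : Y ⇒ Z} →
          curry (k ∘ uncurry (f ∘ g)) ≈ curry (k ∘ uncurry f) ∘ g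
    nat = Eq.trans (curry-resp (Eq.trans (postcomp uncurry-∘) (Eq.sym assoc))) (Eq.sym curry-∘)

  ⊤-hom-≅ : ∀ {A} → [ A , terminal ] ≅ terminal
  ⊤-hom-≅ = yoneda (λ _ → !) (λ _ → curry !) (λ _ → Eq.refl) (λ _ → Eq.refl)
    (Eq.sym (!-unique _))
    (Eq.trans (curry-resp (Eq.sym (!-unique _))) curry-η)
    (Eq.sym (!-unique _))

  ×-assoc-≅ : ∀ {A B D} → (A × (B × D)) ≅ ((A × B) × D)
  ×-assoc-≅ = yoneda
    (λ f → ⟨ ⟨ π₁ ∘ f , π₁ ∘ (π₂ ∘ f) ⟩ , π₂ ∘ (π₂ ∘ f) ⟩)
    (λ f → ⟨ π₁ ∘ (π₁ ∘ f) , ⟨ π₂ ∘ (π₁ ∘ f) , π₂ ∘ f ⟩ ⟩)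
    (λ q → ⟨⟩-resp (⟨⟩-resp (postcomp q) (postcomp (postcomp q))) (postcomp (postcomp q)))
    (λ q → ⟨⟩-resp (postcomp (postcomp q)) (⟨⟩-resp (postcomp (postcomp q)) (postcomp q)))
    (Eq.trans (⟨⟩-resp (Eq.trans (⟨⟩-resp (Eq.sym assoc) assoc₂) ⟨⟩-∘) assoc₂) ⟨⟩-∘)
    (Eq.sym (⟨⟩-unique
      (Eq.sym (Eq.trans (postcomp project₁) project₁))
      (⟨⟩-unique (Eq.sym (Eq.trans (postcomp project₁) project₂)) (Eq.sym project₂))))
    (Eq.sym (⟨⟩-unique
      (⟨⟩-unique (Eq.sym project₁) (Eq.sym (Eq.trans (postcomp project₂) project₁)))
      (Eq.sym (Eq.trans (postcomp project₂) project₂))))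
    where
    assoc₂ : ∀ {A B D E F} {f : E ⇒ F} {g : D ⇒ E} {h : B ⇒ D} {k : A ⇒ B} →
             f ∘ (g ∘ (h ∘ k)) ≈ (f ∘ (g ∘ h)) ∘ k
    assoc₂ = Eq.trans (postcomp (Eq.sym assoc)) (Eq.sym assoc)

  ×-comm-≅ : ∀ {A B} → (A × B) ≅ (B × A)
  ×-comm-≅ = record
    { to = ⟨ π₂ , π₁ ⟩ ; from = ⟨ π₂ , π₁ ⟩ ; isoˡ = invol ; isoʳ = invol }
    where
    invol : ∀ {A B} → ⟨ π₂ {B} {A} , π₁ ⟩ ∘ ⟨ π₂ {A} {B} , π₁ ⟩ ≈ id
    invol = π-ext
      (Eq.trans (Eq.sym assoc) (Eq.trans (precomp project₁) (Eq.trans project₂ (Eq.sym identityʳ))))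
      (Eq.trans (Eq.sym assoc) (Eq.trans (precomp project₂) (Eq.trans project₁ (Eq.sym identityʳ))))

  ×-unit-≅ : ∀ {A} → (A × terminal) ≅ A
  ×-unit-≅ = record
    { to = π₁ ; from = ⟨ id , ! ⟩
    ; isoˡ = π-ext
        (Eq.trans (Eq.sym assoc) (Eq.trans (precomp project₁) (Eq.trans identityˡ (Eq.sym identityʳ))))
        (Eq.trans (!-unique _) (Eq.sym (!-unique _)))
    ; isoʳ = project₁ }

  sound : ∀ {X : Set} {F G : Formula X} (ρ : X → Obj) → F =S G → ⟦ F ⟧ C [ ρ ] ≅ ⟦ G ⟧ C [ ρ ]
  sound ρ refl = ≅-refl
  sound ρ (sym q) = ≅-sym (sound ρ q)
  sound ρ (trans q r) = ≅-trans (sound ρ q) (sound ρ r)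
  sound ρ (⊗-cong q r) = ⊗-≅ (sound ρ q) (sound ρ r)
  sound ρ (⊸-cong q r) = ⊸-≅ (sound ρ q) (sound ρ r)
  sound ρ (&-cong q r) = ×-≅ (sound ρ q) (sound ρ r)
  sound ρ ⊗-assoc = record { to = α⇐ ; from = α⇒ ; isoˡ = α-isoʳ ; isoʳ = α-isoˡ }
  sound ρ ⊗-comm = record { to = σ ; from = σ ; isoˡ = σ-involutive ; isoʳ = σ-involutive }
  sound ρ ⊗-unit = record { to = ρ⇒ ; from = ρ⇐ ; isoˡ = ρ-isoˡ ; isoʳ = ρ-isoʳ }
  sound ρ curry-ax = curry-≅
  sound ρ ⊸-unit = ≅-sym unit-≅
  sound ρ &-assoc = ×-assoc-≅
  sound ρ &-comm = ×-comm-≅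
  sound ρ &-unit = ×-unit-≅
  sound ρ ⊸-& = ×-hom-≅
  sound ρ ⊸-⊤ = ⊤-hom-≅

open import Algebra.Bundles using (CommutativeMonoid)
import Algebra.Properties.CommutativeMonoid.Sum as Sum
open import Data.Empty using (⊥; ⊥-elim)
open import Data.Unit using (⊤; tt)
open import Data.Bool using (Bool; true; false; _∧_; _∨_; not; if_then_else_)
open import Data.Fin using (Fin; zero; suc)
open import Data.Bool.Properties using (∧-identityʳ)
import Data.Fin.Properties as Fin
open import Data.Fin.Permutation using (permutation)
open import Data.List using (List; []; _∷_; _++_; length; lookup)
open import Data.List.Properties using (++-identityʳ)
open import Data.List.Relation.Unary.All as All using (All; []; _∷_)
open import Data.List.Relation.Unary.Any using (here; there; index)
open import Data.List.Membership.Propositional using (_∈_)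
open import Data.List.Membership.Propositional.Properties using (∈-lookup)
open import Data.Product using (Σ; _×_; _,_; proj₁; proj₂)
open import Data.Sum using (_⊎_; inj₁; inj₂)
open import Relation.Nullary using (yes; no)
open import Relation.Binary.PropositionalEquality as ≡ using (_≡_; _≢_; refl; cong; cong₂; subst; subst₂)

-- The acts

-- d0 is zero, d1 the unit, and dx, dy multiply to zero with themselves and with each other.
data Deg : Set where
  d0 d1 dx dy : Deg

infixl 7 _*_
_*_ : Deg → Deg → Deg
d0 * y = d0
d1 * y = y
dx * d0 = d0
dx * d1 = dx
dx * dx = d0
dx * dy = d0
dy * d0 = d0
dy * d1 = dy
dy * dx = d0
dy * dy = d0

*-identityʳ : ∀ x → x * d1 ≡ x
*-identityʳ d0 = refl
*-identityʳ d1 = refl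
*-identityʳ dx = refl
*-identityʳ dy = refl

*-zeroʳ : ∀ x → x * d0 ≡ d0
*-zeroʳ d0 = refl
*-zeroʳ d1 = refl
*-zeroʳ dx = refl
*-zeroʳ dy = refl

*-comm : ∀ x y → x * y ≡ y * x
*-comm d0 y = ≡.sym (*-zeroʳ y)
*-comm d1 y = ≡.sym (*-identityʳ y)
*-comm dx d0 = refl
*-comm dx d1 = refl
*-comm dx dx = refl
*-comm dx dy = refl
*-comm dy d0 = refl
*-comm dy d1 = refl
*-comm dy dx = refl
*-comm dy dy = refl

*-assoc : ∀ x y w → (x * y) * w ≡ x * (y * w)
*-assoc d0 y w = refl
*-assoc d1 y w = refl
*-assoc dx d0 w = refl
*-assoc dx d1 w = refl
*-assoc dx dx d0 = refl
*-assoc dx dx d1 = refl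
*-assoc dx dx dx = refl
*-assoc dx dx dy = refl
*-assoc dx dy d0 = refl
*-assoc dx dy d1 = refl
*-assoc dx dy dx = refl
*-assoc dx dy dy = refl
*-assoc dy d0 w = refl
*-assoc dy d1 w = refl
*-assoc dy dx d0 = refl
*-assoc dy dx d1 = refl
*-assoc dy dx dx = refl
*-assoc dy dx dy = refl
*-assoc dy dy d0 = refl
*-assoc dy dy d1 = refl
*-assoc dy dy dx = refl
*-assoc dy dy dy = refl

-- These degrees form an ideal (`nonE-*ˡ`) with square zero (`nonE-*²`): one factor of such a degree
-- keeps a tensor away from degree `d1`, two give it degree `d0`.
NonE : Deg → Set
NonE d1 = ⊥
NonE _ = ⊤

nonE-*ˡ : ∀ x y → NonE x → NonE (x * y)
nonE-*ˡ d0 y _ = tt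
nonE-*ˡ dx d0 _ = tt
nonE-*ˡ dx d1 _ = tt
nonE-*ˡ dx dx _ = tt
nonE-*ˡ dx dy _ = tt
nonE-*ˡ dy d0 _ = tt
nonE-*ˡ dy d1 _ = tt
nonE-*ˡ dy dx _ = tt
nonE-*ˡ dy dy _ = tt

nonE-*ʳ : ∀ x y → NonE y → NonE (x * y)
nonE-*ʳ x y n = subst NonE (*-comm y x) (nonE-*ˡ y x n)

nonE-*² : ∀ x y → NonE x → NonE y → x * y ≡ d0
nonE-*² d0 y _ _ = refl
nonE-*² dx d0 _ _ = refl
nonE-*² dx dx _ _ = refl
nonE-*² dx dy _ _ = refl
nonE-*² dy d0 _ _ = refl
nonE-*² dy dx _ _ = refl
nonE-*² dy dy _ _ = refl

-- A set with an action of the monoid {0, 1, p}, where p squared is 0, lying over the degrees.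
-- Equality is a field because the tensor is a quotient. By `p-kill` only elements of degree `d1`
-- can have a nonzero p-part.
record Act : Set₁ where
  infix 4 _≈_
  field
    Car    : Set
    _≈_    : Car → Car → Set
    equiv  : IsEquivalence _≈_
    deg    : Car → Deg
    deg-≈  : ∀ {a b} → a ≈ b → deg a ≡ deg b
    z      : Car
    deg-z  : deg z ≡ d0
    p      : Car → Car
    p-≈    : ∀ {a b} → a ≈ b → p a ≈ p b
    deg-p  : ∀ a → deg (p a) ≡ d0
    p-kill : ∀ a → NonE (deg a) → p a ≈ z
  open IsEquivalence equiv public
    renaming (refl to ≈-refl; sym to ≈-sym; trans to ≈-trans; reflexive to ≈-reflexive)

open Act using (Car)

p-z : (A : Act) → Act._≈_ A (Act.p A (Act.z A)) (Act.z A)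
p-z A = Act.p-kill A _ (subst NonE (≡.sym (Act.deg-z A)) tt)

p-p : (A : Act) → ∀ a → Act._≈_ A (Act.p A (Act.p A a)) (Act.z A)
p-p A a = Act.p-kill A _ (subst NonE (≡.sym (Act.deg-p A a)) tt)

infix 3 _⇒_
record _⇒_ (A B : Act) : Set where
  private
    module A = Act A
    module B = Act B
  field
    fun  : Car A → Car B
    resp : ∀ {a b} → a A.≈ b → fun a B.≈ fun b
    dg   : ∀ a → B.deg (fun a) ≡ A.deg a
    fz   : fun A.z B.≈ B.z
    fp   : ∀ a → fun (A.p a) B.≈ B.p (fun a)

open _⇒_ public

infix 2 _≐_
_≐_ : ∀ {A B} → A ⇒ B → A ⇒ B → Set
_≐_ {A} {B} f g = ∀ a → Act._≈_ B (fun f a) (fun g a)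

infixr 9 _∙_
_∙_ : ∀ {A B C} → B ⇒ C → A ⇒ B → A ⇒ C
_∙_ {A} {B} {C} g f = record
  { fun = λ a → fun g (fun f a)
  ; resp = λ q → resp g (resp f q)
  ; dg = λ a → ≡.trans (dg g _) (dg f a)
  ; fz = Act.≈-trans C (resp g (fz f)) (fz g)
  ; fp = λ a → Act.≈-trans C (resp g (fp f a)) (fp g _)
  }

idₐ : ∀ {A} → A ⇒ A
idₐ {A} = record
  { fun = λ a → a ; resp = λ q → q ; dg = λ _ → refl
  ; fz = Act.≈-refl A ; fp = λ _ → Act.≈-refl A }

data Scal : Set where
  nul one eps : Scal

infixr 8 _•[_]_
_•[_]_ : Scal → (A : Act) → Car A → Car A
nul •[ A ] a = Act.z A
one •[ A ] a = a
eps •[ A ] a = Act.p A a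

unitₐ : Act
unitₐ = record
  { Car = Scal ; _≈_ = _≡_ ; equiv = ≡.isEquivalence
  ; deg = dS ; deg-≈ = cong dS ; z = nul ; deg-z = refl
  ; p = pS ; p-≈ = cong pS ; deg-p = dpS ; p-kill = killS }
  where
  dS : Scal → Deg
  dS nul = d0
  dS one = d1
  dS eps = d0
  pS : Scal → Scal
  pS nul = nul
  pS one = eps
  pS eps = nul
  dpS : ∀ a → dS (pS a) ≡ d0
  dpS nul = refl
  dpS one = refl
  dpS eps = refl
  killS : ∀ a → NonE (dS a) → pS a ≡ nul
  killS nul _ = refl
  killS eps _ = refl

topₐ : Act
topₐ = record
  { Car = Deg ; _≈_ = _≡_ ; equiv = ≡.isEquivalence
  ; deg = λ x → x ; deg-≈ = λ q → q ; z = d0 ; deg-z = refl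
  ; p = λ _ → d0 ; p-≈ = λ _ → refl ; deg-p = λ _ → refl ; p-kill = λ _ _ → refl }

infixr 5 _×ₐ_
-- Morphisms preserve degrees, so the product is the fibre product over `Deg`.
_×ₐ_ : Act → Act → Act
A ×ₐ B = record
  { Car = Σ (Car A × Car B) λ x → A.deg (proj₁ x) ≡ B.deg (proj₂ x)
  ; _≈_ = λ x y → (proj₁ (proj₁ x) A.≈ proj₁ (proj₁ y)) × (proj₂ (proj₁ x) B.≈ proj₂ (proj₁ y))
  ; equiv = record
    { refl = A.≈-refl , B.≈-refl
    ; sym = λ q → A.≈-sym (proj₁ q) , B.≈-sym (proj₂ q)
    ; trans = λ q r → A.≈-trans (proj₁ q) (proj₁ r) , B.≈-trans (proj₂ q) (proj₂ r) }
  ; deg = λ x → A.deg (proj₁ (proj₁ x))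
  ; deg-≈ = λ q → A.deg-≈ (proj₁ q)
  ; z = (A.z , B.z) , ≡.trans A.deg-z (≡.sym B.deg-z)
  ; deg-z = A.deg-z
  ; p = λ x → (A.p (proj₁ (proj₁ x)) , B.p (proj₂ (proj₁ x))) ,
              ≡.trans (A.deg-p _) (≡.sym (B.deg-p _))
  ; p-≈ = λ q → A.p-≈ (proj₁ q) , B.p-≈ (proj₂ q)
  ; deg-p = λ x → A.deg-p _
  ; p-kill = λ x n → A.p-kill _ n , B.p-kill _ (subst NonE (proj₂ x) n)
  }
  where
  module A = Act A
  module B = Act B

module _ (A B : Act) where
  private
    module A = Act A
    module B = Act B

  -- The tensor over {0, 1, p}: a smash product in which `p` moves across by `pp`.
  data Tensor≈ : Car A × Car B → Car A × Car B → Set where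
    cmp : ∀ {a a′ b b′} → a A.≈ a′ → b B.≈ b′ → Tensor≈ (a , b) (a′ , b′)
    zl  : ∀ {b} → Tensor≈ (A.z , b) (A.z , B.z)
    zr  : ∀ {a} → Tensor≈ (a , B.z) (A.z , B.z)
    pp  : ∀ {a b} → Tensor≈ (A.p a , b) (a , B.p b)
    ~sym   : ∀ {x y} → Tensor≈ x y → Tensor≈ y x
    ~trans : ∀ {x y w} → Tensor≈ x y → Tensor≈ y w → Tensor≈ x w

  private
    ~deg : ∀ {x y} → Tensor≈ x y → A.deg (proj₁ x) * B.deg (proj₂ x) ≡ A.deg (proj₁ y) * B.deg (proj₂ y)
    ~deg (cmp q r) = cong₂ _*_ (A.deg-≈ q) (B.deg-≈ r)
    ~deg zl rewrite A.deg-z = refl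
    ~deg (zr {a}) rewrite A.deg-z | B.deg-z = *-zeroʳ (A.deg a)
    ~deg (pp {a} {b}) rewrite A.deg-p a | B.deg-p b = ≡.sym (*-zeroʳ (A.deg a))
    ~deg (~sym q) = ≡.sym (~deg q)
    ~deg (~trans q r) = ≡.trans (~deg q) (~deg r)

    ~p : ∀ {x y} → Tensor≈ x y → Tensor≈ (A.p (proj₁ x) , proj₂ x) (A.p (proj₁ y) , proj₂ y)
    ~p (cmp q r) = cmp (A.p-≈ q) r
    ~p zl = ~trans (cmp (p-z A) B.≈-refl) (~trans zl (cmp (A.≈-sym (p-z A)) B.≈-refl))
    ~p zr = ~trans zr (cmp (A.≈-sym (p-z A)) B.≈-refl)
    ~p pp = pp
    ~p (~sym q) = ~sym (~p q)
    ~p (~trans q r) = ~trans (~p q) (~p r)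

    ~kill : ∀ a b → NonE (A.deg a * B.deg b) → Tensor≈ (A.p a , b) (A.z , B.z)
    ~kill a b n with A.deg a in eq
    -- Here the product is the degree of `b`, so `p` is moved across and vanishes there.
    ... | d1 = ~trans pp (~trans (cmp A.≈-refl (B.p-kill b n)) zr)
    ... | d0 = ~trans (cmp (A.p-kill a (subst NonE (≡.sym eq) tt)) B.≈-refl) zl
    ... | dx = ~trans (cmp (A.p-kill a (subst NonE (≡.sym eq) tt)) B.≈-refl) zl
    ... | dy = ~trans (cmp (A.p-kill a (subst NonE (≡.sym eq) tt)) B.≈-refl) zl

  -- The p-action of the tensor is chosen on the left factor; pp makes this choice immaterial.
  infixr 10 _⊗ₐ_
  _⊗ₐ_ : Act
  _⊗ₐ_ = record
    { Car = Car A × Car B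
    ; _≈_ = Tensor≈
    ; equiv = record { refl = cmp A.≈-refl B.≈-refl ; sym = ~sym ; trans = ~trans }
    ; deg = λ x → A.deg (proj₁ x) * B.deg (proj₂ x)
    ; deg-≈ = ~deg
    ; z = A.z , B.z
    ; deg-z = cong (_* B.deg B.z) A.deg-z
    ; p = λ x → A.p (proj₁ x) , proj₂ x
    ; p-≈ = ~p
    ; deg-p = λ x → cong (_* B.deg (proj₂ x)) (A.deg-p (proj₁ x))
    ; p-kill = λ { (a , b) → ~kill a b }
    }

record Bilinear (A B C : Act) : Set where
  private
    module A = Act A
    module B = Act B
    module C = Act C
  field
    fun₂  : Car A → Car B → Car C
    resp₂ : ∀ {a a′ b b′} → a A.≈ a′ → b B.≈ b′ → fun₂ a b C.≈ fun₂ a′ b′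
    dg₂   : ∀ a b → C.deg (fun₂ a b) ≡ A.deg a * B.deg b
    zˡ    : ∀ b → fun₂ A.z b C.≈ C.z
    zʳ    : ∀ a → fun₂ a B.z C.≈ C.z
    pˡ    : ∀ a b → fun₂ (A.p a) b C.≈ C.p (fun₂ a b)
    pʳ    : ∀ a b → fun₂ a (B.p b) C.≈ C.p (fun₂ a b)

  lin : A ⊗ₐ B ⇒ C
  lin = record
    { fun = λ x → fun₂ (proj₁ x) (proj₂ x)
    ; resp = go
    ; dg = λ x → dg₂ (proj₁ x) (proj₂ x)
    ; fz = zˡ _
    ; fp = λ x → pˡ (proj₁ x) (proj₂ x) }
    where
    go : ∀ {x y} → Tensor≈ A B x y → fun₂ (proj₁ x) (proj₂ x) C.≈ fun₂ (proj₁ y) (proj₂ y)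
    go (cmp q r) = resp₂ q r
    go zl = C.≈-trans (zˡ _) (C.≈-sym (zˡ _))
    go zr = C.≈-trans (zʳ _) (C.≈-sym (zˡ _))
    go pp = C.≈-trans (pˡ _ _) (C.≈-sym (pʳ _ _))
    go (~sym q) = C.≈-sym (go q)
    go (~trans q r) = C.≈-trans (go q) (go r)

open Bilinear using (lin)

infixr 10 _⊗ₘ_
_⊗ₘ_ : ∀ {A B C D} → A ⇒ B → C ⇒ D → A ⊗ₐ C ⇒ B ⊗ₐ D
_⊗ₘ_ {A} {B} {C} {D} f g = lin (record
  { fun₂ = λ a c → fun f a , fun g c
  ; resp₂ = λ q r → cmp (resp f q) (resp g r)
  ; dg₂ = λ a c → cong₂ _*_ (dg f a) (dg g c)
  ; zˡ = λ c → ~trans (cmp (fz f) (Act.≈-refl D)) zl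
  ; zʳ = λ a → ~trans (cmp (Act.≈-refl B) (fz g)) zr
  ; pˡ = λ a c → cmp (fp f a) (Act.≈-refl D)
  ; pʳ = λ a c → ~trans (cmp (Act.≈-refl B) (fp g c)) (~sym pp)
  })

σₐ : ∀ {A B} → A ⊗ₐ B ⇒ B ⊗ₐ A
σₐ {A} {B} = lin (record
  { fun₂ = λ a b → b , a
  ; resp₂ = λ q r → cmp r q
  ; dg₂ = λ a b → *-comm (Act.deg B b) (Act.deg A a)
  ; zˡ = λ b → zr
  ; zʳ = λ a → zl
  ; pˡ = λ a b → ~sym pp
  ; pʳ = λ a b → Act.≈-refl (B ⊗ₐ A)
  })

module _ {A B C : Act} where
  private
    module A = Act A
    module B = Act B
    module C = Act C
    X : Act
    X = A ⊗ₐ (B ⊗ₐ C)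
    module X = Act X

  private
    go : ∀ {x y c} → Tensor≈ A B x y → (proj₁ x , (proj₂ x , c)) X.≈ (proj₁ y , (proj₂ y , c))
    go (cmp q r) = cmp q (cmp r C.≈-refl)
    go zl = ~trans zl (~sym zl)
    go zr = ~trans (cmp A.≈-refl zl) (~trans zr (~sym zl))
    go pp = pp
    go (~sym q) = ~sym (go q)
    go (~trans q r) = ~trans (go q) (go r)

  αₐ : (A ⊗ₐ B) ⊗ₐ C ⇒ A ⊗ₐ (B ⊗ₐ C)
  αₐ = lin (record
    { fun₂ = λ x c → proj₁ x , (proj₂ x , c)
    ; resp₂ = λ q r → ~trans (cmp A.≈-refl (cmp B.≈-refl r)) (go q)
    ; dg₂ = λ x c → ≡.sym (*-assoc (A.deg (proj₁ x)) (B.deg (proj₂ x)) (C.deg c))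
    ; zˡ = λ c → zl
    ; zʳ = λ x → ~trans (cmp A.≈-refl zr) zr
    ; pˡ = λ x c → X.≈-refl
    ; pʳ = λ x c → ~trans (cmp A.≈-refl (~sym pp)) (~sym pp)
    })

-- Conjugating `αₐ` by symmetries avoids a second check of bilinearity; on triples it computes to
-- plain re-bracketing.
αₐ⁻ : ∀ {A B C} → A ⊗ₐ (B ⊗ₐ C) ⇒ (A ⊗ₐ B) ⊗ₐ C
αₐ⁻ = σₐ ∙ (idₐ ⊗ₘ σₐ) ∙ αₐ ∙ σₐ ∙ (idₐ ⊗ₘ σₐ)

module _ (A : Act) where
  private module A = Act A

  •-≈ : ∀ r {a b} → a A.≈ b → (r •[ A ] a) A.≈ (r •[ A ] b)
  •-≈ nul q = A.≈-refl
  •-≈ one q = q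
  •-≈ eps q = A.p-≈ q

  •-deg : ∀ r a → A.deg (r •[ A ] a) ≡ Act.deg unitₐ r * A.deg a
  •-deg nul a = A.deg-z
  •-deg one a = refl
  •-deg eps a = A.deg-p a

  •-z : ∀ r → (r •[ A ] A.z) A.≈ A.z
  •-z nul = A.≈-refl
  •-z one = A.≈-refl
  •-z eps = p-z A

  •-pˡ : ∀ r a → (Act.p unitₐ r •[ A ] a) A.≈ A.p (r •[ A ] a)
  •-pˡ nul a = A.≈-sym (p-z A)
  •-pˡ one a = A.≈-refl
  •-pˡ eps a = A.≈-sym (p-p A a)

  •-pʳ : ∀ r a → (r •[ A ] A.p a) A.≈ A.p (r •[ A ] a)
  •-pʳ nul a = A.≈-sym (p-z A)
  •-pʳ one a = A.≈-refl
  •-pʳ eps a = A.≈-refl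

  λₐ : unitₐ ⊗ₐ A ⇒ A
  λₐ = lin (record
    { fun₂ = λ r a → r •[ A ] a
    ; resp₂ = λ { {r} refl q → •-≈ r q }
    ; dg₂ = •-deg
    ; zˡ = λ _ → A.≈-refl
    ; zʳ = •-z
    ; pˡ = •-pˡ
    ; pʳ = •-pʳ
    })

  λₐ⁻ : A ⇒ unitₐ ⊗ₐ A
  λₐ⁻ = record
    { fun = λ a → one , a
    ; resp = λ q → cmp refl q
    ; dg = λ a → refl
    ; fz = zr
    ; fp = λ a → ~sym pp
    }

•-fun : ∀ {A B} (f : A ⇒ B) r a → Act._≈_ B (fun f (r •[ A ] a)) (r •[ B ] fun f a)
•-fun {A} {B} f nul a = fz f
•-fun {A} {B} f one a = Act.≈-refl B
•-fun {A} {B} f eps a = fp f a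

ρₐ : ∀ A → A ⊗ₐ unitₐ ⇒ A
ρₐ A = λₐ A ∙ σₐ

ρₐ⁻ : ∀ A → A ⇒ A ⊗ₐ unitₐ
ρₐ⁻ A = σₐ ∙ λₐ⁻ A

module _ (A B : Act) where
  private
    module A = Act A
    module B = Act B

  -- `τ` is a field because `app` need not determine it: on arguments of degree other than `d1`, the
  -- values `d0`, `dx` and `dy` of `τ` make `app-d` say the same.
  record HomCar : Set where
    field
      τ     : Deg
      app   : Car A → Car B
      app-≈ : ∀ {a b} → a A.≈ b → app a B.≈ app b
      app-d : ∀ a → B.deg (app a) ≡ τ * A.deg a
      app-z : app A.z B.≈ B.z
      app-p : ∀ a → app (A.p a) B.≈ B.p (app a)

  open HomCar

  homₐ : Act
  homₐ = record
    { Car = HomCar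
    ; _≈_ = λ φ ψ → (τ φ ≡ τ ψ) × (∀ a → app φ a B.≈ app ψ a)
    ; equiv = record
      { refl = refl , λ _ → B.≈-refl
      ; sym = λ { (q , r) → ≡.sym q , λ a → B.≈-sym (r a) }
      ; trans = λ { (q , r) (q′ , r′) → ≡.trans q q′ , λ a → B.≈-trans (r a) (r′ a) } }
    ; deg = τ
    ; deg-≈ = proj₁
    ; z = record
      { τ = d0 ; app = λ _ → B.z ; app-≈ = λ _ → B.≈-refl ; app-d = λ _ → B.deg-z
      ; app-z = B.≈-refl ; app-p = λ _ → B.≈-sym (p-z B) }
    ; deg-z = refl
    ; p = λ φ → record
      { τ = d0 ; app = λ a → B.p (app φ a) ; app-≈ = λ q → B.p-≈ (app-≈ φ q)
      ; app-d = λ a → B.deg-p _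
      ; app-z = B.≈-trans (B.p-≈ (app-z φ)) (p-z B)
      ; app-p = λ a → B.p-≈ (app-p φ a) }
    ; p-≈ = λ { (_ , r) → refl , λ a → B.p-≈ (r a) }
    ; deg-p = λ _ → refl
    ; p-kill = λ φ n → refl , λ a → B.p-kill _ (subst NonE (≡.sym (app-d φ a)) (nonE-*ˡ (τ φ) (A.deg a) n))
    }

open HomCar public

evalₐ : ∀ {A B} → homₐ A B ⊗ₐ A ⇒ B
evalₐ {A} {B} = lin (record
  { fun₂ = app
  ; resp₂ = λ { {φ} (_ , r) q → B.≈-trans (app-≈ φ q) (r _) }
  ; dg₂ = app-d
  ; zˡ = λ _ → B.≈-refl
  ; zʳ = app-z
  ; pˡ = λ _ _ → B.≈-refl
  ; pʳ = app-p
  })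
  where module B = Act B

curryₐ : ∀ {A B C} → A ⊗ₐ B ⇒ C → A ⇒ homₐ B C
curryₐ {A} {B} {C} f = record
  { fun = λ a → record
    { τ = A.deg a ; app = λ b → fun f (a , b)
    ; app-≈ = λ q → resp f (cmp A.≈-refl q)
    ; app-d = λ b → dg f (a , b)
    ; app-z = C.≈-trans (resp f zr) (fz f)
    ; app-p = λ b → C.≈-trans (resp f (~sym pp)) (fp f _) }
  ; resp = λ q → A.deg-≈ q , λ b → resp f (cmp q B.≈-refl)
  ; dg = λ _ → refl
  ; fz = A.deg-z , λ b → C.≈-trans (resp f zl) (fz f)
  ; fp = λ a → A.deg-p a , λ b → fp f (a , b)
  }
  where
  module A = Act A
  module B = Act B
  module C = Act C

bangₐ : ∀ A → A ⇒ topₐ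
bangₐ A = record
  { fun = A.deg ; resp = A.deg-≈ ; dg = λ _ → refl ; fz = A.deg-z ; fp = A.deg-p }
  where module A = Act A

fstₐ : ∀ A B → A ×ₐ B ⇒ A
fstₐ A B = record
  { fun = λ x → proj₁ (proj₁ x) ; resp = proj₁ ; dg = λ _ → refl
  ; fz = Act.≈-refl A ; fp = λ _ → Act.≈-refl A }

sndₐ : ∀ A B → A ×ₐ B ⇒ B
sndₐ A B = record
  { fun = λ x → proj₂ (proj₁ x) ; resp = proj₂ ; dg = λ x → ≡.sym (proj₂ x)
  ; fz = Act.≈-refl B ; fp = λ _ → Act.≈-refl B }

pairₐ : ∀ {A B C} → C ⇒ A → C ⇒ B → C ⇒ A ×ₐ B
pairₐ f g = record
  { fun = λ c → (fun f c , fun g c) , ≡.trans (dg f c) (≡.sym (dg g c))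
  ; resp = λ q → resp f q , resp g q
  ; dg = dg f
  ; fz = fz f , fz g
  ; fp = λ c → fp f c , fp g c
  }

-- Cut-free proofs and their denotations

data Atomic : Set where
  base : Atomic
  tok  : Bool → Atomic

-- All atoms share this act: that matched atoms are equal is read off the axioms of the proofs.
atomₐ : Act
atomₐ = record
  { Car = Atomic ; _≈_ = _≡_ ; equiv = ≡.isEquivalence
  ; deg = λ _ → d0 ; deg-≈ = λ _ → refl ; z = base ; deg-z = refl
  ; p = λ _ → base ; p-≈ = λ _ → refl ; deg-p = λ _ → refl ; p-kill = λ _ _ → refl }

-- Tests and colours

∧-true : ∀ {a b} → a ∧ b ≡ true → (a ≡ true) × (b ≡ true)
∧-true {true} {true} _ = refl , refl

∧-intro : ∀ {a b} → a ≡ true → b ≡ true → a ∧ b ≡ true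
∧-intro refl refl = refl

clash : ∀ {b} → b ≡ true → b ≡ false → ⊥
clash refl ()

∧-falseˡ : ∀ {a} b → a ≡ false → a ∧ b ≡ false
∧-falseˡ b refl = refl

∧-falseʳ : ∀ a {b} → b ≡ false → a ∧ b ≡ false
∧-falseʳ true refl = refl
∧-falseʳ false refl = refl

-- The scalar `eps` is `p one`, so every test rejects it; a weak test may accept it.
record WeakTest (A : Act) : Set where
  private module A = Act A
  field
    θ   : A.Car → Bool
    θ-≈ : ∀ {a b} → a A.≈ b → θ a ≡ θ b
    θ-z : θ A.z ≡ false

-- A tensor identifies `(p a , b)` with `(a , p b)`; rejecting every `p a` makes the conjunction
-- `_⊠_` respect this.
record Test (A : Act) : Set where
  private module A = Act A
  field
    weak : WeakTest A
  open WeakTest weak public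
  field
    θ-p : ∀ a → θ (A.p a) ≡ false

open WeakTest using () renaming (θ to wθ)
open Test using (θ; θ-≈; θ-z; θ-p; weak)

Null : Act → Set
Null A = Σ (Car A) λ a → Act.deg A a ≡ d0

zero₀ : ∀ A → Null A
zero₀ A = Act.z A , Act.deg-z A

null-nonE : ∀ A (a : Null A) → NonE (Act.deg A (proj₁ a))
null-nonE A (a , q) = subst NonE (≡.sym q) tt

pull : ∀ {A B} → A ⇒ B → Test B → Test A
pull {A} {B} f T = record
  { weak = record
    { θ = λ a → θ T (fun f a)
    ; θ-≈ = λ q → θ-≈ T (resp f q)
    ; θ-z = ≡.trans (θ-≈ T (fz f)) (θ-z T) }
  ; θ-p = λ a → ≡.trans (θ-≈ T (fp f a)) (θ-p T (fun f a)) }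

infixr 6 _⊠_
_⊠_ : ∀ {A B} → Test A → Test B → Test (A ⊗ₐ B)
_⊠_ {A} {B} S T = record
  { weak = record
    { θ = λ x → θ S (proj₁ x) ∧ θ T (proj₂ x)
    ; θ-≈ = go
    ; θ-z = ∧-falseˡ _ (θ-z S) }
  ; θ-p = λ x → ∧-falseˡ _ (θ-p S (proj₁ x)) }
  where
  go : ∀ {x y} → Tensor≈ A B x y → θ S (proj₁ x) ∧ θ T (proj₂ x) ≡ θ S (proj₁ y) ∧ θ T (proj₂ y)
  go (cmp q r) = cong₂ _∧_ (θ-≈ S q) (θ-≈ T r)
  go zl = ≡.trans (∧-falseˡ _ (θ-z S)) (≡.sym (∧-falseˡ _ (θ-z S)))
  go (zr {a}) = ≡.trans (∧-falseʳ (θ S a) (θ-z T)) (≡.sym (∧-falseˡ _ (θ-z S)))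
  go (pp {a} {b}) = ≡.trans (∧-falseˡ _ (θ-p S a)) (≡.sym (∧-falseʳ (θ S a) (θ-p T b)))
  go (~sym q) = ≡.sym (go q)
  go (~trans q r) = ≡.trans (go q) (go r)

restrict : ∀ {A} (T : Test A) (f : Car A → Bool) →
           (∀ {a b} → Act._≈_ A a b → f a ≡ f b) → Test A
restrict T f f-≈ = record
  { weak = record
    { θ = λ a → θ T a ∧ f a
    ; θ-≈ = λ q → cong₂ _∧_ (θ-≈ T q) (f-≈ q)
    ; θ-z = ∧-falseˡ _ (θ-z T) }
  ; θ-p = λ a → ∧-falseˡ _ (θ-p T a) }

either : ∀ {A} → Test A → Test A → Test A
either S T = record
  { weak = record
    { θ = λ a → θ S a ∨ θ T a
    ; θ-≈ = λ q → cong₂ _∨_ (θ-≈ S q) (θ-≈ T q)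
    ; θ-z = cong₂ _∨_ (θ-z S) (θ-z T) }
  ; θ-p = λ a → cong₂ _∨_ (θ-p S a) (θ-p T a) }

isOne : Test unitₐ
isOne = record
  { weak = record { θ = f ; θ-≈ = cong f ; θ-z = refl }
  ; θ-p = λ { nul → refl ; one → refl ; eps → refl } }
  where
  f : Scal → Bool
  f one = true
  f _ = false

isEps : WeakTest unitₐ
isEps = record { θ = f ; θ-≈ = cong f ; θ-z = refl }
  where
  f : Scal → Bool
  f eps = true
  f _ = false

module _ {A B : Act} where
  private
    module B = Act B

  -- A weak test becomes a test once evaluated at an argument of degree ≠ 1,
  -- because there the p-part of every value is the base point.
  atTest : ∀ a → NonE (Act.deg A a) → WeakTest B → Test (homₐ A B)
  atTest a n W = record
    { weak = record
      { θ = λ φ → wθ W (app φ a)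
      ; θ-≈ = λ q → WeakTest.θ-≈ W (proj₂ q a)
      ; θ-z = WeakTest.θ-z W }
    ; θ-p = λ φ → ≡.trans (WeakTest.θ-≈ W (B.p-kill _ (subst NonE (≡.sym (app-d φ a))
                     (nonE-*ʳ (τ φ) (Act.deg A a) n)))) (WeakTest.θ-z W) }

  atTest′ : Car A → Test B → Test (homₐ A B)
  atTest′ a T = record
    { weak = record
      { θ = λ φ → θ T (app φ a)
      ; θ-≈ = λ q → θ-≈ T (proj₂ q a)
      ; θ-z = θ-z T }
    ; θ-p = λ φ → θ-p T (app φ a) }

  -- Every test is realised by a two-valued function. It commutes with `p` because the test rejects
  -- `p a` while `p` kills the null value, and degree `d0` suits arguments of every degree.
  ind : Test A → Null B → Null (homₐ A B)
  ind T (b , q) = record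
    { τ = d0
    ; app = λ a → pick (θ T a)
    ; app-≈ = λ r → B.≈-reflexive (cong pick (θ-≈ T r))
    ; app-d = λ a → pick-d (θ T a)
    ; app-z = B.≈-reflexive (cong pick (θ-z T))
    ; app-p = λ a → B.≈-trans (B.≈-reflexive (cong pick (θ-p T a))) (B.≈-sym (pick-p (θ T a)))
    } , refl
    where
    pick : Bool → Car B
    pick c = if c then b else B.z
    pick-d : ∀ c → B.deg (pick c) ≡ d0
    pick-d true = q
    pick-d false = B.deg-z
    pick-p : ∀ c → B.p (pick c) B.≈ B.z
    pick-p c = B.p-kill _ (subst NonE (≡.sym (pick-d c)) tt)

  ind-true : ∀ (T : Test A) (b : Null B) a → θ T a ≡ true → app (proj₁ (ind T b)) a ≡ proj₁ b
  ind-true T b a q rewrite q = refl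

  ind-false : ∀ (T : Test A) (b : Null B) a → θ T a ≡ false → app (proj₁ (ind T b)) a ≡ B.z
  ind-false T b a q rewrite q = refl

-- Changing the colour of one input of a proof reveals which outputs it is wired to.
record Palette (A : Act) (Good : Car A → Set) : Set where
  field
    γ    : Bool → Car A
    good : ∀ c → Good (γ c)
    T    : Bool → Test A
    hit  : ∀ c → θ (T c) (γ c) ≡ true
    disj : ∀ c a → θ (T c) a ≡ true → θ (T (not c)) a ≡ true → ⊥

  miss : ∀ c a → θ (T c) a ≡ true → θ (T (not c)) a ≡ false
  miss c a q with θ (T (not c)) a in eq
  ... | false = refl
  ... | true = ⊥-elim (disj c a q eq)

  -- An element computed independently of a colour misses one of the two, and that colour is then
  -- used against it.
  avoid : ∀ a → Σ Bool λ c → θ (T c) a ≡ false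
  avoid a with θ (T true) a in eq
  ... | false = true , eq
  ... | true = false , miss true a eq

record Point (A : Act) (Good : Car A → Set) : Set where
  field
    pt   : Car A
    good : Good pt
    T    : Test A
    hit  : θ T pt ≡ true

-- Primes, cut-free proofs and their denotations

module Completeness (X : Set) where

  mutual
    data Neg : Set where
      neg : List Br → Neg

    data Br : Set where
      br : List Neg → Head → Br

    data Head : Set where
      at  : X → Head
      ten : List Neg → Head

  Ctx : Set
  Ctx = List Neg

  mutual
    ⟦_⟧N : Neg → Act
    ⟦ neg Bs ⟧N = ⟦ Bs ⟧Bs

    ⟦_⟧Bs : List Br → Act
    ⟦ [] ⟧Bs = topₐ
    ⟦ B ∷ Bs ⟧Bs = ⟦ B ⟧B ×ₐ ⟦ Bs ⟧Bs

    ⟦_⟧B : Br → Act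
    ⟦ br As h ⟧B = homₐ ⟦ As ⟧C ⟦ h ⟧H

    ⟦_⟧H : Head → Act
    ⟦ at x ⟧H = atomₐ
    ⟦ ten Q ⟧H = ⟦ Q ⟧C

    ⟦_⟧C : Ctx → Act
    ⟦ [] ⟧C = unitₐ
    ⟦ N ∷ Γ ⟧C = ⟦ N ⟧N ⊗ₐ ⟦ Γ ⟧C

  -- Γ ≔ Γ₁ ⊕ Γ₂: the list Γ is an interleaving of Γ₁ and Γ₂.
  infix 3 _≔_⊕_
  data _≔_⊕_ : Ctx → Ctx → Ctx → Set where
    nil   : [] ≔ [] ⊕ []
    left  : ∀ {N Γ Γ₁ Γ₂} → Γ ≔ Γ₁ ⊕ Γ₂ → N ∷ Γ ≔ N ∷ Γ₁ ⊕ Γ₂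
    right : ∀ {N Γ Γ₁ Γ₂} → Γ ≔ Γ₁ ⊕ Γ₂ → N ∷ Γ ≔ Γ₁ ⊕ N ∷ Γ₂

  -- A step eliminates one branch of a hypothesis, with a tensor as head, and unpacks that
  -- tensor into the context; a proof of a tensor is a sequence of steps followed by a split.
  infix 3 _⊢T_ _⊢B_ _⊢H_ _⊢N_ _⟿_
  mutual
    data _⊢T_ : Ctx → Ctx → Set where
      nil  : [] ⊢T []
      cons : ∀ {Γ Γ₁ Γ₂ N Δ} → Γ ≔ Γ₁ ⊕ Γ₂ → Γ₁ ⊢N N → Γ₂ ⊢T Δ → Γ ⊢T N ∷ Δ

    data _⊢N_ : Ctx → Neg → Set where
      tup : ∀ {Γ Bs} → Γ ⊢B Bs → Γ ⊢N neg Bs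

    data _⊢B_ : Ctx → List Br → Set where
      []  : ∀ {Γ} → Γ ⊢B []
      _∷_ : ∀ {Γ As h Bs} → Γ ++ As ⊢H h → Γ ⊢B Bs → Γ ⊢B br As h ∷ Bs

    data _⊢H_ : Ctx → Head → Set where
      split : ∀ {Γ Q} → Γ ⊢T Q → Γ ⊢H ten Q
      bind  : ∀ {Γ Γ⁺ h} → Γ ⟿ Γ⁺ → Γ⁺ ⊢H h → Γ ⊢H h
      ax    : ∀ {Γ Γ′ Bs As x} → Γ ≔ neg Bs ∷ [] ⊕ Γ′ → br As (at x) ∈ Bs →
              Γ′ ⊢T As → Γ ⊢H at x

    data _⟿_ : Ctx → Ctx → Set where
      step : ∀ {Γ Γ′ Γa Γr Bs As Q} → Γ ≔ neg Bs ∷ [] ⊕ Γ′ → br As (ten Q) ∈ Bs →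
             Γ′ ≔ Γa ⊕ Γr → Γa ⊢T As → Γ ⟿ Q ++ Γr

  sp : ∀ {Γ Γ₁ Γ₂} → Γ ≔ Γ₁ ⊕ Γ₂ → ⟦ Γ ⟧C ⇒ ⟦ Γ₁ ⟧C ⊗ₐ ⟦ Γ₂ ⟧C
  -- The closing scalar goes to the left part, which makes the equations of `Assoc` literal.
  sp nil = ρₐ⁻ unitₐ
  sp (left i) = αₐ⁻ ∙ (idₐ ⊗ₘ sp i)
  sp (right i) = αₐ ∙ (σₐ ⊗ₘ idₐ) ∙ αₐ⁻ ∙ (idₐ ⊗ₘ sp i)

  jn : ∀ Γ {Δ} → ⟦ Γ ⟧C ⊗ₐ ⟦ Δ ⟧C ⇒ ⟦ Γ ++ Δ ⟧C
  jn [] = λₐ _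
  jn (N ∷ Γ) = (idₐ ⊗ₘ jn Γ) ∙ αₐ

  projB : ∀ {B Bs} → B ∈ Bs → ⟦ Bs ⟧Bs ⇒ ⟦ B ⟧B
  projB {Bs = B ∷ Bs} (here refl) = fstₐ ⟦ B ⟧B ⟦ Bs ⟧Bs
  projB {Bs = B ∷ Bs} (there j) = projB j ∙ sndₐ ⟦ B ⟧B ⟦ Bs ⟧Bs

  foc : ∀ {B Bs} → B ∈ Bs → ⟦ neg Bs ∷ [] ⟧C ⇒ ⟦ B ⟧B
  foc {Bs = Bs} j = projB j ∙ ρₐ ⟦ Bs ⟧Bs

  appS : ∀ {Γ Γ′ Γa Γr Bs As h} → Γ ≔ neg Bs ∷ [] ⊕ Γ′ → br As h ∈ Bs →
         Γ′ ≔ Γa ⊕ Γr → ⟦ Γa ⟧C ⇒ ⟦ As ⟧C → ⟦ Γ ⟧C ⇒ ⟦ h ⟧H ⊗ₐ ⟦ Γr ⟧C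
  appS i j k a = (evalₐ ⊗ₘ idₐ) ∙ αₐ⁻ ∙ (foc j ⊗ₘ ((a ⊗ₘ idₐ) ∙ sp k)) ∙ sp i

  appA : ∀ {Γ Γ′ Bs As h} → Γ ≔ neg Bs ∷ [] ⊕ Γ′ → br As h ∈ Bs →
         ⟦ Γ′ ⟧C ⇒ ⟦ As ⟧C → ⟦ Γ ⟧C ⇒ ⟦ h ⟧H
  appA i j a = evalₐ ∙ (foc j ⊗ₘ a) ∙ sp i

  mutual
    evT : ∀ {Γ Δ} → Γ ⊢T Δ → ⟦ Γ ⟧C ⇒ ⟦ Δ ⟧C
    evT nil = idₐ
    evT (cons i a b) = (evN a ⊗ₘ evT b) ∙ sp i

    evN : ∀ {Γ N} → Γ ⊢N N → ⟦ Γ ⟧C ⇒ ⟦ N ⟧N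
    evN (tup fs) = evB fs

    evB : ∀ {Γ Bs} → Γ ⊢B Bs → ⟦ Γ ⟧C ⇒ ⟦ Bs ⟧Bs
    evB [] = bangₐ _
    evB {Γ} (f ∷ fs) = pairₐ (curryₐ (evH f ∙ jn Γ)) (evB fs)

    evH : ∀ {Γ h} → Γ ⊢H h → ⟦ Γ ⟧C ⇒ ⟦ h ⟧H
    evH (split a) = evT a
    evH (bind st f) = evH f ∙ evS st
    evH (ax i j a) = appA i j (evT a)

    evS : ∀ {Γ Γ⁺} → Γ ⟿ Γ⁺ → ⟦ Γ ⟧C ⇒ ⟦ Γ⁺ ⟧C
    evS (step {Q = Q} i j k a) = jn Q ∙ appS i j k (evT a)

  -- Interleavings and the framing of steps

  ⊕-[]ˡ : ∀ Γ → Γ ≔ [] ⊕ Γ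
  ⊕-[]ˡ [] = nil
  ⊕-[]ˡ (N ∷ Γ) = right (⊕-[]ˡ Γ)

  ⊕-swap : ∀ {Γ Γ₁ Γ₂} → Γ ≔ Γ₁ ⊕ Γ₂ → Γ ≔ Γ₂ ⊕ Γ₁
  ⊕-swap nil = nil
  ⊕-swap (left i) = right (⊕-swap i)
  ⊕-swap (right i) = left (⊕-swap i)

  ⊕-++ : ∀ Q {Γ Γ₁ Γ₂} → Γ ≔ Γ₁ ⊕ Γ₂ → Q ++ Γ ≔ Q ++ Γ₁ ⊕ Γ₂
  ⊕-++ [] i = i
  ⊕-++ (N ∷ Q) i = left (⊕-++ Q i)

  ⊕-of-++ : ∀ Γ Δ → Γ ++ Δ ≔ Γ ⊕ Δ
  ⊕-of-++ [] Δ = ⊕-[]ˡ Δ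
  ⊕-of-++ (N ∷ Γ) Δ = left (⊕-of-++ Γ Δ)

  private
    L : ∀ {Γ Γ₁ Γ₂} → Γ ≔ Γ₁ ⊕ Γ₂ → Act.Car ⟦ Γ ⟧C → Act.Car ⟦ Γ₁ ⟧C
    L i x = proj₁ (fun (sp i) x)

    R : ∀ {Γ Γ₁ Γ₂} → Γ ≔ Γ₁ ⊕ Γ₂ → Act.Car ⟦ Γ ⟧C → Act.Car ⟦ Γ₂ ⟧C
    R i x = proj₂ (fun (sp i) x)

  record Assoc {Γ Γ₁₂ Γ₁ Γ₂ Γ₃} (i : Γ ≔ Γ₁₂ ⊕ Γ₃) (i′ : Γ₁₂ ≔ Γ₁ ⊕ Γ₂) : Set where
    field
      {Γ₂₃} : Ctx
      j  : Γ ≔ Γ₁ ⊕ Γ₂₃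
      j′ : Γ₂₃ ≔ Γ₂ ⊕ Γ₃
      eq₁ : ∀ x → L j x ≡ L i′ (L i x)
      eq₂ : ∀ x → L j′ (R j x) ≡ R i′ (L i x)
      eq₃ : ∀ x → R j′ (R j x) ≡ R i x

  ⊕-assoc : ∀ {Γ Γ₁₂ Γ₁ Γ₂ Γ₃} (i : Γ ≔ Γ₁₂ ⊕ Γ₃) (i′ : Γ₁₂ ≔ Γ₁ ⊕ Γ₂) → Assoc i i′
  ⊕-assoc nil nil = record
    { j = nil ; j′ = nil ; eq₁ = λ _ → refl ; eq₂ = λ _ → refl ; eq₃ = λ _ → refl }
  ⊕-assoc (left i) (left i′) = record
    { j = left A.j ; j′ = A.j′ ; eq₁ = λ x → cong (proj₁ x ,_) (A.eq₁ (proj₂ x))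
    ; eq₂ = λ x → A.eq₂ (proj₂ x) ; eq₃ = λ x → A.eq₃ (proj₂ x) }
    where module A = Assoc (⊕-assoc i i′)
  ⊕-assoc (left i) (right i′) = record
    { j = right A.j ; j′ = left A.j′ ; eq₁ = λ x → A.eq₁ (proj₂ x)
    ; eq₂ = λ x → cong (proj₁ x ,_) (A.eq₂ (proj₂ x)) ; eq₃ = λ x → A.eq₃ (proj₂ x) }
    where module A = Assoc (⊕-assoc i i′)
  ⊕-assoc (right i) i′ = record
    { j = right A.j ; j′ = right A.j′ ; eq₁ = λ x → A.eq₁ (proj₂ x)
    ; eq₂ = λ x → A.eq₂ (proj₂ x) ; eq₃ = λ x → cong (proj₁ x ,_) (A.eq₃ (proj₂ x)) }
    where module A = Assoc (⊕-assoc i i′)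

  sp-swap : ∀ {Γ Γ₁ Γ₂} (i : Γ ≔ Γ₁ ⊕ Γ₂) → σₐ ∙ sp i ≐ sp (⊕-swap i)
  sp-swap nil nul = ~trans zr (~sym zl)
  sp-swap nil one = cmp refl refl
  sp-swap nil eps = ~sym pp
  sp-swap (left {N} i) (n , x) =
    resp (αₐ ∙ (σₐ ⊗ₘ idₐ) ∙ αₐ⁻) (cmp (Act.≈-refl ⟦ N ⟧N) (sp-swap i x))
  sp-swap (right {N} i) (n , x) =
    resp αₐ⁻ (cmp (Act.≈-refl ⟦ N ⟧N) (sp-swap i x))

  jn-sp : ∀ Q {Γ Γ₁ Γ₂} (i : Γ ≔ Γ₁ ⊕ Γ₂) →
          sp (⊕-++ Q i) ∙ jn Q ≐ (jn Q ⊗ₘ idₐ) ∙ αₐ⁻ ∙ (idₐ ⊗ₘ sp i)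
  jn-sp [] i (nul , x) = ~trans (fz (sp i)) (~sym zl)
  jn-sp [] {Γ₁ = Γ₁} {Γ₂} i (one , x) = Act.≈-refl (⟦ Γ₁ ⟧C ⊗ₐ ⟦ Γ₂ ⟧C)
  jn-sp [] i (eps , x) = fp (sp i) x
  jn-sp (N ∷ Q) i ((n , q) , x) = resp αₐ⁻ (cmp (Act.≈-refl ⟦ N ⟧N) (jn-sp Q i (q , x)))

  -- The commuting conversion of a left rule with a division of the context: a step uses hypotheses
  -- from one side only, so it can be carried out before the division, and `coh` says that the
  -- result is the same.
  record FrameL {Γ Γ⁺ Δ Θ} (st : Γ ⟿ Γ⁺) (i : Θ ≔ Γ ⊕ Δ) : Set where
    field
      {Θ⁺} : Ctx
      st′ : Θ ⟿ Θ⁺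
      i⁺  : Θ⁺ ≔ Γ⁺ ⊕ Δ
      coh : sp i⁺ ∙ evS st′ ≐ (evS st ⊗ₘ idₐ) ∙ sp i

  frameL : ∀ {Γ Γ⁺ Δ Θ} (st : Γ ⟿ Γ⁺) (i : Θ ≔ Γ ⊕ Δ) → FrameL st i
  frameL {Δ = Δ} {Θ} (step {Γr = Γr} {Bs} {As} {Q} i₁ b k a) i = record
    { st′ = step A.j b K.j a
    ; i⁺ = ⊕-++ Q K.j′
    ; coh = λ x → T.≈-trans (jn-sp Q K.j′ (fun (appS A.j b K.j (evT a)) x))
                            (T.≈-reflexive (cong₂ _,_ (cong (fun (jn Q)) (cong₂ _,_ (hd x) (rs x))) (tl x))) }
    where
    module A = Assoc (⊕-assoc i i₁)
    module K = Assoc (⊕-assoc A.j′ k)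
    module T = Act (⟦ Q ++ Γr ⟧C ⊗ₐ ⟦ Δ ⟧C)
    hd : ∀ x → app (fun (foc b) (L A.j x)) (fun (evT a) (L K.j (R A.j x)))
             ≡ app (fun (foc b) (L i₁ (L i x))) (fun (evT a) (L k (R i₁ (L i x))))
    hd x rewrite K.eq₁ (R A.j x) | A.eq₂ x | A.eq₁ x = refl
    rs : ∀ x → L K.j′ (R K.j (R A.j x)) ≡ R k (R i₁ (L i x))
    rs x = ≡.trans (K.eq₂ (R A.j x)) (cong (R k) (A.eq₂ x))
    tl : ∀ x → R K.j′ (R K.j (R A.j x)) ≡ R i x
    tl x = ≡.trans (K.eq₃ (R A.j x)) (A.eq₃ x)

  record FrameR {Γ Γ⁺ Δ Θ} (st : Γ ⟿ Γ⁺) (i : Θ ≔ Δ ⊕ Γ) : Set where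
    field
      {Θ⁺} : Ctx
      st′ : Θ ⟿ Θ⁺
      i⁺  : Θ⁺ ≔ Δ ⊕ Γ⁺
      coh : sp i⁺ ∙ evS st′ ≐ (idₐ ⊗ₘ evS st) ∙ sp i

  frameR : ∀ {Γ Γ⁺ Δ Θ} (st : Γ ⟿ Γ⁺) (i : Θ ≔ Δ ⊕ Γ) → FrameR st i
  frameR {Γ} {Γ⁺} {Δ} st i = record
    { st′ = F.st′
    ; i⁺ = ⊕-swap F.i⁺
    ; coh = λ x → T.≈-trans (T.≈-sym (sp-swap F.i⁺ (fun (evS F.st′) x)))
        (T.≈-trans (resp σₐ (F.coh x))
                   (resp (σₐ ∙ (evS st ⊗ₘ idₐ)) (T′.≈-sym (sp-swap i x)))) }
    where
    module F = FrameL (frameL st (⊕-swap i))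
    module T = Act (⟦ Δ ⟧C ⊗ₐ ⟦ Γ⁺ ⟧C)
    module T′ = Act (⟦ Γ ⟧C ⊗ₐ ⟦ Δ ⟧C)

  -- Gluing

  -- Def Γ m: the morphism m is definable from the hypotheses Γ.  Closure under steps is what
  -- lets definable elements of a tensor begin with eliminations.
  record Pred (A : Act) : Set₁ where
    field
      Def   : ∀ Γ → ⟦ Γ ⟧C ⇒ A → Set
      ext : ∀ {Γ m m′} → m ≐ m′ → Def Γ m → Def Γ m′
      bnd : ∀ {Γ Γ⁺ m} (st : Γ ⟿ Γ⁺) → Def Γ⁺ m → Def Γ (m ∙ evS st)

  record Obj : Set₁ where
    constructor obj
    field
      act  : Act
      pred : Pred act
    open Pred pred public

  open Obj

  infix 5 _⇒ᴳ_
  record _⇒ᴳ_ (A B : Obj) : Set where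
    constructor mor
    field
      under : act A ⇒ act B
      pres  : ∀ {Γ m} → Def A Γ m → Def B Γ (under ∙ m)

  open _⇒ᴳ_ public

  module _ (A B : Obj) where
    private
      AB : Act
      AB = act A ⊗ₐ act B

    -- Day convolution of the two predicates along interleavings, closed under steps.
    data P⊗ : ∀ Γ → ⟦ Γ ⟧C ⇒ AB → Set where
      pr : ∀ {Γ Γ₁ Γ₂ m m₁ m₂} (i : Γ ≔ Γ₁ ⊕ Γ₂) → Def A Γ₁ m₁ → Def B Γ₂ m₂ →
           m ≐ (m₁ ⊗ₘ m₂) ∙ sp i → P⊗ Γ m
      st : ∀ {Γ Γ⁺ m m′} (s : Γ ⟿ Γ⁺) → P⊗ Γ⁺ m′ → m ≐ m′ ∙ evS s → P⊗ Γ m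

    _⊗ᴳ_ : Obj
    _⊗ᴳ_ = obj AB record
      { Def = P⊗
      ; ext = ex
      ; bnd = λ s q → st s q (λ _ → Act.≈-refl AB) }
      where
      ex : ∀ {Γ m m′} → m ≐ m′ → P⊗ Γ m → P⊗ Γ m′
      ex q (pr i a b r) = pr i a b (λ x → Act.≈-trans AB (Act.≈-sym AB (q x)) (r x))
      ex q (st s a r) = st s a (λ x → Act.≈-trans AB (Act.≈-sym AB (q x)) (r x))

    -- The target is itself closed under steps, so only interleaved pairs have to be checked.
    ⊗-rec : ∀ C (φ : AB ⇒ act C) →
            (∀ {Γ Γ₁ Γ₂ m₁ m₂} (i : Γ ≔ Γ₁ ⊕ Γ₂) → Def A Γ₁ m₁ → Def B Γ₂ m₂ →
              Def C Γ (φ ∙ (m₁ ⊗ₘ m₂) ∙ sp i)) →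
            ∀ {Γ m} → P⊗ Γ m → Def C Γ (φ ∙ m)
    ⊗-rec C φ h (pr i a b q) = ext C (λ x → Act.≈-sym (act C) (resp φ (q x))) (h i a b)
    ⊗-rec C φ h (st s a q) =
      ext C (λ x → Act.≈-sym (act C) (resp φ (q x))) (bnd C s (⊗-rec C φ h a))

  data PI : ∀ Γ → ⟦ Γ ⟧C ⇒ unitₐ → Set where
    nl : ∀ {m} → m ≐ idₐ → PI [] m
    st : ∀ {Γ Γ⁺ m m′} (s : Γ ⟿ Γ⁺) → PI Γ⁺ m′ → m ≐ m′ ∙ evS s → PI Γ m

  unitᴳ : Obj
  unitᴳ = obj unitₐ record
    { Def = PI ; ext = ex ; bnd = λ s q → st s q (λ _ → refl) }
    where
    ex : ∀ {Γ m m′} → m ≐ m′ → PI Γ m → PI Γ m′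
    ex q (nl r) = nl (λ x → ≡.trans (≡.sym (q x)) (r x))
    ex q (st s a r) = st s a (λ x → ≡.trans (≡.sym (q x)) (r x))

  -- As in a Kripke logical relation, the argument may bring hypotheses `Δ` of its own.
  homᴳ : Obj → Obj → Obj
  homᴳ A B = obj (homₐ (act A) (act B)) record
    { Def = λ Γ m → ∀ {Δ Θ k} (i : Θ ≔ Γ ⊕ Δ) → Def A Δ k → Def B Θ (evalₐ ∙ (m ⊗ₘ k) ∙ sp i)
    ; ext = λ {_} {m} {m′} q f {k = k} i a → ext B
        (λ x → proj₂ (q (proj₁ (fun (sp i) x))) (fun k (proj₂ (fun (sp i) x)))) (f i a)
    ; bnd = λ {m = m} s f {k = k} i a →
        let open FrameL (frameL s i) in
        ext B (λ x → resp (evalₐ ∙ (m ⊗ₘ k)) (coh x)) (bnd B st′ (f i⁺ a)) }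

  topᴳ : Obj
  topᴳ = obj topₐ record { Def = λ _ _ → ⊤ ; ext = λ _ _ → tt ; bnd = λ _ _ → tt }

  _×ᴳ_ : Obj → Obj → Obj
  A ×ᴳ B = obj (act A ×ₐ act B) record
    { Def = λ Γ m → Def A Γ (fstₐ (act A) (act B) ∙ m) × Def B Γ (sndₐ (act A) (act B) ∙ m)
    ; ext = λ q a → ext A (λ x → proj₁ (q x)) (proj₁ a) , ext B (λ x → proj₂ (q x)) (proj₂ a)
    ; bnd = λ s a → ext A (λ _ → Act.≈-refl (act A)) (bnd A s (proj₁ a)) ,
                    ext B (λ _ → Act.≈-refl (act B)) (bnd B s (proj₂ a)) }

  -- The base case of reification: here definability carries an actual proof.
  atomᴳ : X → Obj
  atomᴳ x = obj atomₐ record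
    { Def = λ Γ m → Σ (Γ ⊢H at x) λ f → m ≐ evH f
    ; ext = λ q a → proj₁ a , λ y → ≡.trans (≡.sym (q y)) (proj₂ a y)
    ; bnd = λ s a → bind s (proj₁ a) , λ y → proj₂ a _ }

  idᴳ : ∀ {A} → A ⇒ᴳ A
  idᴳ {A} = mor idₐ (ext A (λ _ → Act.≈-refl (act A)))

  _∘ᴳ_ : ∀ {A B C} → B ⇒ᴳ C → A ⇒ᴳ B → A ⇒ᴳ C
  _∘ᴳ_ {C = C} g f = mor (under g ∙ under f)
    (λ a → ext C (λ _ → Act.≈-refl (act C)) (pres g (pres f a)))

  σᴳ : ∀ {A B} → (A ⊗ᴳ B) ⇒ᴳ (B ⊗ᴳ A)
  σᴳ {A} {B} = mor σₐ (⊗-rec A B (B ⊗ᴳ A) σₐ λ {_} {_} {_} {m₁} {m₂} i a b →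
    pr (⊕-swap i) b a (λ x → resp (m₂ ⊗ₘ m₁) (sp-swap i x)))

  _⊗₁ᴳ_ : ∀ {A B C D} → A ⇒ᴳ B → C ⇒ᴳ D → (A ⊗ᴳ C) ⇒ᴳ (B ⊗ᴳ D)
  _⊗₁ᴳ_ {A} {B} {C} {D} f g = mor (under f ⊗ₘ under g)
    (⊗-rec A C (B ⊗ᴳ D) (under f ⊗ₘ under g) λ i a b →
      pr i (pres f a) (pres g b) (λ _ → Act.≈-refl (act B ⊗ₐ act D)))

  αᴳ : ∀ {A B C} → ((A ⊗ᴳ B) ⊗ᴳ C) ⇒ᴳ (A ⊗ᴳ (B ⊗ᴳ C))
  αᴳ {A} {B} {C} = mor αₐ (⊗-rec (A ⊗ᴳ B) C D αₐ go)
    where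
    D : Obj
    D = A ⊗ᴳ (B ⊗ᴳ C)
    module D = Act (act D)
    go : ∀ {Γ Γ₁ Γ₂ m₁ m₂} (i : Γ ≔ Γ₁ ⊕ Γ₂) → P⊗ A B Γ₁ m₁ → Def C Γ₂ m₂ →
         Def D Γ (αₐ ∙ (m₁ ⊗ₘ m₂) ∙ sp i)
    go {m₂ = m₂} i (pr {m₁ = u} {v} i′ a b q) c =
      pr K.j a (pr {m = (v ⊗ₘ m₂) ∙ sp K.j′} K.j′ b c (λ _ → Act.≈-refl (act B ⊗ₐ act C)))
        (λ x → D.≈-trans (resp αₐ (cmp (q _) (Act.≈-refl (act C))))
          (D.≈-reflexive (cong₂ _,_ (cong (fun u) (≡.sym (K.eq₁ x)))
            (cong₂ _,_ (cong (fun v) (≡.sym (K.eq₂ x))) (cong (fun m₂) (≡.sym (K.eq₃ x)))))))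
      where module K = Assoc (⊕-assoc i i′)
    go {m₂ = m₂} i (st {m′ = m′} s a q) c =
      st F.st′ (go F.i⁺ a c)
        (λ x → D.≈-trans (resp αₐ (cmp (q _) (Act.≈-refl (act C))))
                         (D.≈-sym (resp (αₐ ∙ (m′ ⊗ₘ m₂)) (F.coh x))))
      where module F = FrameL (frameL s i)

  sp-[]ˡ : ∀ Γ x → Tensor≈ unitₐ ⟦ Γ ⟧C (fun (sp (⊕-[]ˡ Γ)) x) (one , x)
  sp-[]ˡ [] nul = ~trans zl (~sym zr)
  sp-[]ˡ [] one = cmp refl refl
  sp-[]ˡ [] eps = pp
  sp-[]ˡ (N ∷ Γ) (n , x) =
    resp (αₐ ∙ (σₐ ⊗ₘ idₐ) ∙ αₐ⁻) (cmp (Act.≈-refl ⟦ N ⟧N) (sp-[]ˡ Γ x))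

  ⊕-[]ˡ-≡ : ∀ {Γ Δ} → Γ ≔ [] ⊕ Δ → Γ ≡ Δ
  ⊕-[]ˡ-≡ nil = refl
  ⊕-[]ˡ-≡ (right i) = cong (_ ∷_) (⊕-[]ˡ-≡ i)

  ⊕-[]ˡ-unique : ∀ {Γ} (i : Γ ≔ [] ⊕ Γ) → i ≡ ⊕-[]ˡ Γ
  ⊕-[]ˡ-unique nil = refl
  ⊕-[]ˡ-unique (right i) = cong right (⊕-[]ˡ-unique i)

  λᴳ : ∀ {A} → (unitᴳ ⊗ᴳ A) ⇒ᴳ A
  λᴳ {A} = mor (λₐ (act A)) (⊗-rec unitᴳ A A (λₐ (act A)) go)
    where
    module A = Act (act A)
    go : ∀ {Γ Γ₁ Γ₂ m₁ m₂} (i : Γ ≔ Γ₁ ⊕ Γ₂) → PI Γ₁ m₁ → Def A Γ₂ m₂ →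
         Def A Γ (λₐ (act A) ∙ (m₁ ⊗ₘ m₂) ∙ sp i)
    go {Γ} {m₁ = m₁} {m₂} i (nl q) b with ⊕-[]ˡ-≡ i
    ... | refl rewrite ⊕-[]ˡ-unique i = ext A (λ x → A.≈-sym (A.≈-trans
        (resp (λₐ (act A) ∙ (m₁ ⊗ₘ m₂)) (sp-[]ˡ Γ x))
        (resp (λₐ (act A)) (cmp (q one) A.≈-refl)))) b
    go {m₂ = m₂} i (st {m′ = m′} s a q) b =
      ext A (λ x → A.≈-trans (resp (λₐ (act A) ∙ (m′ ⊗ₘ m₂)) (F.coh x))
                             (resp (λₐ (act A)) (cmp (≡.sym (q _)) A.≈-refl)))
        (bnd A F.st′ (go F.i⁺ a b))
      where module F = FrameL (frameL s i)

  λ⁻ᴳ : ∀ {A} → A ⇒ᴳ (unitᴳ ⊗ᴳ A)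
  λ⁻ᴳ {A} = mor (λₐ⁻ (act A)) λ {Γ} {m} a →
    pr (⊕-[]ˡ Γ) (nl {m = idₐ} (λ _ → refl)) a
      (λ x → Act.≈-sym (unitₐ ⊗ₐ act A) (resp (idₐ ⊗ₘ m) (sp-[]ˡ Γ x)))

  evalᴳ : ∀ {A B} → (homᴳ A B ⊗ᴳ A) ⇒ᴳ B
  evalᴳ {A} {B} = mor evalₐ (⊗-rec (homᴳ A B) A B evalₐ λ i f a → f i a)

  curryᴳ : ∀ {A B C} → (A ⊗ᴳ B) ⇒ᴳ C → A ⇒ᴳ homᴳ B C
  curryᴳ {A} {B} {C} f = mor (curryₐ (under f)) λ {_} {m} a {_} {_} {k} i b →
    ext C (λ _ → Act.≈-refl (act C)) (pres f (pr {m = (m ⊗ₘ k) ∙ sp i} i a b (λ _ → Act.≈-refl (act A ⊗ₐ act B))))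

  gluing : SMCCProd (lsuc 0ℓ) 0ℓ 0ℓ
  gluing = record
    { category = record
      { Obj = Obj
      ; _⇒_ = _⇒ᴳ_
      ; _≈_ = λ f g → under f ≐ under g
      ; ≈-equiv = λ {_} {B} → record
        { refl = λ _ → Act.≈-refl (act B)
        ; sym = λ q x → Act.≈-sym (act B) (q x)
        ; trans = λ q r x → Act.≈-trans (act B) (q x) (r x) }
      ; id = idᴳ
      ; _∘_ = _∘ᴳ_
      ; assoc = λ {_} {_} {_} {D} _ → Act.≈-refl (act D)
      ; identityˡ = λ {_} {B} _ → Act.≈-refl (act B)
      ; identityʳ = λ {_} {B} _ → Act.≈-refl (act B)
      ; ∘-resp-≈ = λ {_} {_} {C} {f} {h} {g} {i} q r x →
          Act.≈-trans (act C) (resp (under f) (r x)) (q (fun (under i) x))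
      }
    ; _⊗₀_ = _⊗ᴳ_
    ; _⊗₁_ = _⊗₁ᴳ_
    ; ⊗-identity = λ {A} {C} _ → Act.≈-refl (act A ⊗ₐ act C)
    ; ⊗-homomorphism = λ {_} {_} {C} {_} {_} {F} _ → Act.≈-refl (act C ⊗ₐ act F)
    ; ⊗-resp-≈ = λ q r x → cmp (q (proj₁ x)) (r (proj₂ x))
    ; unit = unitᴳ
    ; α⇒ = αᴳ
    ; α⇐ = λ {A} {B} {C} → σᴳ ∘ᴳ ((idᴳ {C} ⊗₁ᴳ σᴳ {B} {A}) ∘ᴳ (αᴳ {C} {B} {A} ∘ᴳ (σᴳ ∘ᴳ (idᴳ {A} ⊗₁ᴳ σᴳ {B} {C}))))
    ; α-isoˡ = λ {A} {B} {C} _ → Act.≈-refl ((act A ⊗ₐ act B) ⊗ₐ act C)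
    ; α-isoʳ = λ {A} {B} {C} _ → Act.≈-refl (act A ⊗ₐ (act B ⊗ₐ act C))
    ; α-natural = λ {_} {B} {_} {D} {_} {F} _ → Act.≈-refl (act B ⊗ₐ (act D ⊗ₐ act F))
    ; λ⇒ = λᴳ
    ; λ⇐ = λ⁻ᴳ
    ; λ-isoˡ = λ {A} → λ-iso (act A)
    ; λ-isoʳ = λ {A} _ → Act.≈-refl (act A)
    ; λ-natural = λ {_} {B} {f} x → Act.≈-sym (act B) (•-fun (under f) (proj₁ x) (proj₂ x))
    ; ρ⇒ = λ {A} → λᴳ {A} ∘ᴳ σᴳ
    ; ρ⇐ = λ {A} → σᴳ ∘ᴳ λ⁻ᴳ {A}
    ; ρ-isoˡ = λ {A} x → resp (σₐ {unitₐ} {act A}) (λ-iso (act A) (fun (σₐ {act A} {unitₐ}) x))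
    ; ρ-isoʳ = λ {A} _ → Act.≈-refl (act A)
    ; ρ-natural = λ {_} {B} {f} x → Act.≈-sym (act B) (•-fun (under f) (proj₂ x) (proj₁ x))
    ; σ = σᴳ
    ; σ-natural = λ {_} {B} {_} {D} _ → Act.≈-refl (act D ⊗ₐ act B)
    ; σ-involutive = λ {A} {B} _ → Act.≈-refl (act A ⊗ₐ act B)
    ; pentagon = λ {A} {B} {C} {D} _ → Act.≈-refl (act A ⊗ₐ (act B ⊗ₐ (act C ⊗ₐ act D)))
    ; triangle = λ {A} {B} → tri (act A) (act B)
    ; hexagon = λ {A} {B} {C} _ → Act.≈-refl (act B ⊗ₐ (act C ⊗ₐ act A))
    ; [_,_] = homᴳ
    ; eval = evalᴳ
    ; curry = curryᴳ
    ; curry-β = λ {_} {_} {C} _ → Act.≈-refl (act C)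
    ; curry-unique = λ {_} {_} {_} {_} {g} q a → dg (under g) a , λ b → q (a , b)
    ; terminal = topᴳ
    ; ! = λ {A} → mor (bangₐ (act A)) (λ _ → tt)
    ; !-unique = λ f a → dg (under f) a
    ; _×_ = _×ᴳ_
    ; π₁ = λ {A} {B} → mor (fstₐ (act A) (act B)) proj₁
    ; π₂ = λ {A} {B} → mor (sndₐ (act A) (act B)) proj₂
    ; ⟨_,_⟩ = λ {A} {B} f g → mor (pairₐ (under f) (under g)) λ a →
        ext A (λ _ → Act.≈-refl (act A)) (pres f a) , ext B (λ _ → Act.≈-refl (act B)) (pres g a)
    ; project₁ = λ {A} _ → Act.≈-refl (act A)
    ; project₂ = λ {_} {B} _ → Act.≈-refl (act B)
    ; ⟨⟩-unique = λ q r x → q x , r x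
    }
    where
    λ-iso : ∀ A x → Tensor≈ unitₐ A (one , proj₁ x •[ A ] proj₂ x) x
    λ-iso A (nul , a) = ~trans zr (~sym zl)
    λ-iso A (one , a) = Act.≈-refl (unitₐ ⊗ₐ A)
    λ-iso A (eps , a) = ~sym pp
    tri : ∀ A B x → Tensor≈ A B (fun ((idₐ {A} ⊗ₘ λₐ B) ∙ αₐ {A} {unitₐ} {B}) x) (fun (ρₐ A ⊗ₘ idₐ {B}) x)
    tri A B ((a , nul) , b) = ~trans zr (~sym zl)
    tri A B ((a , one) , b) = Act.≈-refl (A ⊗ₐ B)
    tri A B ((a , eps) , b) = ~sym pp

  open Obj

  -- Reflection and reification

  mutual
    ⌜_⌝N : Neg → Formula X
    ⌜ neg Bs ⌝N = ⌜ Bs ⌝Bs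

    ⌜_⌝Bs : List Br → Formula X
    ⌜ [] ⌝Bs = 𝟙⊤
    ⌜ B ∷ Bs ⌝Bs = ⌜ B ⌝B & ⌜ Bs ⌝Bs

    ⌜_⌝B : Br → Formula X
    ⌜ br As h ⌝B = ⌜ As ⌝C ⊸ ⌜ h ⌝H

    ⌜_⌝H : Head → Formula X
    ⌜ at x ⌝H = atom x
    ⌜ ten Q ⌝H = ⌜ Q ⌝C

    ⌜_⌝C : Ctx → Formula X
    ⌜ [] ⌝C = 𝟏
    ⌜ N ∷ Γ ⌝C = ⌜ N ⌝N ⊗ ⌜ Γ ⌝C

  mutual
    -- Built over the acts in which proofs are interpreted, so that `Def` and `evT` share their
    -- carriers; `interpC` identifies the result with the interpretation of formulas.
    predN : ∀ N → Pred ⟦ N ⟧N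
    predN (neg Bs) = predBs Bs

    predBs : ∀ Bs → Pred ⟦ Bs ⟧Bs
    predBs [] = pred topᴳ
    predBs (B ∷ Bs) = pred (obj _ (predB B) ×ᴳ obj _ (predBs Bs))

    predB : ∀ B → Pred ⟦ B ⟧B
    predB (br As h) = pred (homᴳ (obj _ (predC As)) (obj _ (predH h)))

    predH : ∀ h → Pred ⟦ h ⟧H
    predH (at x) = pred (atomᴳ x)
    predH (ten Q) = predC Q

    predC : ∀ Γ → Pred ⟦ Γ ⟧C
    predC [] = pred unitᴳ
    predC (N ∷ Γ) = pred (obj _ (predN N) ⊗ᴳ obj _ (predC Γ))

  GN : Neg → Obj
  GN N = obj ⟦ N ⟧N (predN N)

  GC : Ctx → Obj
  GC Γ = obj ⟦ Γ ⟧C (predC Γ)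

  mutual
    interpBs : ∀ Bs → ⟦ ⌜ Bs ⌝Bs ⟧ gluing [ atomᴳ ] ≡ obj ⟦ Bs ⟧Bs (predBs Bs)
    interpBs [] = refl
    interpBs (B ∷ Bs) = cong₂ _×ᴳ_ (interpB B) (interpBs Bs)

    interpB : ∀ B → ⟦ ⌜ B ⌝B ⟧ gluing [ atomᴳ ] ≡ obj ⟦ B ⟧B (predB B)
    interpB (br As h) = cong₂ homᴳ (interpC As) (interpH h)

    interpH : ∀ h → ⟦ ⌜ h ⌝H ⟧ gluing [ atomᴳ ] ≡ obj ⟦ h ⟧H (predH h)
    interpH (at x) = refl
    interpH (ten Q) = interpC Q

    interpC : ∀ Γ → ⟦ ⌜ Γ ⌝C ⟧ gluing [ atomᴳ ] ≡ GC Γ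
    interpC [] = refl
    interpC (neg Bs ∷ Γ) = cong₂ _⊗ᴳ_ (interpBs Bs) (interpC Γ)

  •-⊗ʳ : ∀ A B r a b → Tensor≈ A B (a , r •[ B ] b) (r •[ A ⊗ₐ B ] (a , b))
  •-⊗ʳ A B nul a b = zr
  •-⊗ʳ A B one a b = Act.≈-refl (A ⊗ₐ B)
  •-⊗ʳ A B eps a b = ~sym pp

  •-comm : ∀ r r′ → r •[ unitₐ ] r′ ≡ r′ •[ unitₐ ] r
  •-comm nul nul = refl
  •-comm nul one = refl
  •-comm nul eps = refl
  •-comm one nul = refl
  •-comm one one = refl
  •-comm one eps = refl
  •-comm eps nul = refl
  •-comm eps one = refl
  •-comm eps eps = refl

  unitʳ : ∀ Q → ⟦ Q ++ [] ⟧C ⇒ ⟦ Q ⟧C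
  unitʳ [] = idₐ
  unitʳ (N ∷ Q) = idₐ ⊗ₘ unitʳ Q

  unitʳ-jn : ∀ Q → unitʳ Q ∙ jn Q ≐ ρₐ ⟦ Q ⟧C
  unitʳ-jn [] (r , r′) = •-comm r r′
  unitʳ-jn (N ∷ Q) ((n , q) , r) =
    ~trans (cmp (Act.≈-refl ⟦ N ⟧N) (unitʳ-jn Q (q , r))) (•-⊗ʳ ⟦ N ⟧N ⟦ Q ⟧C r n q)

  sp-of-++ : ∀ Γ Δ → sp (⊕-of-++ Γ Δ) ∙ jn Γ ≐ idₐ
  sp-of-++ [] Δ (r , x) = ~trans (sp-[]ˡ Δ _) (go r)
    where
    go : ∀ r → Tensor≈ unitₐ ⟦ Δ ⟧C (one , r •[ ⟦ Δ ⟧C ] x) (r , x)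
    go nul = ~trans zr (~sym zl)
    go one = Act.≈-refl (unitₐ ⊗ₐ ⟦ Δ ⟧C)
    go eps = ~sym pp
  sp-of-++ (N ∷ Γ) Δ ((n , g) , x) = resp αₐ⁻ (cmp (Act.≈-refl ⟦ N ⟧N) (sp-of-++ Γ Δ (g , x)))

  ⊕-[]ʳ : ∀ Γ → Γ ≔ Γ ⊕ []
  ⊕-[]ʳ Γ = ⊕-swap (⊕-[]ˡ Γ)

  sp-[]ʳ : ∀ Γ x → Tensor≈ ⟦ Γ ⟧C unitₐ (fun (sp (⊕-[]ʳ Γ)) x) (x , one)
  sp-[]ʳ Γ x = ~trans (~sym (sp-swap (⊕-[]ˡ Γ) x)) (resp (σₐ {unitₐ} {⟦ Γ ⟧C}) (sp-[]ˡ Γ x))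

  record ReifiedH {Γ h} (m : ⟦ Γ ⟧C ⇒ ⟦ h ⟧H) : Set where
    constructor _,ʰ_
    field
      proof : Γ ⊢H h
      sound : m ≐ evH proof

  -- Steps that begin the proof of the tail are framed by `Γ₁` and moved before the split. The proof
  -- of `N` never begins with a step; its eliminations sit inside its branches.
  consH : ∀ {Γ Γ₁ Γ₂ N Δ} (i : Γ ≔ Γ₁ ⊕ Γ₂) (f : Γ₁ ⊢N N) (g : Γ₂ ⊢H ten Δ) →
          ReifiedH {Γ} {ten (N ∷ Δ)} ((evN f ⊗ₘ evH g) ∙ sp i)
  consH {N = N} {Δ} i f (split b) = split (cons i f b) ,ʰ λ _ → Act.≈-refl (⟦ N ⟧N ⊗ₐ ⟦ Δ ⟧C)
  consH {N = N} {Δ} i f (bind w g) = bind F.st′ R.proof ,ʰ λ x →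
    ~trans (~sym (resp (evN f ⊗ₘ evH g) (F.coh x))) (R.sound (fun (evS F.st′) x))
    where
    module F = FrameR (frameR w i)
    module R = ReifiedH (consH F.i⁺ f g)

  mutual
    -- Normalisation by evaluation: reflection makes hypotheses definable, reification reads a proof
    -- off a definable map. The argument side of ⊸ exchanges the two directions, hence the mutual
    -- recursion.
    reflectC : ∀ Γ {m} → m ≐ idₐ → Def (GC Γ) Γ m
    reflectC [] q = nl q
    reflectC (N ∷ Γ) q =
      pr (left (⊕-[]ˡ Γ)) (reflectN N) (reflectC Γ {idₐ} (λ _ → Act.≈-refl ⟦ Γ ⟧C))
        (λ x → ~trans (q x) (~sym (resp ((ρₐ ⟦ N ⟧N ⊗ₘ idₐ) ∙ αₐ⁻)
                 (cmp (Act.≈-refl ⟦ N ⟧N) (sp-[]ˡ Γ (proj₂ x))))))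

    reflectUnitʳ : ∀ Q → Def (GC Q) (Q ++ []) (unitʳ Q)
    reflectUnitʳ [] = nl (λ _ → refl)
    reflectUnitʳ (N ∷ Q) =
      pr (left (⊕-[]ˡ (Q ++ []))) (reflectN N) (reflectUnitʳ Q)
        (λ x → ~sym (resp ((ρₐ ⟦ N ⟧N ⊗ₘ unitʳ Q) ∙ αₐ⁻)
                 (cmp (Act.≈-refl ⟦ N ⟧N) (sp-[]ˡ (Q ++ []) (proj₂ x)))))

    reflectN : ∀ N → Def (GN N) (N ∷ []) (ρₐ ⟦ N ⟧N)
    reflectN (neg Bs) = reflectBs Bs (λ j → j) (λ {B} j x → Act.≈-refl ⟦ B ⟧B)

    -- `ι` lets the recursion run through part of the branches while the hypothesis keeps all of
    -- `Bs`.
    reflectBs : ∀ {Bs} Bs′ (ι : ∀ {B} → B ∈ Bs′ → B ∈ Bs) {m : ⟦ neg Bs ∷ [] ⟧C ⇒ ⟦ Bs′ ⟧Bs} →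
                (∀ {B} (j : B ∈ Bs′) → foc (ι j) ≐ projB j ∙ m) →
                Def (obj _ (predBs Bs′)) (neg Bs ∷ []) m
    reflectBs [] ι q = tt
    reflectBs (br As h ∷ Bs′) ι {m} q =
      (λ {Δ} {Θ} {k} i a → ext (obj _ (predH h))
         (λ x → let module H = Act ⟦ h ⟧H in H.≈-trans
            (app-≈ (fun (foc (ι (here refl))) (proj₁ (fun (sp i) x)))
              (Act.≈-sym ⟦ As ⟧C (ReifiedH.sound (reifyC As a) (proj₂ (fun (sp i) x)))))
            (proj₂ (q (here refl) (proj₁ (fun (sp i) x))) (fun k (proj₂ (fun (sp i) x)))))
         (applyN As h (ι (here refl)) i (ReifiedH.proof (reifyC As a)))) ,
      reflectBs Bs′ (λ j → ι (there j)) (λ j → q (there j))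

    -- Only an argument in split form can be fed to a rule, so its leading steps are moved in front.
    -- An atomic head then gives `ax`; a tensor head gives a step that leaves no hypotheses over,
    -- whence the context `Q ++ []`.
    applyN : ∀ As h {Bs Θ Δ} (j : br As h ∈ Bs) (i : Θ ≔ neg Bs ∷ [] ⊕ Δ) (f : Δ ⊢H ten As) →
             Def (obj _ (predH h)) Θ (evalₐ ∙ (foc j ⊗ₘ evH f) ∙ sp i)
    applyN As (at x) j i (split a) = ax i j a , λ _ → refl
    applyN As (ten Q) {Bs} {Θ} {Δ} j i (split a) =
      ext (GC Q) (λ x → C.≈-trans
          (resp (unitʳ Q ∙ jn Q ∙ (evalₐ ⊗ₘ idₐ) ∙ αₐ⁻ ∙ (idₐ {homₐ ⟦ As ⟧C ⟦ Q ⟧C} ⊗ₘ (evT a ⊗ₘ idₐ)))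
            (cmp {a = φ x} {φ x} (Act.≈-refl (homₐ ⟦ As ⟧C ⟦ Q ⟧C) {φ x}) (sp-[]ʳ Δ (proj₂ (fun (sp i) x)))))
          (unitʳ-jn Q (app (φ x) (fun (evT a) (proj₂ (fun (sp i) x))) , one)))
        (bnd (GC Q) (step i j (⊕-[]ʳ Δ) a) (reflectUnitʳ Q))
      where
      module C = Act ⟦ Q ⟧C
      φ = λ x → fun (foc j) (proj₁ (fun (sp i) x))
    applyN As h j i (bind w f) =
      ext (obj _ (predH h)) (λ x → resp (evalₐ ∙ (foc j ⊗ₘ evH f)) (F.coh x))
        (bnd (obj _ (predH h)) F.st′ (applyN As h j F.i⁺ f))
      where module F = FrameR (frameR w i)

    reifyBs : ∀ Bs {Γ m} → Def (obj _ (predBs Bs)) Γ m → Σ (Γ ⊢B Bs) λ f → m ≐ evB f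
    reifyBs [] {m = m} _ = [] , dg m
    reifyBs (br As h ∷ Bs) {Γ} {m} (a , as) =
      -- A function is read back by applying it to generic arguments, here the added hypotheses
      -- `As`.
      let r = reifyH h (a (⊕-of-++ Γ As) (reflectC As {idₐ} (λ _ → Act.≈-refl ⟦ As ⟧C)))
          rs = reifyBs Bs as
          module H = Act ⟦ h ⟧H
          φ = fstₐ ⟦ br As h ⟧B ⟦ Bs ⟧Bs ∙ m in
      ReifiedH.proof r ∷ proj₁ rs , λ x → (dg m x , λ y →
        H.≈-trans
          (H.≈-sym (resp (evalₐ ∙ (φ ⊗ₘ idₐ)) (sp-of-++ Γ As (x , y))))
          (ReifiedH.sound r (fun (jn Γ) (x , y)))) , proj₂ rs x

    reifyH : ∀ h {Γ m} → Def (obj _ (predH h)) Γ m → ReifiedH {Γ} {h} m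
    reifyH (at x) a = proj₁ a ,ʰ proj₂ a
    reifyH (ten Q) a = reifyC Q a

    reifyC : ∀ Δ {Γ m} → Def (GC Δ) Γ m → ReifiedH {Γ} {ten Δ} m
    reifyC [] (nl q) = split nil ,ʰ q
    reifyC [] (st s a q) = let r = reifyC [] a in
      bind s (ReifiedH.proof r) ,ʰ λ x → ≡.trans (q x) (ReifiedH.sound r _)
    reifyC (neg Bs ∷ Δ) (pr i a b q) =
      let f = reifyBs Bs a
          g = reifyC Δ b
          r = consH {N = neg Bs} i (tup (proj₁ f)) (ReifiedH.proof g) in
      ReifiedH.proof r ,ʰ λ x →
        ~trans (q x) (~trans (cmp (proj₂ f _) (ReifiedH.sound g _)) (ReifiedH.sound r x))
    reifyC (N ∷ Δ) (st s a q) = let r = reifyC (N ∷ Δ) a in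
      bind s (ReifiedH.proof r) ,ʰ λ x → ~trans (q x) (ReifiedH.sound r _)

  =S-setoid : Setoid _ _
  =S-setoid = record
    { Carrier = Formula X ; _≈_ = _=S_ ; isEquivalence = record { refl = refl ; sym = sym ; trans = trans } }

  private
    open module =S-Reasoning = SetoidReasoning =S-setoid

  -- Normal forms

  -- Excludes the products with a single branch that is a tensor, hence not a prime.
  data Proper : List Br → Set where
    top : Proper []
    atm : ∀ {x} → Proper (br [] (at x) ∷ [])
    fn  : ∀ {N As h} → Proper (br (N ∷ As) h ∷ [])
    amp : ∀ {B B′ Bs} → Proper (B ∷ B′ ∷ Bs)

  -- A head consisting of one prime is excluded: by distributivity and currying it dissolves into
  -- the branches of that prime.
  data Plural : Ctx → Set where
    none : Plural []
    some : ∀ {N N′ Γ} → Plural (N ∷ N′ ∷ Γ)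

  mutual
    OkN : Neg → Set
    OkN (neg Bs) = OkBs Bs × Proper Bs

    OkBs : List Br → Set
    OkBs [] = ⊤
    OkBs (B ∷ Bs) = OkB B × OkBs Bs

    OkB : Br → Set
    OkB (br As h) = OkC As × OkH h

    OkH : Head → Set
    OkH (at x) = ⊤
    OkH (ten Q) = OkC Q × Plural Q

    OkC : Ctx → Set
    OkC [] = ⊤
    OkC (N ∷ Γ) = OkN N × OkC Γ

  OkC-++ : ∀ Γ {Δ} → OkC Γ → OkC Δ → OkC (Γ ++ Δ)
  OkC-++ [] _ d = d
  OkC-++ (N ∷ Γ) (n , g) d = n , OkC-++ Γ g d

  OkBs-++ : ∀ Bs {Bs′} → OkBs Bs → OkBs Bs′ → OkBs (Bs ++ Bs′)
  OkBs-++ [] _ d = d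
  OkBs-++ (B ∷ Bs) (b , bs) d = b , OkBs-++ Bs bs d

  branches : Neg → List Br
  branches (neg Bs) = Bs

  toBrs : Ctx → List Br
  toBrs [] = br [] (ten []) ∷ []
  toBrs (N ∷ []) = branches N
  toBrs (M ∷ N ∷ Γ) = br [] (ten (M ∷ N ∷ Γ)) ∷ []

  fromBrs : List Br → Ctx
  fromBrs (br [] (ten Q) ∷ []) = Q
  fromBrs Bs = neg Bs ∷ []

  addArgs : Ctx → List Br → List Br
  addArgs Γ [] = []
  addArgs Γ (br As h ∷ Bs) = br (Γ ++ As) h ∷ addArgs Γ Bs

  nf : Formula X → Ctx
  nf (atom x) = neg (br [] (at x) ∷ []) ∷ []
  nf (F ⊗ G) = nf F ++ nf G
  nf 𝟏 = []
  nf (F ⊸ G) = fromBrs (addArgs (nf F) (toBrs (nf G)))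
  nf (F & G) = fromBrs (toBrs (nf F) ++ toBrs (nf G))
  nf 𝟙⊤ = neg [] ∷ []

  toBrs-ok : ∀ Γ → OkC Γ → OkBs (toBrs Γ)
  toBrs-ok [] _ = (tt , tt , none) , tt
  toBrs-ok (neg Bs ∷ []) ((bs , _) , _) = bs
  toBrs-ok (M ∷ N ∷ Γ) g = (tt , g , some) , tt

  fromBrs-ok : ∀ Bs → OkBs Bs → OkC (fromBrs Bs)
  fromBrs-ok [] _ = (tt , top) , tt
  fromBrs-ok (br [] (at x) ∷ []) bs = (bs , atm) , tt
  fromBrs-ok (br [] (ten Q) ∷ []) ((_ , q , _) , _) = q
  fromBrs-ok (br (N ∷ As) h ∷ []) bs = (bs , fn) , tt
  fromBrs-ok (br [] (at x) ∷ _ ∷ _) bs = (bs , amp) , tt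
  fromBrs-ok (br [] (ten Q) ∷ _ ∷ _) bs = (bs , amp) , tt
  fromBrs-ok (br (N ∷ As) h ∷ _ ∷ _) bs = (bs , amp) , tt

  addArgs-ok : ∀ Γ Bs → OkC Γ → OkBs Bs → OkBs (addArgs Γ Bs)
  addArgs-ok Γ [] g _ = tt
  addArgs-ok Γ (br As h ∷ Bs) g ((a , b) , bs) = (OkC-++ Γ g a , b) , addArgs-ok Γ Bs g bs

  nf-ok : ∀ F → OkC (nf F)
  nf-ok (atom x) = (((tt , tt) , tt) , atm) , tt
  nf-ok (F ⊗ G) = OkC-++ (nf F) (nf-ok F) (nf-ok G)
  nf-ok 𝟏 = tt
  nf-ok (F ⊸ G) = fromBrs-ok _ (addArgs-ok (nf F) _ (nf-ok F) (toBrs-ok (nf G) (nf-ok G)))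
  nf-ok (F & G) = fromBrs-ok _ (OkBs-++ (toBrs (nf F)) (toBrs-ok (nf F) (nf-ok F)) (toBrs-ok (nf G) (nf-ok G)))
  nf-ok 𝟙⊤ = (tt , top) , tt

  ⊗-unitˡ : ∀ {F : Formula X} → 𝟏 ⊗ F =S F
  ⊗-unitˡ = trans ⊗-comm ⊗-unit

  &-unitˡ : ∀ {F : Formula X} → 𝟙⊤ & F =S F
  &-unitˡ = trans &-comm &-unit

  ⌜++⌝C : ∀ Γ Δ → ⌜ Γ ++ Δ ⌝C =S ⌜ Γ ⌝C ⊗ ⌜ Δ ⌝C
  ⌜++⌝C [] Δ = sym ⊗-unitˡ
  ⌜++⌝C (N ∷ Γ) Δ = trans (⊗-cong refl (⌜++⌝C Γ Δ)) ⊗-assoc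

  ⌜++⌝Bs : ∀ Bs Bs′ → ⌜ Bs ++ Bs′ ⌝Bs =S ⌜ Bs ⌝Bs & ⌜ Bs′ ⌝Bs
  ⌜++⌝Bs [] Bs′ = sym &-unitˡ
  ⌜++⌝Bs (B ∷ Bs) Bs′ = trans (&-cong refl (⌜++⌝Bs Bs Bs′)) &-assoc

  private
    lone : ∀ Q → ⌜ br [] (ten Q) ∷ [] ⌝Bs =S ⌜ Q ⌝C
    lone Q = trans &-unit ⊸-unit

  ⌜toBrs⌝ : ∀ Γ → ⌜ toBrs Γ ⌝Bs =S ⌜ Γ ⌝C
  ⌜toBrs⌝ [] = lone []
  ⌜toBrs⌝ (neg Bs ∷ []) = sym ⊗-unit
  ⌜toBrs⌝ (M ∷ N ∷ Γ) = lone (M ∷ N ∷ Γ)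

  ⌜fromBrs⌝ : ∀ Bs → ⌜ fromBrs Bs ⌝C =S ⌜ Bs ⌝Bs
  ⌜fromBrs⌝ [] = ⊗-unit
  ⌜fromBrs⌝ (br [] (at x) ∷ []) = ⊗-unit
  ⌜fromBrs⌝ (br [] (ten Q) ∷ []) = sym (lone Q)
  ⌜fromBrs⌝ (br (N ∷ As) h ∷ []) = ⊗-unit
  ⌜fromBrs⌝ (br [] (at x) ∷ _ ∷ _) = ⊗-unit
  ⌜fromBrs⌝ (br [] (ten Q) ∷ _ ∷ _) = ⊗-unit
  ⌜fromBrs⌝ (br (N ∷ As) h ∷ _ ∷ _) = ⊗-unit

  ⌜addArgs⌝ : ∀ Γ Bs → ⌜ addArgs Γ Bs ⌝Bs =S (⌜ Γ ⌝C ⊸ ⌜ Bs ⌝Bs)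
  ⌜addArgs⌝ Γ [] = sym ⊸-⊤
  ⌜addArgs⌝ Γ (br As h ∷ Bs) =
    trans (&-cong (trans (⊸-cong (⌜++⌝C Γ As) refl) curry-ax) (⌜addArgs⌝ Γ Bs)) (sym ⊸-&)

  nf-=S : ∀ F → F =S ⌜ nf F ⌝C
  nf-=S (atom x) = sym (trans ⊗-unit (trans &-unit ⊸-unit))
  nf-=S (F ⊗ G) = trans (⊗-cong (nf-=S F) (nf-=S G)) (sym (⌜++⌝C (nf F) (nf G)))
  nf-=S 𝟏 = refl
  nf-=S (F ⊸ G) = begin
    (F ⊸ G)                                             ≈⟨ ⊸-cong (nf-=S F) (nf-=S G) ⟩
    (⌜ nf F ⌝C ⊸ ⌜ nf G ⌝C)                             ≈⟨ ⊸-cong refl (⌜toBrs⌝ (nf G)) ⟨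
    (⌜ nf F ⌝C ⊸ ⌜ toBrs (nf G) ⌝Bs)                    ≈⟨ ⌜addArgs⌝ (nf F) (toBrs (nf G)) ⟨
    ⌜ addArgs (nf F) (toBrs (nf G)) ⌝Bs                 ≈⟨ ⌜fromBrs⌝ (addArgs (nf F) (toBrs (nf G))) ⟨
    ⌜ fromBrs (addArgs (nf F) (toBrs (nf G))) ⌝C        ∎
  nf-=S (F & G) = begin
    F & G                                               ≈⟨ &-cong (nf-=S F) (nf-=S G) ⟩
    ⌜ nf F ⌝C & ⌜ nf G ⌝C                               ≈⟨ &-cong (⌜toBrs⌝ (nf F)) (⌜toBrs⌝ (nf G)) ⟨
    ⌜ toBrs (nf F) ⌝Bs & ⌜ toBrs (nf G) ⌝Bs             ≈⟨ ⌜++⌝Bs (toBrs (nf F)) (toBrs (nf G)) ⟨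
    ⌜ toBrs (nf F) ++ toBrs (nf G) ⌝Bs                  ≈⟨ ⌜fromBrs⌝ (toBrs (nf F) ++ toBrs (nf G)) ⟨
    ⌜ fromBrs (toBrs (nf F) ++ toBrs (nf G)) ⌝C         ∎
  nf-=S 𝟙⊤ = sym ⊗-unit

  -- Admissible inputs and the colours of contexts

  Small : ∀ N → Car ⟦ N ⟧N → Set
  Small N a = NonE (Act.deg ⟦ N ⟧N a)

  -- Pure tensors of elements of degree ≠ 1, the inputs on which proofs are tested; with at
  -- least two factors their degree is 0.
  Adm : ∀ Γ → Car ⟦ Γ ⟧C → Set
  Adm [] r = r ≡ one
  Adm (N ∷ Γ) (n , g) = Small N n × Adm Γ g

  IsNull : ∀ A → Car A → Set
  IsNull A a = Act.deg A a ≡ d0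

  adm-nonE : ∀ N Γ x → Adm (N ∷ Γ) x → NonE (Act.deg ⟦ N ∷ Γ ⟧C x)
  adm-nonE N Γ (n , g) (a , _) = nonE-*ˡ (Act.deg ⟦ N ⟧N n) (Act.deg ⟦ Γ ⟧C g) a

  adm-null : ∀ M N Γ x → Adm (M ∷ N ∷ Γ) x → IsNull ⟦ M ∷ N ∷ Γ ⟧C x
  adm-null M N Γ (m , g) (a , b) = nonE-*² (Act.deg ⟦ M ⟧N m) (Act.deg ⟦ N ∷ Γ ⟧C g) a (adm-nonE N Γ g b)

  mg : ∀ {Γ Γ₁ Γ₂} → Γ ≔ Γ₁ ⊕ Γ₂ → Car ⟦ Γ₁ ⟧C → Car ⟦ Γ₂ ⟧C → Car ⟦ Γ ⟧C
  mg nil r r′ = r •[ unitₐ ] r′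
  mg (left i) (n , g) g′ = n , mg i g g′
  mg (right i) g (n , g′) = n , mg i g g′

  mg-adm : ∀ {Γ Γ₁ Γ₂} (i : Γ ≔ Γ₁ ⊕ Γ₂) {x y} → Adm Γ₁ x → Adm Γ₂ y → Adm Γ (mg i x y)
  mg-adm nil refl refl = refl
  mg-adm (left i) (a , b) c = a , mg-adm i b c
  mg-adm (right i) b (a , c) = a , mg-adm i b c

  sp-mg : ∀ {Γ Γ₁ Γ₂} (i : Γ ≔ Γ₁ ⊕ Γ₂) {x y} → Adm Γ₁ x → Adm Γ₂ y → fun (sp i) (mg i x y) ≡ (x , y)
  sp-mg nil refl refl = refl
  sp-mg (left i) {n , g} (_ , b) c rewrite sp-mg i b c = refl
  sp-mg (right i) {y = n , g} b (_ , c) rewrite sp-mg i b c = refl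

  -- When the closing scalar is `one`, it does not matter to which side `sp` sends it; the equations
  -- of `Exch` rely on this.
  Uni : ∀ Γ → Car ⟦ Γ ⟧C → Set
  Uni [] r = r ≡ one
  Uni (N ∷ Γ) (n , g) = Uni Γ g

  adm-uni : ∀ Γ {x} → Adm Γ x → Uni Γ x
  adm-uni [] q = q
  adm-uni (N ∷ Γ) (_ , a) = adm-uni Γ a

  sp-uni : ∀ {Γ Γ₁ Γ₂} (i : Γ ≔ Γ₁ ⊕ Γ₂) x → Uni Γ x →
           Uni Γ₁ (proj₁ (fun (sp i) x)) × Uni Γ₂ (proj₂ (fun (sp i) x))
  sp-uni nil x q = q , refl
  sp-uni (left i) (n , x) q = sp-uni i x q
  sp-uni (right i) (n , x) q = sp-uni i x q

  sp-[]ˡ-uni : ∀ Γ {x} → Uni Γ x → fun (sp (⊕-[]ˡ Γ)) x ≡ (one , x)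
  sp-[]ˡ-uni [] refl = refl
  sp-[]ˡ-uni (N ∷ Γ) q rewrite sp-[]ˡ-uni Γ q = refl

  okL : ∀ {Γ Γ₁ Γ₂} → Γ ≔ Γ₁ ⊕ Γ₂ → OkC Γ → OkC Γ₁
  okL nil _ = tt
  okL (left i) (a , b) = a , okL i b
  okL (right i) (a , b) = okL i b

  okR : ∀ {Γ Γ₁ Γ₂} → Γ ≔ Γ₁ ⊕ Γ₂ → OkC Γ → OkC Γ₂
  okR nil _ = tt
  okR (left i) (a , b) = okR i b
  okR (right i) (a , b) = a , okR i b

  PaletteN : Neg → Set
  PaletteN N = Palette ⟦ N ⟧N (Small N)

  PointC PaletteC : Ctx → Set
  PointC Γ = Point ⟦ Γ ⟧C (Adm Γ)
  PaletteC Γ = Palette ⟦ Γ ⟧C (Adm Γ)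

  fromPalette : ∀ {A Good} → Palette A Good → Point A Good
  fromPalette P = record { pt = γ true ; good = good true ; T = T true ; hit = hit true }
    where open Palette P

  point-∷ : ∀ {N Γ} → Point ⟦ N ⟧N (Small N) → PointC Γ → PointC (N ∷ Γ)
  point-∷ P Q = record
    { pt = P.pt , Q.pt ; good = P.good , Q.good ; T = P.T ⊠ Q.T ; hit = ∧-intro P.hit Q.hit }
    where
    module P = Point P
    module Q = Point Q

  palette-∷ : ∀ {N Γ} → PaletteN N → PointC Γ → PaletteC (N ∷ Γ)
  palette-∷ P Q = record
    { γ = λ c → P.γ c , Q.pt
    ; good = λ c → P.good c , Q.good
    ; T = λ c → P.T c ⊠ Q.T
    ; hit = λ c → ∧-intro (P.hit c) Q.hit
    ; disj = λ c x q r → P.disj c (proj₁ x) (proj₁ (∧-true q)) (proj₁ (∧-true r)) }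
    where
    module P = Palette P
    module Q = Point Q

  palette-∷ʳ : ∀ {N Γ} → Point ⟦ N ⟧N (Small N) → PaletteC Γ → PaletteC (N ∷ Γ)
  palette-∷ʳ P Q = record
    { γ = λ c → P.pt , Q.γ c
    ; good = λ c → P.good , Q.good c
    ; T = λ c → P.T ⊠ Q.T c
    ; hit = λ c → ∧-intro P.hit (Q.hit c)
    ; disj = λ c x q r → Q.disj c (proj₂ x) (proj₂ (∧-true q)) (proj₂ (∧-true r)) }
    where
    module P = Point P
    module Q = Palette Q

  palette-⊕ˡ : ∀ {Γ Γ₁ Γ₂} → Γ ≔ Γ₁ ⊕ Γ₂ → PaletteC Γ₁ → PointC Γ₂ → PaletteC Γ
  palette-⊕ˡ i P Q = record
    { γ = λ c → mg i (P.γ c) Q.pt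
    ; good = λ c → mg-adm i (P.good c) Q.good
    ; T = λ c → pull (sp i) (P.T c ⊠ Q.T)
    ; hit = λ c → ≡.trans (cong (θ (P.T c ⊠ Q.T)) (sp-mg i (P.good c) Q.good))
                          (∧-intro (P.hit c) Q.hit)
    ; disj = λ c x q r → P.disj c _ (proj₁ (∧-true q)) (proj₁ (∧-true r)) }
    where
    module P = Palette P
    module Q = Point Q

  palette-⊕ʳ : ∀ {Γ Γ₁ Γ₂} → Γ ≔ Γ₁ ⊕ Γ₂ → PaletteC Γ₂ → PointC Γ₁ → PaletteC Γ
  palette-⊕ʳ i P Q = record
    { γ = λ c → mg i Q.pt (P.γ c)
    ; good = λ c → mg-adm i Q.good (P.good c)
    ; T = λ c → pull (sp i) (Q.T ⊠ P.T c)
    ; hit = λ c → ≡.trans (cong (θ (Q.T ⊠ P.T c)) (sp-mg i Q.good (P.good c)))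
                          (∧-intro Q.hit (P.hit c))
    ; disj = λ c x q r → P.disj c _ (proj₂ (∧-true q)) (proj₂ (∧-true r)) }
    where
    module P = Palette P
    module Q = Point Q

  -- Two colours for every prime

  record HeadPoint (h : Head) : Set where
    field
      pt   : Null ⟦ h ⟧H
      W    : WeakTest ⟦ h ⟧H
      hit  : wθ W (proj₁ pt) ≡ true

  -- The components of a tuple share their degree, so one of them can be exchanged freely when all
  -- are null.
  put : ∀ {B Bs} → B ∈ Bs → Null ⟦ B ⟧B → Null ⟦ Bs ⟧Bs → Null ⟦ Bs ⟧Bs
  put (here refl) (b , q) (((a , as) , r) , w) = ((b , as) , ≡.trans q (≡.trans (≡.sym w) r)) , q
  put {Bs = B′ ∷ Bs} (there j) b (((a , as) , r) , w) =
    let (as′ , q) = put j b (as , ≡.trans (≡.sym r) w) in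
    ((a , as′) , ≡.trans w (≡.sym q)) , w

  put-same : ∀ {B Bs} (j : B ∈ Bs) b t → fun (projB j) (proj₁ (put j b t)) ≡ proj₁ b
  put-same (here refl) b t = refl
  put-same (there j) b t = put-same j b _

  put-other : ∀ {B B′ Bs} (j : B ∈ Bs) (j′ : B′ ∈ Bs) b t → index j ≢ index j′ →
              fun (projB j′) (proj₁ (put j b t)) ≡ fun (projB j′) (proj₁ t)
  put-other (here refl) (here refl) b t n = ⊥-elim (n refl)
  put-other (here refl) (there j′) b t n = refl
  put-other (there j) (here refl) b t n = refl
  put-other (there j) (there j′) b t n = put-other j j′ b _ (λ q → n (cong Data.Fin.suc q))
    where import Data.Fin

  projB-z : ∀ {B Bs} (j : B ∈ Bs) → fun (projB j) (Act.z ⟦ Bs ⟧Bs) ≡ Act.z ⟦ B ⟧B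
  projB-z (here refl) = refl
  projB-z (there j) = projB-z j

  okB : ∀ {B Bs} → B ∈ Bs → OkBs Bs → OkB B
  okB (here refl) (b , _) = b
  okB (there j) (_ , bs) = okB j bs

  isTok : Bool → Test atomₐ
  isTok c = record
    { weak = record { θ = f c ; θ-≈ = cong (f c) ; θ-z = f-base c }
    ; θ-p = λ _ → f-base c }
    where
    f : Bool → Atomic → Bool
    f _ base = false
    f true (tok c) = c
    f false (tok c) = not c
    f-base : ∀ c → f c base ≡ false
    f-base true = refl
    f-base false = refl

  atomPalette : Palette atomₐ (IsNull atomₐ)
  atomPalette = record
    { γ = tok ; good = λ _ → refl ; T = isTok
    ; hit = λ { true → refl ; false → refl }
    ; disj = λ { true (tok true) _ () ; false (tok false) _ () ; true (tok false) () ; false (tok true) () } }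

  -- `dx` and `dy` are not null; for their sake the colours of a prime are only required to be
  -- `Small`.
  topPalette : Palette topₐ NonE
  topPalette = record
    { γ = λ { true → dx ; false → dy }
    ; good = λ { true → tt ; false → tt }
    ; T = λ c → record
      { weak = record { θ = f c ; θ-≈ = cong (f c) ; θ-z = f-d0 c } ; θ-p = λ _ → f-d0 c }
    ; hit = λ { true → refl ; false → refl }
    ; disj = λ { true dx _ () ; false dy _ () ; true d0 () ; true d1 () ; true dy ()
               ; false d0 () ; false d1 () ; false dx () } }
    where
    f : Bool → Deg → Bool
    f true dx = true
    f false dy = true
    f _ _ = false
    f-d0 : ∀ c → f c d0 ≡ false
    f-d0 true = refl
    f-d0 false = refl

  data Kind : Br → Set where
    unitK : Kind (br [] (ten []))
    headK : ∀ {h} → Palette ⟦ h ⟧H (IsNull ⟦ h ⟧H) → Kind (br [] h)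
    argsK : ∀ {N As h} → PaletteC (N ∷ As) → HeadPoint h → Kind (br (N ∷ As) h)

  headPoint-fromPalette : ∀ {h} → Palette ⟦ h ⟧H (IsNull ⟦ h ⟧H) → HeadPoint h
  headPoint-fromPalette P = record
    { pt = P.γ true , P.good true ; W = weak (P.T true) ; hit = P.hit true }
    where module P = Palette P

  -- The head 1 is why `HeadPoint` asks for a weak test only: `eps` is its one nonzero null element,
  -- and no test accepts it.
  unitHeadPoint : HeadPoint (ten [])
  unitHeadPoint = record { pt = eps , refl ; W = isEps ; hit = refl }

  -- A branch with arguments inherits their colours: colour `c` is the indicator of `T c`,
  -- recognised by being accepted at `γ c` and rejected at the other colour. Without arguments the
  -- head supplies the colours, unless it is 1.
  coloured : ∀ {B} → Kind B → B ≡ br [] (ten []) ⊎ Palette ⟦ B ⟧B (IsNull ⟦ B ⟧B)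
  coloured unitK = inj₁ refl
  coloured (headK P) = inj₂ record
    { γ = λ c → proj₁ (ind isOne (P.γ c , P.good c))
    ; good = λ _ → refl
    ; T = λ c → atTest′ one (P.T c)
    ; hit = P.hit
    ; disj = λ c φ → P.disj c (app φ one) }
    where module P = Palette P
  coloured (argsK {N} {As} {h} P H) = inj₂ record
    { γ = β
    ; good = λ _ → refl
    ; T = λ c → restrict (probe c) (λ φ → not (value (not c) φ)) 
        (λ {φ} {ψ} q → cong not (θ-≈ (probe (not c)) {φ} {ψ} q))
    ; hit = λ c → ∧-intro
        (≡.trans (cong (wθ H.W) (ind-true {B = ⟦ h ⟧H} (P.T c) H.pt (P.γ c) (P.hit c))) H.hit)
        (cong not (≡.trans (cong (wθ H.W) (ind-false {B = ⟦ h ⟧H} (P.T c) H.pt (P.γ (not c)) (opp c)))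
                           (WeakTest.θ-z H.W)))
    ; disj = λ c φ q r → not-true (proj₂ (∧-true {value c φ} q)) (proj₁ (∧-true {value (not c) φ} r)) }
    where
    module P = Palette P
    module H = HeadPoint H
    probe : Bool → Test ⟦ br (N ∷ As) h ⟧B
    probe c = atTest (P.γ c) (adm-nonE N As (P.γ c) (P.good c)) H.W
    value : Bool → Car ⟦ br (N ∷ As) h ⟧B → Bool
    value c φ = θ (probe c) φ
    β : Bool → Car ⟦ br (N ∷ As) h ⟧B
    β c = proj₁ (ind (P.T c) H.pt)
    opp : ∀ c → θ (P.T c) (P.γ (not c)) ≡ false
    opp true = P.miss false (P.γ false) (P.hit false)
    opp false = P.miss true (P.γ true) (P.hit true)
    not-true : ∀ {b} → not b ≡ true → b ≡ true → ⊥
    not-true {true} () _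
    not-true {false} _ ()

  palette-put : ∀ {B Bs} (j : B ∈ Bs) → Palette ⟦ B ⟧B (IsNull ⟦ B ⟧B) → PaletteN (neg Bs)
  palette-put {Bs = Bs} j P = record
    { γ = λ c → proj₁ (el c)
    ; good = λ c → null-nonE ⟦ Bs ⟧Bs (el c)
    ; T = λ c → pull (projB j) (P.T c)
    ; hit = λ c → ≡.trans (cong (θ (P.T c)) (put-same j _ (zero₀ ⟦ Bs ⟧Bs))) (P.hit c)
    ; disj = λ c a → P.disj c (fun (projB j) a) }
    where
    module P = Palette P
    el : Bool → Null ⟦ Bs ⟧Bs
    el c = put j (P.γ c , P.good c) (zero₀ ⟦ Bs ⟧Bs)

  Unit : Br
  Unit = br [] (ten [])

  unitValue : ∀ {Bs} → Unit ∈ Bs → Car ⟦ Bs ⟧Bs → Scal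
  unitValue j n = app (fun (projB j) n) one

  unitValue-≈ : ∀ {Bs} (j : Unit ∈ Bs) {m n} → Act._≈_ ⟦ Bs ⟧Bs m n → unitValue j m ≡ unitValue j n
  unitValue-≈ j q = proj₂ (resp (projB j) q) one

  -- The scalar eps of a unit component has no test of its own, since eps = p one;
  -- it becomes detectable next to another unit component different from eps.
  unitTest : ∀ {Bs} → Unit ∈ Bs → Unit ∈ Bs → Test ⟦ Bs ⟧Bs
  unitTest {Bs} j j′ = record
    { weak = record
      { θ = λ n → wθ isEps (unitValue j n) ∧ not (wθ isEps (unitValue j′ n))
      ; θ-≈ = λ q → cong₂ (λ a b → wθ isEps a ∧ not (wθ isEps b)) (unitValue-≈ j q) (unitValue-≈ j′ q)
      ; θ-z = ∧-falseˡ _ (cong (λ φ → wθ isEps (app φ one)) (projB-z j)) }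
    ; θ-p = λ n → go (unitValue j n) (unitValue j′ n)
        (≡.trans (app-d (fun (projB j) n) one) (≡.trans (*-identityʳ _) (dg (projB j) n)))
        (≡.trans (app-d (fun (projB j′) n) one) (≡.trans (*-identityʳ _) (dg (projB j′) n)))
        (proj₂ (fp (projB j) n) one) (proj₂ (fp (projB j′) n) one) }
    where
    go : ∀ {d} r r′ {u u′} → Act.deg unitₐ r ≡ d → Act.deg unitₐ r′ ≡ d →
         u ≡ Act.p unitₐ r → u′ ≡ Act.p unitₐ r′ → wθ isEps u ∧ not (wθ isEps u′) ≡ false
    go nul r′ q q′ refl refl = refl
    go eps r′ q q′ refl refl = refl
    -- Both components have the same degree, so if one is `one` then both are, and `p` turns both
    -- into `eps`: the second conjunct fails.
    go one one q q′ refl refl = refl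
    go one nul refl () _ _
    go one eps refl () _ _

  unitPair : ∀ {B B′} Bs → B ≡ Unit → B′ ≡ Unit → PaletteN (neg (B ∷ B′ ∷ Bs))
  unitPair Bs refl refl = record
    { γ = λ c → proj₁ (el c)
    ; good = λ c → null-nonE ⟦ Unit ∷ Unit ∷ Bs ⟧Bs (el c)
    ; T = λ { true → unitTest j₀ j₁ ; false → unitTest j₁ j₀ }
    ; hit = λ { true → refl ; false → refl }
    ; disj = λ { true n q r → dis (unitValue j₀ n) (unitValue j₁ n) q r
               ; false n q r → dis (unitValue j₁ n) (unitValue j₀ n) q r } }
    where
    j₀ j₁ : Unit ∈ Unit ∷ Unit ∷ Bs
    j₀ = here refl
    j₁ = there (here refl)
    el : Bool → Null ⟦ Unit ∷ Unit ∷ Bs ⟧Bs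
    el true = put {Bs = Unit ∷ Unit ∷ Bs} j₀ (ind isOne (eps , refl)) (zero₀ ⟦ Unit ∷ Unit ∷ Bs ⟧Bs)
    el false = put {Bs = Unit ∷ Unit ∷ Bs} j₁ (ind isOne (eps , refl)) (zero₀ ⟦ Unit ∷ Unit ∷ Bs ⟧Bs)
    dis : ∀ u v → wθ isEps u ∧ not (wθ isEps v) ≡ true → wθ isEps v ∧ not (wθ isEps u) ≡ true → ⊥
    dis eps eps () _
    dis eps nul _ ()
    dis eps one _ ()
    dis nul _ () _
    dis one _ () _

  Inhabited : Ctx → Set
  Inhabited [] = ⊥
  Inhabited (_ ∷ _) = ⊤

  mutual
    pointC : ∀ Γ → OkC Γ → PointC Γ
    pointC [] _ = record { pt = one ; good = refl ; T = isOne ; hit = refl }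
    pointC (N ∷ Γ) (n , g) = point-∷ {N} {Γ} (fromPalette {Good = Small N} (paletteN N n)) (pointC Γ g)

    paletteC : ∀ Γ → Inhabited Γ → OkC Γ → PaletteC Γ
    paletteC (N ∷ Γ) _ (n , g) = palette-∷ {N} {Γ} (paletteN N n) (pointC Γ g)

    headPoint : ∀ h → OkH h → HeadPoint h
    headPoint (at x) _ = headPoint-fromPalette atomPalette
    headPoint (ten []) _ = unitHeadPoint
    headPoint (ten (M ∷ N ∷ Q)) (q , some) = headPoint-fromPalette (tensorPalette (M ∷ N ∷ Q) refl q)

    tensorPalette : ∀ {M N Γ} Q → Q ≡ M ∷ N ∷ Γ → OkC Q → Palette ⟦ Q ⟧C (IsNull ⟦ Q ⟧C)
    tensorPalette {M} {N} {Γ} Q@(_ ∷ _ ∷ _) refl q = record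
      { γ = P.γ ; good = λ c → adm-null M N Γ (P.γ c) (P.good c) ; T = P.T ; hit = P.hit ; disj = P.disj }
      where module P = Palette (paletteC Q tt q)

    kind : ∀ B → OkB B → Kind B
    kind (br (N ∷ As) h) (a , b) = argsK (paletteC (N ∷ As) tt a) (headPoint h b)
    kind (br [] (at x)) _ = headK atomPalette
    kind (br [] (ten [])) _ = unitK
    kind (br [] (ten (M ∷ N ∷ Q))) (_ , q , some) = headK (tensorPalette (M ∷ N ∷ Q) refl q)

    -- A branch other than 1 supplies the colours; if the first two branches are both 1, the
    -- position of `eps` serves instead. `Proper` excludes a single branch 1.
    paletteN : ∀ N → OkN N → PaletteN N
    paletteN (neg []) _ = topPalette
    paletteN (neg (B ∷ [])) ((b , _) , w) with coloured (kind B b) | w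
    ... | inj₂ P | _ = palette-put {Bs = B ∷ []} (here refl) P
    ... | inj₁ () | atm
    ... | inj₁ () | fn
    paletteN (neg (B ∷ B′ ∷ Bs)) ((b , b′ , _) , _)
      with coloured (kind B b) | coloured (kind B′ b′)
    ... | inj₂ P | _ = palette-put {Bs = B ∷ B′ ∷ Bs} (here refl) P
    ... | inj₁ _ | inj₂ P = palette-put {Bs = B ∷ B′ ∷ Bs} (there (here refl)) P
    ... | inj₁ q | inj₁ q′ = unitPair Bs q q′

  -- What an elimination cannot see

  record SepOther {Bs B B′} (j : B ∈ Bs) (i : B′ ∈ Bs) : Set where
    field
      T    : Test ⟦ Bs ⟧Bs
      ν ν′ : Null ⟦ Bs ⟧Bs
      same : fun (projB j) (proj₁ ν) ≡ fun (projB j) (proj₁ ν′)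
      holds  : θ T (proj₁ ν) ≡ true
      fails   : θ T (proj₁ ν′) ≡ false
      unrecoverable : (f : ⟦ Bs ⟧Bs ⇒ ⟦ Bs ⟧Bs) →
        (∀ (S : Test ⟦ Bs ⟧Bs) (x : Null ⟦ Bs ⟧Bs) → θ S (fun f (proj₁ x)) ≡ θ S (proj₁ x)) →
        Act._≈_ ⟦ B′ ⟧B (fun (projB i) (fun f (proj₁ ν))) (fun (projB i) (fun f (proj₁ ν′))) → ⊥

  -- The two elements differ at `i` only. If branch `i` is 1, the change is to `eps`, which no test
  -- on that component detects; the test then also reads branch `j`, which is kept constant. Hence
  -- `unrecoverable` is recorded separately: testing component `i` alone would not give it.
  sepOther : ∀ {Bs B B′} (j : B ∈ Bs) (i : B′ ∈ Bs) → index j ≢ index i → OkBs Bs → SepOther j i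
  sepOther {Bs} {B} {B′} j i j≢i ok with coloured (kind B′ (okB i ok)) | coloured (kind B (okB j ok))
  ... | inj₂ P | _ = record
    { T = T ; ν = ν ; ν′ = zero₀ ⟦ Bs ⟧Bs
    ; same = put-other i j _ _ (λ q → j≢i (≡.sym q))
    ; holds = holds
    ; fails = θ-z T
    ; unrecoverable = λ f h q → clash (≡.trans (h T ν) holds)
        (≡.trans (θ-≈ (P.T true) q) (≡.trans (h T (zero₀ ⟦ Bs ⟧Bs)) (θ-z T))) }
    where
    module P = Palette P
    T = pull (projB i) (P.T true)
    ν = put i (P.γ true , P.good true) (zero₀ ⟦ Bs ⟧Bs)
    holds = ≡.trans (cong (θ (P.T true)) (put-same i _ (zero₀ ⟦ Bs ⟧Bs))) (P.hit true)
  ... | inj₁ refl | inj₂ P = record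
    { T = T ; ν = ν ; ν′ = ν′
    ; same = put-other i j _ _ i≢j
    ; holds = ∧-intro
        (≡.trans (cong (θ (P.T true)) (put-other i j _ ν′ i≢j)) holds′)
        (cong (λ φ → wθ isEps (app φ one)) (put-same i (ind isOne (eps , refl)) ν′))
    ; fails = fails
    ; unrecoverable = λ f h q → clash
        (∧-intro {θ T′ (fun f (proj₁ ν′))} (≡.trans (h T′ ν′) holds′)
          (≡.trans (cong (wθ isEps) (≡.sym (proj₂ q one)))
                   (proj₂ (∧-true {θ T′ (fun f (proj₁ ν))} (≡.trans (h T ν)
                     (∧-intro (≡.trans (cong (θ (P.T true)) (put-other i j _ ν′ i≢j)) holds′)
                       (cong (λ φ → wθ isEps (app φ one)) (put-same i (ind isOne (eps , refl)) ν′))))))))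
        (≡.trans (h T ν′) fails) }
    where
    module P = Palette P
    i≢j = λ q → j≢i (≡.sym q)
    T′ = pull (projB j) (P.T true)
    T : Test ⟦ Bs ⟧Bs
    T = restrict T′ (λ n → wθ isEps (unitValue i n)) (λ q → cong (wθ isEps) (unitValue-≈ i q))
    ν′ ν : Null ⟦ Bs ⟧Bs
    ν′ = put j (P.γ true , P.good true) (zero₀ ⟦ Bs ⟧Bs)
    ν = put i (ind isOne (eps , refl)) ν′
    holds′ : θ T′ (proj₁ ν′) ≡ true
    holds′ = ≡.trans (cong (θ (P.T true)) (put-same j _ (zero₀ ⟦ Bs ⟧Bs))) (P.hit true)
    fails : θ T (proj₁ ν′) ≡ false
    fails = ∧-falseʳ (θ T′ (proj₁ ν′)) (cong (λ φ → wθ isEps (app φ one))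
           (≡.trans (put-other j i _ (zero₀ ⟦ Bs ⟧Bs) j≢i) (projB-z i)))
  ... | inj₁ refl | inj₁ refl = record
    { T = unitTest i j ; ν = ν ; ν′ = zero₀ ⟦ Bs ⟧Bs
    ; same = put-other i j _ _ i≢j
    ; holds = holds
    ; fails = θ-z (unitTest i j)
    ; unrecoverable = λ f h q → clash
        (proj₁ (∧-true {wθ isEps (unitValue i (fun f (proj₁ ν)))} (≡.trans (h (unitTest i j) ν) holds)))
        (cong (wθ isEps) (≡.trans (proj₂ q one)
          (≡.trans (unitValue-≈ i (fz f)) (cong (λ φ → app φ one) (projB-z i))))) }
    where
    i≢j = λ q → j≢i (≡.sym q)
    ν : Null ⟦ Bs ⟧Bs
    ν = put i (ind isOne (eps , refl)) (zero₀ ⟦ Bs ⟧Bs)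
    holds : θ (unitTest i j) (proj₁ ν) ≡ true
    holds = ∧-intro
      (cong (λ φ → wθ isEps (app φ one)) (put-same i _ (zero₀ ⟦ Bs ⟧Bs)))
      (cong (λ φ → not (wθ isEps (app φ one)))
        (≡.trans (put-other i j (ind isOne (eps , refl)) (zero₀ ⟦ Bs ⟧Bs) i≢j) (projB-z j)))

  record Distinct {Bs As h} (j : br As h ∈ Bs) (T : Test ⟦ Bs ⟧Bs) (α : Car ⟦ As ⟧C) : Set where
    field
      ν ν′ : Null ⟦ Bs ⟧Bs
      same : app (fun (projB j) (proj₁ ν)) α ≡ app (fun (projB j) (proj₁ ν′)) α
      holds  : θ T (proj₁ ν) ≡ true
      fails   : θ T (proj₁ ν′) ≡ false

  -- The elimination left out, that of an atom without arguments, loses nothing when this atom is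
  -- the whole prime.
  data Elim : Ctx → Head → Set where
    argsE : ∀ {N As h} → Elim (N ∷ As) h
    tenE  : ∀ {As Q} → Elim As (ten Q)

  -- Applying one component of a prime to one argument loses information, and a single
  -- test detects this for every argument.
  sepElim : ∀ {Bs As h} → OkN (neg Bs) → (j : br As h ∈ Bs) → Elim As h →
            Σ (Test ⟦ Bs ⟧Bs) λ T → ∀ α → Distinct j T α
  sepElim (_ , atm) (here refl) ()
  sepElim (((a , b) , _) , fn {N} {As} {h}) (here refl) _ =
    -- Which colour `α` misses depends on `α`; probing at both colours gives one test for all `α`.
    either (probe true) (probe false) , λ α → let c , q = P.avoid α in record
      { ν = put j₀ (ind (P.T c) H.pt) (zero₀ ⟦ Bs₁ ⟧Bs)
      ; ν′ = zero₀ ⟦ Bs₁ ⟧Bs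
      ; same = ind-false {B = ⟦ h ⟧H} (P.T c) H.pt α q
      ; holds = holds c
      ; fails = θ-z (either (probe true) (probe false)) }
    where
    module P = Palette (paletteC (N ∷ As) tt a)
    module H = HeadPoint (headPoint h b)
    Bs₁ : List Br
    Bs₁ = br (N ∷ As) h ∷ []
    j₀ : br (N ∷ As) h ∈ Bs₁
    j₀ = here refl
    probe : Bool → Test ⟦ Bs₁ ⟧Bs
    probe c = pull (projB j₀) (atTest {B = ⟦ h ⟧H} (P.γ c) (adm-nonE N As (P.γ c) (P.good c)) H.W)
    hit : ∀ c → wθ H.W (app (proj₁ (ind {B = ⟦ h ⟧H} (P.T c) H.pt)) (P.γ c)) ≡ true
    hit c = ≡.trans (cong (wθ H.W) (ind-true {B = ⟦ h ⟧H} (P.T c) H.pt (P.γ c) (P.hit c))) H.hit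
    ∨-trueˡ : ∀ {a} → a ≡ true → ∀ b → a ∨ b ≡ true
    ∨-trueˡ refl b = refl
    ∨-trueʳ : ∀ a {b} → b ≡ true → a ∨ b ≡ true
    ∨-trueʳ true _ = refl
    ∨-trueʳ false q = q
    holds : ∀ c → wθ H.W (app (proj₁ (ind {B = ⟦ h ⟧H} (P.T c) H.pt)) (P.γ true)) ∨
                wθ H.W (app (proj₁ (ind {B = ⟦ h ⟧H} (P.T c) H.pt)) (P.γ false)) ≡ true
    holds true = ∨-trueˡ (hit true) _
    holds false = ∨-trueʳ _ (hit false)
  -- With two or more branches, some other component is invisible to the elimination.
  sepElim (ok , amp {B} {B′} {Bs}) j@(here refl) _ = S.T , λ α → record
    { ν = S.ν ; ν′ = S.ν′ ; same = cong (λ φ → app φ α) S.same ; holds = S.holds ; fails = S.fails }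
    where module S = SepOther (sepOther {Bs = B ∷ B′ ∷ Bs} j (there (here refl)) (λ ()) ok)
  sepElim (ok , amp {B} {B′} {Bs}) j@(there _) _ = S.T , λ α → record
    { ν = S.ν ; ν′ = S.ν′ ; same = cong (λ φ → app φ α) S.same ; holds = S.holds ; fails = S.fails }
    where module S = SepOther (sepOther {Bs = B ∷ B′ ∷ Bs} j (here refl) (λ ()) ok)

  -- Rigidity of contexts

  -- The identity as far as tests on admissible inputs can tell.
  FixC : ∀ Γ → ⟦ Γ ⟧C ⇒ ⟦ Γ ⟧C → Set
  FixC Γ f = ∀ (T : Test ⟦ Γ ⟧C) x → Adm Γ x → θ T (fun f x) ≡ θ T x

  FixN : ∀ N → ⟦ N ⟧N ⇒ ⟦ N ⟧N → Set
  FixN N f = ∀ (T : Test ⟦ N ⟧N) x → Small N x → θ T (fun f x) ≡ θ T x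

  -- `T` and `σ` are chosen before `α`, since the argument that a proof feeds to the hypothesis is
  -- computed from the other inputs `σ`.
  record SepCtx {Γ Γ′ Bs As h} (i : Γ ≔ neg Bs ∷ [] ⊕ Γ′) (j : br As h ∈ Bs) : Set where
    field
      T : Test ⟦ Γ ⟧C
      σ : Car ⟦ Γ′ ⟧C
      σ-adm : Adm Γ′ σ
    input : Car ⟦ Bs ⟧Bs → Car ⟦ Γ ⟧C
    input κ = mg i (κ , one) σ
    field
      pick : ∀ α → Σ (Null ⟦ Bs ⟧Bs × Null ⟦ Bs ⟧Bs) λ κs →
        (app (fun (projB j) (proj₁ (proj₁ κs))) α ≡ app (fun (projB j) (proj₁ (proj₂ κs))) α) ×
        (θ T (input (proj₁ (proj₁ κs))) ≡ true) × (θ T (input (proj₁ (proj₂ κs))) ≡ false)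
    adm : (κ : Null ⟦ Bs ⟧Bs) → Adm Γ (input (proj₁ κ))
    adm κ = mg-adm i (null-nonE ⟦ Bs ⟧Bs κ , refl) σ-adm
    sp-input : (κ : Null ⟦ Bs ⟧Bs) → fun (sp i) (input (proj₁ κ)) ≡ ((proj₁ κ , one) , σ)
    sp-input κ = sp-mg i (null-nonE ⟦ Bs ⟧Bs κ , refl) σ-adm

  sepCtx : ∀ {Γ Γ′ Bs As h} (i : Γ ≔ neg Bs ∷ [] ⊕ Γ′) (j : br As h ∈ Bs) →
           OkC Γ → Elim As h → SepCtx i j
  sepCtx {Γ} {Γ′} {Bs} i j ok el = record
    { T = T ; σ = P.pt ; σ-adm = P.good
    ; pick = λ α → let module D = Distinct (proj₂ S α) in
        (D.ν , D.ν′) , D.same ,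
        ≡.trans (val D.ν) (∧-intro (∧-intro D.holds refl) P.hit) ,
        ≡.trans (val D.ν′) (∧-falseˡ _ (∧-falseˡ _ D.fails)) }
    where
    module P = Point (pointC Γ′ (okR i ok))
    S = sepElim (proj₁ (okL i ok)) j el
    T = pull (sp i) ((proj₁ S ⊠ isOne) ⊠ P.T)
    val : (κ : Null ⟦ Bs ⟧Bs) → θ T (mg i (proj₁ κ , one) P.pt) ≡
          (θ (proj₁ S) (proj₁ κ) ∧ true) ∧ θ P.T P.pt
    val κ = cong (θ ((proj₁ S ⊠ isOne) ⊠ P.T)) (sp-mg i (null-nonE ⟦ Bs ⟧Bs κ , refl) P.good)

  -- A leading step sees its hypothesis only through one branch at one argument. Two inputs that
  -- agree there have the same image, although a test preserved by the composite with `g` tells them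
  -- apart.
  splits : ∀ {Γ Δ} (f : Γ ⊢H ten Δ) (g : ⟦ Δ ⟧C ⇒ ⟦ Γ ⟧C) → OkC Γ → FixC Γ (g ∙ evH f) →
           Σ (Γ ⊢T Δ) λ a → f ≡ split a
  splits (split a) g ok q = a , refl
  splits {Γ} {Δ} (bind (step {Γ′ = Γ′} {Bs = Bs} {Q = Q} i j k a) r) g ok q = ⊥-elim (clash
      (≡.trans (q S.T _ (S.adm κ)) holds)
      (≡.trans (cong (λ y → θ S.T (fun g y)) same)
               (≡.trans (q S.T _ (S.adm κ′)) fails)))
    where
    module S = SepCtx (sepCtx i j ok (tenE {Q = Q}))
    α = fun (evT a) (L k S.σ)
    κ = proj₁ (proj₁ (S.pick α))
    κ′ = proj₂ (proj₁ (S.pick α))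
    holds = proj₁ (proj₂ (proj₂ (S.pick α)))
    fails = proj₂ (proj₂ (proj₂ (S.pick α)))
    K : Car ⟦ neg Bs ∷ [] ⟧C × Car ⟦ Γ′ ⟧C → Car ⟦ Δ ⟧C
    K y = fun (evH r) (fun (jn Q) (app (fun (foc j) (proj₁ y)) (fun (evT a) (L k (proj₂ y))) , R k (proj₂ y)))
    same : fun (evH (bind (step i j k a) r)) (S.input (proj₁ κ)) ≡
           fun (evH (bind (step i j k a) r)) (S.input (proj₁ κ′))
    same = ≡.trans (cong K (S.sp-input κ))
      (≡.trans (cong (λ h → fun (evH r) (fun (jn Q) (h , R k S.σ))) (proj₁ (proj₂ (S.pick α))))
               (≡.sym (cong K (S.sp-input κ′))))

  record Assocʳ {Γ Γ₁ Γ₂ Γ₂₀ Γ₂₁} (i : Γ ≔ Γ₁ ⊕ Γ₂) (i′ : Γ₂ ≔ Γ₂₀ ⊕ Γ₂₁) : Set where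
    field
      {Γ₁₀} : Ctx
      j  : Γ ≔ Γ₁₀ ⊕ Γ₂₁
      j′ : Γ₁₀ ≔ Γ₁ ⊕ Γ₂₀
      eq₁ : ∀ x → Uni Γ x → L j′ (L j x) ≡ L i x
      eq₂ : ∀ x → Uni Γ x → R j′ (L j x) ≡ L i′ (R i x)
      eq₃ : ∀ x → Uni Γ x → R j x ≡ R i′ (R i x)

  assocʳ : ∀ {Γ Γ₁ Γ₂ Γ₂₀ Γ₂₁} (i : Γ ≔ Γ₁ ⊕ Γ₂) (i′ : Γ₂ ≔ Γ₂₀ ⊕ Γ₂₁) → Assocʳ i i′
  assocʳ nil nil = record
    { j = nil ; j′ = nil ; eq₁ = λ { _ refl → refl } ; eq₂ = λ { _ refl → refl } ; eq₃ = λ { _ refl → refl } }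
  assocʳ (left i) i′ = record
    { j = left A.j ; j′ = left A.j′ ; eq₁ = λ x u → cong (proj₁ x ,_) (A.eq₁ (proj₂ x) u)
    ; eq₂ = λ x → A.eq₂ (proj₂ x) ; eq₃ = λ x → A.eq₃ (proj₂ x) }
    where module A = Assocʳ (assocʳ i i′)
  assocʳ (right i) (left i′) = record
    { j = left A.j ; j′ = right A.j′ ; eq₁ = λ x → A.eq₁ (proj₂ x)
    ; eq₂ = λ x u → cong (proj₁ x ,_) (A.eq₂ (proj₂ x) u) ; eq₃ = λ x → A.eq₃ (proj₂ x) }
    where module A = Assocʳ (assocʳ i i′)
  assocʳ (right i) (right i′) = record
    { j = right A.j ; j′ = A.j′ ; eq₁ = λ x → A.eq₁ (proj₂ x)
    ; eq₂ = λ x → A.eq₂ (proj₂ x) ; eq₃ = λ x u → cong (proj₁ x ,_) (A.eq₃ (proj₂ x) u) }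
    where module A = Assocʳ (assocʳ i i′)

  record Exch {Γ Γ₁ Γ₂ Γ₂₀ Γ₂₁} (i : Γ ≔ Γ₁ ⊕ Γ₂) (i′ : Γ₂ ≔ Γ₂₀ ⊕ Γ₂₁) : Set where
    field
      {Γ₁₁} : Ctx
      j  : Γ ≔ Γ₂₀ ⊕ Γ₁₁
      j′ : Γ₁₁ ≔ Γ₁ ⊕ Γ₂₁
      eq₁ : ∀ x → Uni Γ x → L j′ (R j x) ≡ L i x
      eq₂ : ∀ x → Uni Γ x → L j x ≡ L i′ (R i x)
      eq₃ : ∀ x → Uni Γ x → R j′ (R j x) ≡ R i′ (R i x)

  exch : ∀ {Γ Γ₁ Γ₂ Γ₂₀ Γ₂₁} (i : Γ ≔ Γ₁ ⊕ Γ₂) (i′ : Γ₂ ≔ Γ₂₀ ⊕ Γ₂₁) → Exch i i′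
  exch nil nil = record
    { j = nil ; j′ = nil ; eq₁ = λ { _ refl → refl } ; eq₂ = λ { _ refl → refl } ; eq₃ = λ { _ refl → refl } }
  exch (left i) i′ = record
    { j = right A.j ; j′ = left A.j′ ; eq₁ = λ x u → cong (proj₁ x ,_) (A.eq₁ (proj₂ x) u)
    ; eq₂ = λ x → A.eq₂ (proj₂ x) ; eq₃ = λ x → A.eq₃ (proj₂ x) }
    where module A = Exch (exch i i′)
  exch (right i) (left i′) = record
    { j = left A.j ; j′ = A.j′ ; eq₁ = λ x → A.eq₁ (proj₂ x)
    ; eq₂ = λ x u → cong (proj₁ x ,_) (A.eq₂ (proj₂ x) u) ; eq₃ = λ x → A.eq₃ (proj₂ x) }
    where module A = Exch (exch i i′)
  exch (right i) (right i′) = record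
    { j = right A.j ; j′ = right A.j′ ; eq₁ = λ x → A.eq₁ (proj₂ x)
    ; eq₂ = λ x → A.eq₂ (proj₂ x) ; eq₃ = λ x u → cong (proj₁ x ,_) (A.eq₃ (proj₂ x) u) }
    where module A = Exch (exch i i′)

  -- A split proof distributes its hypotheses over the primes it proves, so it can be cut along any
  -- interleaving of these.
  record SplitT {Γ Δ Δ₀ Δ₁} (f : Γ ⊢T Δ) (j : Δ ≔ Δ₀ ⊕ Δ₁) : Set where
    field
      {Γ₀ Γ₁} : Ctx
      k  : Γ ≔ Γ₀ ⊕ Γ₁
      f₀ : Γ₀ ⊢T Δ₀
      f₁ : Γ₁ ⊢T Δ₁
      coh : ∀ x → Uni Γ x → Act._≈_ (⟦ Δ₀ ⟧C ⊗ₐ ⟦ Δ₁ ⟧C)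
              (fun (sp j) (fun (evT f) x)) (fun (evT f₀) (L k x) , fun (evT f₁) (R k x))

  splitT : ∀ {Γ Δ Δ₀ Δ₁} (f : Γ ⊢T Δ) (j : Δ ≔ Δ₀ ⊕ Δ₁) → SplitT f j
  splitT nil nil = record { k = nil ; f₀ = nil ; f₁ = nil ; coh = λ { _ refl → cmp refl refl } }
  splitT (cons {N = N} i a b) (left {Γ₁ = Δ₀} {Γ₂ = Δ₁} j) = record
    { k = A.j ; f₀ = cons A.j′ a S.f₀ ; f₁ = S.f₁
    ; coh = λ x u → ~trans
        (resp (αₐ⁻ {⟦ N ⟧N} {⟦ Δ₀ ⟧C} {⟦ Δ₁ ⟧C})
          (cmp (Act.≈-refl ⟦ N ⟧N) (S.coh (R i x) (proj₂ (sp-uni i x u)))))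
        (Act.≈-reflexive (⟦ N ∷ Δ₀ ⟧C ⊗ₐ ⟦ Δ₁ ⟧C)
          (≡.sym (cong₂ _,_
            (cong₂ _,_ (cong (fun (evN a)) (A.eq₁ x u)) (cong (fun (evT S.f₀)) (A.eq₂ x u)))
            (cong (fun (evT S.f₁)) (A.eq₃ x u))))) }
    where
    module S = SplitT (splitT b j)
    module A = Assocʳ (assocʳ i S.k)
  splitT (cons {N = N} i a b) (right {Γ₁ = Δ₀} {Γ₂ = Δ₁} j) = record
    { k = A.j ; f₀ = S.f₀ ; f₁ = cons A.j′ a S.f₁
    ; coh = λ x u → ~trans
        (resp (αₐ {⟦ Δ₀ ⟧C} {⟦ N ⟧N} {⟦ Δ₁ ⟧C} ∙ (σₐ {⟦ N ⟧N} {⟦ Δ₀ ⟧C} ⊗ₘ idₐ {⟦ Δ₁ ⟧C}) ∙ αₐ⁻)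
          (cmp (Act.≈-refl ⟦ N ⟧N) (S.coh (R i x) (proj₂ (sp-uni i x u)))))
        (Act.≈-reflexive (⟦ Δ₀ ⟧C ⊗ₐ ⟦ N ∷ Δ₁ ⟧C)
          (≡.sym (cong₂ _,_ (cong (fun (evT S.f₀)) (A.eq₂ x u))
            (cong₂ _,_ (cong (fun (evN a)) (A.eq₁ x u)) (cong (fun (evT S.f₁)) (A.eq₃ x u)))))) }
    where
    module S = SplitT (splitT b j)
    module A = Exch (exch i S.k)

  evT-uni : ∀ {Γ Δ} (f : Γ ⊢T Δ) x → Uni Γ x → Uni Δ (fun (evT f) x)
  evT-uni nil x u = u
  evT-uni (cons i a b) x u = evT-uni b (R i x) (proj₂ (sp-uni i x u))

  ⊕-=S : ∀ {Γ Γ₁ Γ₂} → Γ ≔ Γ₁ ⊕ Γ₂ → ⌜ Γ ⌝C =S ⌜ Γ₁ ⌝C ⊗ ⌜ Γ₂ ⌝C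
  ⊕-=S nil = sym ⊗-unit
  ⊕-=S (left i) = trans (⊗-cong refl (⊕-=S i)) ⊗-assoc
  ⊕-=S (right i) = trans (⊗-cong refl (trans (⊕-=S i) ⊗-comm))
    (trans ⊗-assoc ⊗-comm)

  ⟪_⟫ : ∀ {M N} → M ∷ [] ⊢N N → ⟦ M ⟧N ⇒ ⟦ N ⟧N
  ⟪ f ⟫ = evN f ∙ ρₐ⁻ _

  RigidN : Neg → Set
  RigidN N = ∀ {M} → OkN M → (f : N ∷ [] ⊢N M) (g : M ∷ [] ⊢N N) →
    FixN N (⟪ g ⟫ ∙ ⟪ f ⟫) → FixN M (⟪ f ⟫ ∙ ⟪ g ⟫) → ⌜ N ⌝N =S ⌜ M ⌝N

  -- An output that is not wired to an input cannot reproduce both colours of that input.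
  module _ {N Γ} (ok : OkC (N ∷ Γ)) where
    private
      PN = paletteN N (proj₁ ok)
      PΓ = pointC Γ (proj₂ ok)
      module PN = Palette PN
      module PΓ = Point PΓ

    -- `g₀` produces `N` from `Δ₀`, and `f₀` produces `Δ₀` from `Γ₀`. The wiring forces `Γ₀` and
    -- `Δ₀` to be single primes, and the rest of `f` and of `g` are again inverse up to tests.
    rigidPeel : ∀ {Δ Δ₀ Δᵣ Γ₀ Γ₁} → OkC Δ → RigidN N →
      (jΔ : Δ ≔ Δ₀ ⊕ Δᵣ) (g₀ : Δ₀ ⊢N N) (gᵣ : Δᵣ ⊢T Γ) (f : N ∷ Γ ⊢T Δ)
      (k : N ∷ Γ ≔ Γ₀ ⊕ Γ₁) (f₀ : Γ₀ ⊢T Δ₀) (f₁ : Γ₁ ⊢T Δᵣ) →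
      (∀ x → Uni (N ∷ Γ) x → Act._≈_ (⟦ Δ₀ ⟧C ⊗ₐ ⟦ Δᵣ ⟧C)
         (fun (sp jΔ) (fun (evT f) x)) (fun (evT f₀) (L k x) , fun (evT f₁) (R k x))) →
      FixC (N ∷ Γ) (evT (cons jΔ g₀ gᵣ) ∙ evT f) → FixC Δ (evT f ∙ evT (cons jΔ g₀ gᵣ)) →
      Σ Neg λ M → (Δ₀ ≡ M ∷ []) × (⌜ N ⌝N =S ⌜ M ⌝N) ×
        Σ (Γ ⊢T Δᵣ) λ f′ → FixC Γ (evT gᵣ ∙ evT f′) × FixC Δᵣ (evT f′ ∙ evT gᵣ)
    -- `N` is used for `Δᵣ`, so the `N` that comes back ignores its colour.
    rigidPeel okΔ r jΔ g₀ gᵣ f (right k) f₀ f₁ coh q q′ =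
      ⊥-elim (PN.disj true _ (val true) (val false))
      where
      val : ∀ c → θ (PN.T c) (fun (evN g₀) (fun (evT f₀) (L k PΓ.pt))) ≡ true
      val c = proj₁ (∧-true (≡.trans
        (≡.sym (θ-≈ (PN.T c ⊠ PΓ.T) (resp (evN g₀ ⊗ₘ evT gᵣ)
          (coh (PN.γ c , PΓ.pt) (adm-uni Γ PΓ.good)))))
        (≡.trans (q (PN.T c ⊠ PΓ.T) (PN.γ c , PΓ.pt) (PN.good c , PΓ.good))
                 (∧-intro (PN.hit c) PΓ.hit))))
    -- Another prime of `Γ` is used up for `Δ₀`, so its colour is lost to the `Γ` that comes back.
    rigidPeel okΔ r jΔ g₀ gᵣ f (left {Γ₁ = K ∷ Γ₀} {Γ₂ = Γ₁} k) f₀ f₁ coh q q′ =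
      ⊥-elim (P.disj true _ (val true) (val false))
      where
      P₀ = paletteC (K ∷ Γ₀) tt (okL k (proj₂ ok))
      P₁ = pointC Γ₁ (okR k (proj₂ ok))
      P = palette-⊕ˡ k P₀ P₁
      module P₀ = Palette P₀
      module P₁ = Point P₁
      module P = Palette P
      val : ∀ c → θ (P.T c) (fun (evT gᵣ) (fun (evT f₁) P₁.pt)) ≡ true
      val c = ≡.trans
        (cong (λ y → θ (P.T c) (fun (evT gᵣ) (fun (evT f₁) y)))
              (≡.sym (cong proj₂ (sp-mg k (P₀.good c) P₁.good))))
        (proj₂ (∧-true {θ (PN.T true) (fun (evN g₀) (fun (evT f₀) (L (left {N = N} k) (PN.γ true , P.γ c))))} (≡.trans
          (≡.sym (θ-≈ (PN.T true ⊠ P.T c) (resp (evN g₀ ⊗ₘ evT gᵣ)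
            (coh (PN.γ true , P.γ c) (adm-uni Γ (P.good c))))))
          (≡.trans (q (PN.T true ⊠ P.T c) (PN.γ true , P.γ c) (PN.good true , P.good c))
                   (∧-intro (PN.hit true) (P.hit c))))))
    rigidPeel {Δ} {Δ₀} {Δᵣ} okΔ r jΔ g₀ gᵣ f (left {Γ₁ = []} {Γ₂ = Γ₁} k) f₀ f₁ coh q q′
      with ⊕-[]ˡ-≡ k
    ... | refl with ⊕-[]ˡ-unique k
    ... | refl = go f₀ g₀ jΔ coh q q′
      where
      go : ∀ {Δ₀} (f₀ : N ∷ [] ⊢T Δ₀) (g₀ : Δ₀ ⊢N N) (jΔ : Δ ≔ Δ₀ ⊕ Δᵣ) →
        (∀ x → Uni (N ∷ Γ) x → Act._≈_ (⟦ Δ₀ ⟧C ⊗ₐ ⟦ Δᵣ ⟧C)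
           (fun (sp jΔ) (fun (evT f) x))
           (fun (evT f₀) (proj₁ x , L (⊕-[]ˡ Γ) (proj₂ x)) , fun (evT f₁) (R (⊕-[]ˡ Γ) (proj₂ x)))) →
        FixC (N ∷ Γ) (evT (cons jΔ g₀ gᵣ) ∙ evT f) → FixC Δ (evT f ∙ evT (cons jΔ g₀ gᵣ)) →
        Σ Neg λ M → (Δ₀ ≡ M ∷ []) × (⌜ N ⌝N =S ⌜ M ⌝N) ×
          Σ (Γ ⊢T Δᵣ) λ f′ → FixC Γ (evT gᵣ ∙ evT f′) × FixC Δᵣ (evT f′ ∙ evT gᵣ)
      go {Δ₀} f₀ g₀ jΔ coh q q′ = back f₀ refl
        where
        Pᵣ = pointC Δᵣ (okR jΔ okΔ)
        module Pᵣ = Point Pᵣ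

        coh′ : ∀ n x → Uni Γ x → Act._≈_ (⟦ Δ₀ ⟧C ⊗ₐ ⟦ Δᵣ ⟧C)
          (fun (sp jΔ) (fun (evT f) (n , x))) (fun (evT f₀) (n , one) , fun (evT f₁) x)
        coh′ n x u = subst (λ y → Act._≈_ (⟦ Δ₀ ⟧C ⊗ₐ ⟦ Δᵣ ⟧C)
          (fun (sp jΔ) (fun (evT f) (n , x))) (fun (evT f₀) (n , proj₁ y) , fun (evT f₁) (proj₂ y)))
          (sp-[]ˡ-uni Γ u) (coh (n , x) u)

        there-back : (S : Test ⟦ N ⟧N) (T : Test ⟦ Γ ⟧C) → ∀ n x → Small N n → Adm Γ x →
          θ S (fun (evN g₀) (fun (evT f₀) (n , one))) ∧ θ T (fun (evT gᵣ) (fun (evT f₁) x)) ≡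
          θ S n ∧ θ T x
        there-back S T n x a b = ≡.trans
          (≡.sym (θ-≈ (S ⊠ T) (resp (evN g₀ ⊗ₘ evT gᵣ) (coh′ n x (adm-uni Γ b)))))
          (q (S ⊠ T) (n , x) (a , b))

        back-there : (S : Test ⟦ Δ₀ ⟧C) (T : Test ⟦ Δᵣ ⟧C) → ∀ y w → Adm Δ₀ y → Adm Δᵣ w →
          θ S (fun (evT f₀) (fun (evN g₀) y , one)) ∧ θ T (fun (evT f₁) (fun (evT gᵣ) w)) ≡
          θ S y ∧ θ T w
        back-there S T y w a b = ≡.trans
          (≡.sym (θ-≈ (S ⊠ T) (subst
            (λ v → Act._≈_ (⟦ Δ₀ ⟧C ⊗ₐ ⟦ Δᵣ ⟧C)
              (fun (sp jΔ) (fun (evT f) (fun (evN g₀) (proj₁ v) , fun (evT gᵣ) (proj₂ v))))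
              (fun (evT f₀) (fun (evN g₀) y , one) , fun (evT f₁) (fun (evT gᵣ) w)))
            (≡.sym (sp-mg jΔ a b))
            (coh′ _ _ (evT-uni gᵣ w (adm-uni Δᵣ b))))))
          (≡.trans (q′ (pull (sp jΔ) (S ⊠ T)) (mg jΔ y w) (mg-adm jΔ a b))
                   (cong (θ (S ⊠ T)) (sp-mg jΔ a b)))

        colours : (P : PaletteC Δ₀) → ∀ c →
          θ (Palette.T P c) (fun (evT f₀) (fun (evN g₀) (Palette.γ P c) , one)) ≡ true
        colours P c = proj₁ (∧-true (≡.trans
          (back-there (P.T c) Pᵣ.T (P.γ c) Pᵣ.pt (P.good c) Pᵣ.good)
          (∧-intro (P.hit c) Pᵣ.hit)))
          where module P = Palette P

        back : (f₀′ : N ∷ [] ⊢T Δ₀) → f₀′ ≡ f₀ →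
          Σ Neg λ M → (Δ₀ ≡ M ∷ []) × (⌜ N ⌝N =S ⌜ M ⌝N) ×
            Σ (Γ ⊢T Δᵣ) λ f′ → FixC Γ (evT gᵣ ∙ evT f′) × FixC Δᵣ (evT f′ ∙ evT gᵣ)
        -- The first prime `M` of `Δ₀` does not receive `N` and is therefore constant.
        back (cons {N = M} {Δ = Δ₁} (right nil) a b) refl =
          ⊥-elim (PM.disj true (fun (evN a) one) (val true) (val false))
          where
          okM = okL jΔ okΔ
          PM = paletteN M (proj₁ okM)
          P₁ = pointC Δ₁ (proj₂ okM)
          module PM = Palette PM
          val : ∀ c → θ (PM.T c) (fun (evN a) one) ≡ true
          val c = proj₁ (∧-true {b = θ (Point.T P₁) (fun (evT b) (fun (evN g₀) (PM.γ c , Point.pt P₁) , one))} (colours (palette-∷ {M} {Δ₁} PM P₁) c))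
        -- `M` takes `N`, so the remaining primes of `Δ₀` are constant.
        back (cons {N = M} {Δ = M′ ∷ Δ₁} (left nil) a b) refl =
          ⊥-elim (P₁.disj true (fun (evT b) one) (val true) (val false))
          where
          okM = okL jΔ okΔ
          PM = paletteN M (proj₁ okM)
          P₁ = paletteC (M′ ∷ Δ₁) tt (proj₂ okM)
          module P₁ = Palette P₁
          module PM = Palette PM
          val : ∀ c → θ (P₁.T c) (fun (evT b) one) ≡ true
          val c = proj₂ (∧-true {θ (PM.T true) (fun (evN a) (fun (evN g₀) (PM.γ true , P₁.γ c) , one))} (colours (palette-∷ʳ {M} {M′ ∷ Δ₁} (fromPalette {Good = Small M} PM) P₁) c))
        back (cons {N = M} {Δ = []} (left nil) a nil) refl =
          M , refl , r (proj₁ okM) a g₀ fixN fixM , f₁ , fixΓ , fixΔ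
          where
          okM = okL jΔ okΔ
          PM = paletteN M (proj₁ okM)
          module PM = Palette PM
          -- A test on one factor is paired with a test that holds on the other factor before and
          -- after the round trip, and the latter cancels.
          fixN : FixN N (⟪ g₀ ⟫ ∙ ⟪ a ⟫)
          fixN S n s = cancel-true
            (there-back S PΓ.T n PΓ.pt s PΓ.good) PΓ.hit
            (proj₂ (∧-true (≡.trans (there-back (PN.T true) PΓ.T (PN.γ true) PΓ.pt (PN.good true) PΓ.good)
                                    (∧-intro (PN.hit true) PΓ.hit))))
            where
            cancel-true : ∀ {u v u′ v′} → u ∧ v ≡ u′ ∧ v′ → v′ ≡ true → v ≡ true → u ≡ u′
            cancel-true {u} {_} {u′} q refl refl =
              ≡.trans (≡.sym (∧-identityʳ u)) (≡.trans q (∧-identityʳ u′))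
          fixM : FixN M (⟪ a ⟫ ∙ ⟪ g₀ ⟫)
          fixM S m s = cancel-true
            (back-there (S ⊠ isOne) Pᵣ.T (m , one) Pᵣ.pt (s , refl) Pᵣ.good) Pᵣ.hit
            (proj₂ (∧-true (≡.trans
              (back-there (PM.T true ⊠ isOne) Pᵣ.T (PM.γ true , one) Pᵣ.pt (PM.good true , refl) Pᵣ.good)
              (∧-intro (∧-intro (PM.hit true) refl) Pᵣ.hit))))
            where
            ∧-units : ∀ b → (b ∧ true) ∧ true ≡ b
            ∧-units b = ≡.trans (∧-identityʳ (b ∧ true)) (∧-identityʳ b)
            cancel-true : ∀ {u v u′ v′} → (u ∧ true) ∧ v ≡ (u′ ∧ true) ∧ v′ → v′ ≡ true → v ≡ true → u ≡ u′
            cancel-true {u} {_} {u′} q refl refl = ≡.trans (≡.sym (∧-units u)) (≡.trans q (∧-units u′))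
          fixΓ : FixC Γ (evT gᵣ ∙ evT f₁)
          fixΓ S x s = cancelˡ (there-back (PN.T true) S (PN.γ true) x (PN.good true) s)
            (fixN (PN.T true) (PN.γ true) (PN.good true)) (PN.hit true)
            where
            cancelˡ : ∀ {u v u′ v′} → u ∧ v ≡ u′ ∧ v′ → u ≡ u′ → u′ ≡ true → v ≡ v′
            cancelˡ q refl refl = q
          fixΔ : FixC Δᵣ (evT f₁ ∙ evT gᵣ)
          fixΔ S x s = cancelˡ
            (back-there (PM.T true ⊠ isOne) S (PM.γ true , one) x (PM.good true , refl) s)
            (fixM (PM.T true) (PM.γ true) (PM.good true)) (PM.hit true)
            where
            cancelˡ : ∀ {u v u′ v′} → (u ∧ true) ∧ v ≡ (u′ ∧ true) ∧ v′ → u ≡ u′ → u′ ≡ true → v ≡ v′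
            cancelˡ q refl refl = q

  rigidT : ∀ Γ → All RigidN Γ → OkC Γ → ∀ {Δ} → OkC Δ → (f : Γ ⊢T Δ) (g : Δ ⊢T Γ) →
           FixC Γ (evT g ∙ evT f) → FixC Δ (evT f ∙ evT g) → ⌜ Γ ⌝C =S ⌜ Δ ⌝C
  rigidT [] _ _ _ f nil _ _ = refl
  rigidT (N ∷ Γ) (r ∷ rs) ok okΔ f (cons jΔ g₀ gᵣ) q q′
    with rigidPeel ok okΔ r jΔ g₀ gᵣ f S.k S.f₀ S.f₁ S.coh q q′
    where module S = SplitT (splitT f jΔ)
  ... | M , refl , N=M , f′ , fixΓ , fixΔ =
    trans (⊗-cong N=M (rigidT Γ rs (proj₂ ok) (okR jΔ okΔ) f′ gᵣ fixΓ fixΔ))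
      (sym (trans (⊕-=S jΔ) (⊗-cong ⊗-unit refl)))

  -- Rigidity of primes

  -- A proof of a branch of one prime from another prime Bs must begin by eliminating Bs.
  data Focus (Bs : List Br) (T : Ctx) : Head → ∀ {B} → B ∈ Bs → Set where
    fat  : ∀ {As x} (i : br As (at x) ∈ Bs) → T ⊢T As → Focus Bs T (at x) i
    ften : ∀ {As Q Ta Tr h} (i : br As (ten Q) ∈ Bs) → T ≔ Ta ⊕ Tr → Ta ⊢T As →
           Q ++ Tr ⊢H h → Focus Bs T h i

  evF : ∀ {Bs T h B} {i : B ∈ Bs} → Focus Bs T h i → ⟦ Bs ⟧Bs ⊗ₐ ⟦ T ⟧C ⇒ ⟦ h ⟧H
  evF (fat i a) = evalₐ ∙ (projB i ⊗ₘ evT a)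
  evF (ften {Q = Q} i k a r) =
    evH r ∙ jn Q ∙ (evalₐ ⊗ₘ idₐ) ∙ αₐ⁻ ∙ (projB i ⊗ₘ ((evT a ⊗ₘ idₐ) ∙ sp k))

  argF : ∀ {Bs T h As h′} {i : br As h′ ∈ Bs} → Focus Bs T h i → Car ⟦ T ⟧C → Car ⟦ As ⟧C
  argF (fat i a) u = fun (evT a) u
  argF (ften i k a r) u = fun (evT a) (L k u)

  evF-cong : ∀ {Bs T h As h′} {i : br As h′ ∈ Bs} (φ : Focus Bs T h i) {ν ν′} u →
    Act._≈_ ⟦ h′ ⟧H (app (fun (projB i) ν) (argF φ u)) (app (fun (projB i) ν′) (argF φ u)) →
    Act._≈_ ⟦ h ⟧H (fun (evF φ) (ν , u)) (fun (evF φ) (ν′ , u))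
  evF-cong (fat i a) u q = q
  evF-cong (ften {Q = Q} {Tr = Tr} i k a r) u q = resp (evH r ∙ jn Q) (cmp q (Act.≈-refl ⟦ Tr ⟧C))

  lookupB : ∀ {Γ Bs As h} → Γ ⊢B Bs → br As h ∈ Bs → Γ ++ As ⊢H h
  lookupB (f ∷ fs) (here refl) = f
  lookupB (f ∷ fs) (there j) = lookupB fs j

  lookupB-ev : ∀ {Γ Bs As h} (fs : Γ ⊢B Bs) (j : br As h ∈ Bs) x s →
    app (fun (projB j) (fun (evB fs) x)) s ≡ fun (evH (lookupB fs j)) (fun (jn Γ) (x , s))
  lookupB-ev (f ∷ fs) (here refl) x s = refl
  lookupB-ev (f ∷ fs) (there j) x s = lookupB-ev fs j x s

  inhabited : ∀ {T K Γ} → T ≔ K ∷ [] ⊕ Γ → Inhabited T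
  inhabited (left i) = tt
  inhabited (right i) = tt

  adm-nonE′ : ∀ T → Inhabited T → ∀ x → Adm T x → NonE (Act.deg ⟦ T ⟧C x)
  adm-nonE′ (N ∷ T) _ x a = adm-nonE N T x a

  module Focusing {Bs Bs′ T h} (j : br T h ∈ Bs′) (okM : OkN (neg Bs′))
    (F : ⟦ Bs ⟧Bs ⇒ ⟦ Bs′ ⟧Bs) (G : ⟦ Bs′ ⟧Bs ⇒ ⟦ Bs ⟧Bs) (fix : FixN (neg Bs′) (F ∙ G))
    where
    private
      okT : OkC T
      okT = proj₁ (okB j (proj₁ okM))
      okh : OkH h
      okh = proj₂ (okB j (proj₁ okM))
      PT : PointC T
      PT = pointC T okT
      module PT = Point PT
      module H = HeadPoint (headPoint h okh)
      module Hd = Act ⟦ h ⟧H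

    Agrees : (Car ⟦ Bs ⟧Bs → Car ⟦ T ⟧C → Car ⟦ h ⟧H) → Set
    Agrees E = ∀ ν s → app (fun (projB j) (fun F ν)) s ≡ E ν s

    private
      put₀ : Null ⟦ br T h ⟧B → Null ⟦ Bs′ ⟧Bs
      put₀ b = put j b (zero₀ ⟦ Bs′ ⟧Bs)

    -- An indicator with a coloured value, put into branch `j` and sent through `G`, comes back
    -- through `F` with its colour. So at the fixed argument `PT.pt` the branch takes values of both
    -- colours.
    reach : ∀ E → Agrees E → (P : Palette ⟦ h ⟧H (IsNull ⟦ h ⟧H)) →
            ∀ c → Σ (Car ⟦ Bs ⟧Bs) λ ν → θ (Palette.T P c) (E ν PT.pt) ≡ true
    reach E agr P c = fun G (proj₁ μ) , ≡.trans
      (cong (θ (P.T c)) (≡.sym (agr (fun G (proj₁ μ)) PT.pt)))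
      (≡.trans (fix S (proj₁ μ) (null-nonE ⟦ Bs′ ⟧Bs μ))
        (≡.trans (cong (λ φ → θ (P.T c) (app φ PT.pt)) (put-same j b (zero₀ ⟦ Bs′ ⟧Bs)))
          (≡.trans (cong (θ (P.T c)) (ind-true {B = ⟦ h ⟧H} PT.T (P.γ c , P.good c) PT.pt PT.hit))
                   (P.hit c))))
      where
      module P = Palette P
      b : Null ⟦ br T h ⟧B
      b = ind PT.T (P.γ c , P.good c)
      μ = put₀ b
      S : Test ⟦ Bs′ ⟧Bs
      S = pull (projB j) (atTest′ PT.pt (P.T c))

    -- Branch `j` of `μ` is the indicator of the separating test `S.T`, and `F ∙ G` preserves it up
    -- to tests. So its values at the inputs made from `κ` and `κ′` differ, whereas eliminating the
    -- argument first would make them equal.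
    noOther : ∀ {Γ BsK As h₁} (i : T ≔ neg BsK ∷ [] ⊕ Γ) (j₁ : br As h₁ ∈ BsK) → Elim As h₁ →
      (E : Car ⟦ Bs ⟧Bs → Car ⟦ T ⟧C → Car ⟦ h ⟧H) → Agrees E →
      (∀ n σ → Adm Γ σ → Σ (Car ⟦ As ⟧C) λ α → ∀ (κ κ′ : Null ⟦ BsK ⟧Bs) →
         app (fun (projB j₁) (proj₁ κ)) α ≡ app (fun (projB j₁) (proj₁ κ′)) α →
         E n (mg i (proj₁ κ , one) σ) ≡ E n (mg i (proj₁ κ′ , one) σ)) → ⊥
    noOther {BsK = BsK} i j₁ el E agr dep = clash
        (≡.trans (value κ) (≡.trans (cong (wθ H.W) (ind-true {B = ⟦ h ⟧H} S.T H.pt (S.input (proj₁ κ)) holds)) H.hit))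
        (≡.trans (cong (wθ H.W) (proj₂ D κ κ′ (proj₁ (proj₂ pk))))
          (≡.trans (value κ′) (≡.trans (cong (wθ H.W) (ind-false {B = ⟦ h ⟧H} S.T H.pt (S.input (proj₁ κ′)) fails))
                                       (WeakTest.θ-z H.W))))
      where
      module S = SepCtx (sepCtx i j₁ okT el)
      b : Null ⟦ br T h ⟧B
      b = ind S.T H.pt
      μ = put₀ b
      n = fun G (proj₁ μ)
      D = dep n S.σ S.σ-adm
      pk = S.pick (proj₁ D)
      κ = proj₁ (proj₁ pk)
      κ′ = proj₂ (proj₁ pk)
      holds = proj₁ (proj₂ (proj₂ pk))
      fails = proj₂ (proj₂ (proj₂ pk))
      value : ∀ (κ : Null ⟦ BsK ⟧Bs) → wθ H.W (E n (S.input (proj₁ κ))) ≡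
              wθ H.W (app (proj₁ b) (S.input (proj₁ κ)))
      value κ = ≡.trans
        (cong (wθ H.W) (≡.sym (agr n (S.input (proj₁ κ)))))
        (≡.trans (fix (pull (projB j) (atTest (S.input (proj₁ κ))
                          (adm-nonE′ T (inhabited i) (S.input (proj₁ κ)) (S.adm κ)) H.W))
                      (proj₁ μ) (null-nonE ⟦ Bs′ ⟧Bs μ))
          (cong (λ φ → wθ H.W (app φ (S.input (proj₁ κ)))) (put-same j b (zero₀ ⟦ Bs′ ⟧Bs))))

    Result : (Car ⟦ Bs ⟧Bs → Car ⟦ T ⟧C → Car ⟦ h ⟧H) → Set
    Result E = Σ Br λ B → Σ (B ∈ Bs) λ i → Σ (Focus Bs T h i) λ φ →
               ∀ ν s → E ν s Hd.≈ fun (evF φ) (ν , s)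

  module _ {Bs Bs′} (okM : OkN (neg Bs′))
    (F : ⟦ Bs ⟧Bs ⇒ ⟦ Bs′ ⟧Bs) (G : ⟦ Bs′ ⟧Bs ⇒ ⟦ Bs ⟧Bs) (fix : FixN (neg Bs′) (F ∙ G)) where

    private
      module Fo {T h} (j : br T h ∈ Bs′) = Focusing {Bs} {Bs′} {T} {h} j okM F G fix

    -- After a split, `Bs` reaches one side only and the other is determined by the arguments alone,
    -- against `reach`. Eliminating an argument is excluded by `noOther`.
    focus : ∀ {T h} (j : br T h ∈ Bs′) (f : neg Bs ∷ T ⊢H h) →
      Fo.Agrees j (λ ν s → fun (evH f) (ν , s)) →
      Fo.Result j (λ ν s → fun (evH f) (ν , s))
    focus j (split (cons {N = M} {Δ = []} i a b)) agr with okB j (proj₁ okM)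
    ... | _ , _ , ()
    focus {T} j (split (cons {N = M} {Δ = M′ ∷ Q} (left i) a b)) agr =
      ⊥-elim (P.disj true (fun (evT b) (R i PT.pt)) (val true) (val false))
      where
      okQ = proj₁ (proj₂ (okB j (proj₁ okM)))
      PT = pointC T (proj₁ (okB j (proj₁ okM)))
      PM = paletteN M (proj₁ okQ)
      P = paletteC (M′ ∷ Q) tt (proj₂ okQ)
      module PT = Point PT
      module P = Palette P
      PQ = palette-∷ʳ {M} {M′ ∷ Q} (fromPalette {Good = Small M} PM) P
      module PQ = Palette PQ
      val : ∀ c → θ (P.T c) (fun (evT b) (R i PT.pt)) ≡ true
      val c = let ν , q = Fo.reach j _ agr record
                    { γ = PQ.γ ; good = λ c → adm-null M M′ Q (PQ.γ c) (PQ.good c)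
                    ; T = PQ.T ; hit = PQ.hit ; disj = PQ.disj } c
              in proj₂ (∧-true {θ (Palette.T PM true) (fun (evN a) (ν , L i PT.pt))} q)
    focus {T} j (split (cons {N = M} {Δ = M′ ∷ Q} (right {N = N} i) a b)) agr =
      ⊥-elim (P.disj true (fun (evN a) (L i PT.pt)) (val true) (val false))
      where
      okQ = proj₁ (proj₂ (okB j (proj₁ okM)))
      PT = pointC T (proj₁ (okB j (proj₁ okM)))
      P = paletteN M (proj₁ okQ)
      PR = pointC (M′ ∷ Q) (proj₂ okQ)
      module PT = Point PT
      module P = Palette P
      PQ = palette-∷ {M} {M′ ∷ Q} P PR
      module PQ = Palette PQ
      val : ∀ c → θ (P.T c) (fun (evN a) (L i PT.pt)) ≡ true
      val c = let ν , q = Fo.reach j _ agr record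
                    { γ = PQ.γ ; good = λ c → adm-null M M′ Q (PQ.γ c) (PQ.good c)
                    ; T = PQ.T ; hit = PQ.hit ; disj = PQ.disj } c
              in proj₁ (∧-true {b = θ (Point.T PR) (fun (evT b) (ν , R i PT.pt))} q)
    focus {T} j (ax {As = As} {x} (left i) j₁ a) agr with ⊕-[]ˡ-≡ i
    ... | refl with ⊕-[]ˡ-unique i
    ... | refl = _ , j₁ , fat j₁ a , λ ν s →
      resp (evalₐ {⟦ As ⟧C} {atomₐ} ∙ (foc j₁ ⊗ₘ evT a) ∙ αₐ⁻)
           (cmp (Act.≈-refl ⟦ Bs ⟧Bs) (sp-[]ˡ T s))
    -- An axiom without arguments cannot consume the hypothesis `Bs`.
    focus j (ax {As = []} (right i) j₁ ()) agr
    focus {T} j (ax {Γ′ = _ ∷ Γ} {Bs = BsK} {As = N ∷ As} (right i) j₁ a) agr =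
      ⊥-elim (Fo.noOther j i j₁ argsE _ agr λ n σ σ-adm →
        fun (evT a) (n , σ) , λ κ κ′ q →
          ≡.trans (cong (K n) (sp-mg i (null-nonE ⟦ BsK ⟧Bs κ , refl) σ-adm))
            (≡.trans q (≡.sym (cong (K n) (sp-mg i (null-nonE ⟦ BsK ⟧Bs κ′ , refl) σ-adm)))))
      where
      K : Car ⟦ Bs ⟧Bs → Car ⟦ neg BsK ∷ [] ⟧C × Car ⟦ Γ ⟧C → Atomic
      K n y = app (fun (foc j₁) (proj₁ y)) (fun (evT a) (n , proj₂ y))
    focus {T} {h} j (bind (step {Bs = BsK} {As} {Q} (left i) j₁ k a) r) agr with ⊕-[]ˡ-≡ i
    ... | refl with ⊕-[]ˡ-unique i
    ... | refl = _ , j₁ , ften j₁ k a r , λ ν s →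
      resp (evH r ∙ jn Q ∙ (evalₐ {⟦ As ⟧C} {⟦ Q ⟧C} ⊗ₘ idₐ) ∙ αₐ⁻ ∙ (foc j₁ ⊗ₘ ((evT a ⊗ₘ idₐ) ∙ sp k)) ∙ αₐ⁻)
           (cmp (Act.≈-refl ⟦ Bs ⟧Bs) (sp-[]ˡ T s))
    focus {T} {h} j (bind (step {Γ′ = _ ∷ Γ} {Bs = BsK} {As} {Q} (right i) j₁ k a) r) agr =
      ⊥-elim (Fo.noOther j i j₁ (tenE {Q = Q}) _ agr λ n σ σ-adm →
        fun (evT a) (L k (n , σ)) , λ κ κ′ q →
          ≡.trans (cong (K n) (sp-mg i (null-nonE ⟦ BsK ⟧Bs κ , refl) σ-adm))
            (≡.trans (cong (λ u → fun (evH r) (fun (jn Q) (u , R k (n , σ)))) q)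
              (≡.sym (cong (K n) (sp-mg i (null-nonE ⟦ BsK ⟧Bs κ′ , refl) σ-adm)))))
      where
      K : Car ⟦ Bs ⟧Bs → Car ⟦ neg BsK ∷ [] ⟧C × Car ⟦ Γ ⟧C → Car ⟦ h ⟧H
      K n y = fun (evH r) (fun (jn Q)
        (app (fun (foc j₁) (proj₁ y)) (fun (evT a) (L k (n , proj₂ y))) , R k (n , proj₂ y)))

  -- Matched branches: their arguments and heads

  data Full (Bs : List Br) (T : Ctx) : Head → ∀ {B} → B ∈ Bs → Set where
    fat  : ∀ {As x} (i : br As (at x) ∈ Bs) → T ⊢T As → Full Bs T (at x) i
    ften : ∀ {As Q h} (i : br As (ten Q) ∈ Bs) → T ⊢T As → Q ⊢H h → Full Bs T h i

  argM : ∀ {Bs T h As h′} {i : br As h′ ∈ Bs} → Full Bs T h i → ⟦ T ⟧C ⇒ ⟦ As ⟧C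
  argM (fat i a) = evT a
  argM (ften i a r) = evT a

  headM : ∀ {Bs T h As h′} {i : br As h′ ∈ Bs} → Full Bs T h i → ⟦ h′ ⟧H ⇒ ⟦ h ⟧H
  headM (fat i a) = idₐ
  headM (ften i a r) = evH r

  evFull : ∀ {Bs T h As h′} {i : br As h′ ∈ Bs} → Full Bs T h i → Car ⟦ Bs ⟧Bs → Car ⟦ T ⟧C → Car ⟦ h ⟧H
  evFull {i = i} φ ν u = fun (headM φ) (app (fun (projB i) ν) (fun (argM φ) u))

  castC : ∀ {Γ Γ′} → Γ ≡ Γ′ → Car ⟦ Γ′ ⟧C → Car ⟦ Γ ⟧C
  castC refl x = x

  castC-∷ : ∀ {N Γ Γ′} (q : Γ ≡ Γ′) n x → castC (cong (N ∷_) q) (n , x) ≡ (n , castC q x)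
  castC-∷ refl n x = refl

  castH : ∀ {Γ Γ′ h} → Γ ≡ Γ′ → Γ ⊢H h → Γ′ ⊢H h
  castH refl r = r

  castH-ev : ∀ {Γ Γ′ h} (q : Γ ≡ Γ′) (r : Γ ⊢H h) x → fun (evH (castH q r)) x ≡ fun (evH r) (castC q x)
  castH-ev refl r x = refl

  jn-one : ∀ Q x → fun (jn Q {[]}) (x , one) ≡ castC (++-identityʳ Q) x
  jn-one [] nul = refl
  jn-one [] one = refl
  jn-one [] eps = refl
  jn-one (N ∷ Q) (n , x) =
    ≡.trans (cong (n ,_) (jn-one Q x)) (≡.sym (castC-∷ {N} (++-identityʳ Q) n x))

  ⊕-[]ʳ-≡ : ∀ {Γ Δ} → Γ ≔ Δ ⊕ [] → Γ ≡ Δ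
  ⊕-[]ʳ-≡ nil = refl
  ⊕-[]ʳ-≡ (left i) = cong (_ ∷_) (⊕-[]ʳ-≡ i)

  ⊕-[]ʳ-unique : ∀ {Γ} (i : Γ ≔ Γ ⊕ []) → i ≡ ⊕-[]ʳ Γ
  ⊕-[]ʳ-unique nil = refl
  ⊕-[]ʳ-unique (left i) = cong left (⊕-[]ʳ-unique i)

  NoRest : ∀ {Bs T h B} {i : B ∈ Bs} → Focus Bs T h i → Set
  NoRest (fat i a) = ⊤
  NoRest (ften {Tr = Tr} i k a r) = Tr ≡ []

  fill : ∀ {Bs T h As h′} {i : br As h′ ∈ Bs} (φ : Focus Bs T h i) → NoRest φ →
         Σ (Full Bs T h i) λ ψ → ∀ ν u → Act._≈_ ⟦ h ⟧H (fun (evF φ) (ν , u)) (evFull ψ ν u)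
  fill (fat i a) _ = fat i a , λ _ _ → refl
  fill {T = T} {h} (ften {As} {Q} {Ta} i k a r) refl with ⊕-[]ʳ-≡ k
  ... | refl with ⊕-[]ʳ-unique k
  ... | refl = ften i a (castH (++-identityʳ Q) r) , λ ν u →
    let φ = fun (projB i) ν in
    H.≈-trans
      (resp (evH r ∙ jn Q ∙ (evalₐ {⟦ As ⟧C} {⟦ Q ⟧C} ⊗ₘ idₐ) ∙ αₐ⁻ ∙ (idₐ ⊗ₘ (evT a ⊗ₘ idₐ)))
        (cmp {a = φ} {φ} (Act.≈-refl (homₐ ⟦ As ⟧C ⟦ Q ⟧C) {φ}) (sp-[]ʳ T u)))
      (H.≈-reflexive (≡.trans (cong (fun (evH r)) (jn-one Q _)) (≡.sym (castH-ev (++-identityʳ Q) r _))))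
    where module H = Act ⟦ h ⟧H

  record Half (Bs Bs′ : List Br) {A h T h′} (i : br A h ∈ Bs) (j : br T h′ ∈ Bs′) : Set where
    field
      ok  : OkN (neg Bs)
      F   : ⟦ Bs ⟧Bs ⇒ ⟦ Bs′ ⟧Bs
      G   : ⟦ Bs′ ⟧Bs ⇒ ⟦ Bs ⟧Bs
      fix : FixN (neg Bs) (G ∙ F)

    private
      okA : OkC A
      okA = proj₁ (okB i (proj₁ ok))
      okh : OkH h
      okh = proj₂ (okB i (proj₁ ok))
      module H = HeadPoint (headPoint h okh)
      module Hd = Act ⟦ h ⟧H

    -- Going round, branch `i` is evaluated at a single argument `α`, computed from a fixed point of
    -- `Sa`. The indicator of a colour of the leftover `K ∷ Sr` that `α` misses therefore looks like
    -- zero after the round trip, though `S` tells it from zero.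
    noRest : (φg : Focus Bs′ A h j) (φf : Focus Bs T h′ i) →
      (∀ μ s → Act._≈_ ⟦ h ⟧H (app (fun (projB i) (fun G μ)) s) (fun (evF φg) (μ , s))) →
      (∀ ν u → Act._≈_ ⟦ h′ ⟧H (app (fun (projB j) (fun F ν)) u) (fun (evF φf) (ν , u))) →
      NoRest φg
    noRest (fat _ _) φf eqG eqF = tt
    noRest (ften {Tr = []} _ k a r) φf eqG eqF = refl
    noRest φg@(ften {Ta = Sa} {Tr = K ∷ Sr} j k a r) φf eqG eqF = ⊥-elim (clash
        (≡.trans (fix S (proj₁ ν) (null-nonE ⟦ Bs ⟧Bs ν))
          (≡.trans (cong (λ ψ → wθ H.W (app ψ (P.γ c))) (put-same i b (zero₀ ⟦ Bs ⟧Bs)))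
            (≡.trans (cong (wθ H.W) (ind-true {B = ⟦ h ⟧H} (P.T c) H.pt (P.γ c) (P.hit c))) H.hit)))
        (≡.trans (WeakTest.θ-≈ H.W same)
          (≡.trans (fix S (Act.z ⟦ Bs ⟧Bs) (null-nonE ⟦ Bs ⟧Bs (zero₀ ⟦ Bs ⟧Bs))) (θ-z S))))
      where
      Pₐ = pointC Sa (okL k okA)
      Pᵣ = paletteC (K ∷ Sr) tt (okR k okA)
      P = palette-⊕ʳ k Pᵣ Pₐ
      module Pₐ = Point Pₐ
      module Pᵣ = Palette Pᵣ
      module P = Palette P
      u = fun (evT a) Pₐ.pt
      α = argF φf u
      cq = P.avoid α
      c = proj₁ cq
      b : Null ⟦ br A h ⟧B
      b = ind (P.T c) H.pt
      ν : Null ⟦ Bs ⟧Bs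
      ν = put i b (zero₀ ⟦ Bs ⟧Bs)
      inh : ∀ {Γ Γ₁} → Γ ≔ Γ₁ ⊕ K ∷ Sr → Inhabited Γ
      inh (left _) = tt
      inh (right _) = tt
      S : Test ⟦ Bs ⟧Bs
      S = pull (projB i) (atTest (P.γ c) (adm-nonE′ A (inh k) (P.γ c) (P.good c)) H.W)
      arg : argF φg (P.γ c) ≡ u
      arg = cong (fun (evT a)) (cong proj₁ (sp-mg k Pₐ.good (Pᵣ.good c)))
      at-α : app (fun (projB i) (proj₁ ν)) α ≡ app (fun (projB i) (Act.z ⟦ Bs ⟧Bs)) α
      at-α = ≡.trans (cong (λ ψ → app ψ α) (put-same i b (zero₀ ⟦ Bs ⟧Bs)))
        (≡.trans (ind-false {B = ⟦ h ⟧H} (P.T c) H.pt α (proj₂ cq))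
                 (cong (λ ψ → app ψ α) (≡.sym (projB-z i))))
      same : Act._≈_ ⟦ h ⟧H (app (fun (projB i) (fun G (fun F (proj₁ ν)))) (P.γ c))
               (app (fun (projB i) (fun G (fun F (Act.z ⟦ Bs ⟧Bs)))) (P.γ c))
      same = Hd.≈-trans (eqG (fun F (proj₁ ν)) (P.γ c)) (Hd.≈-trans
        (evF-cong φg (P.γ c) (subst (λ v → Act._≈_ ⟦ h′ ⟧H
            (app (fun (projB j) (fun F (proj₁ ν))) v) (app (fun (projB j) (fun F (Act.z ⟦ Bs ⟧Bs))) v))
          (≡.sym arg)
          (H′.≈-trans (eqF (proj₁ ν) u) (H′.≈-trans
            (evF-cong φf u (Hd.≈-reflexive at-α))
            (H′.≈-sym (eqF (Act.z ⟦ Bs ⟧Bs) u))))))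
        (Hd.≈-sym (eqG (fun F (Act.z ⟦ Bs ⟧Bs)) (P.γ c))))
        where module H′ = Act ⟦ h′ ⟧H

    module _ (V : ⟦ h ⟧H ⇒ ⟦ h ⟧H) (αₘ : ⟦ A ⟧C ⇒ ⟦ A ⟧C)
      (eq : ∀ ν s → Act._≈_ ⟦ h ⟧H (app (fun (projB i) (fun G (fun F ν))) s)
                                   (fun V (app (fun (projB i) ν) (fun αₘ s)))) where

      private
        -- `one` is the only scalar of degree `d1`.
        fix-one : (f : unitₐ ⇒ unitₐ) → fun f one ≡ one
        fix-one f with fun f one | dg f one
        ... | one | _ = refl
        ... | nul | ()
        ... | eps | ()

        value : ∀ (b : Null ⟦ br A h ⟧B) (S : Test ⟦ br A h ⟧B) →
          θ S (fun (projB i) (fun G (fun F (proj₁ (put i b (zero₀ ⟦ Bs ⟧Bs)))))) ≡ θ S (proj₁ b)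
        value b S = ≡.trans
          (fix (pull (projB i) S) _ (null-nonE ⟦ Bs ⟧Bs (put i b (zero₀ ⟦ Bs ⟧Bs))))
          (cong (θ S) (put-same i b (zero₀ ⟦ Bs ⟧Bs)))

        eqAt : ∀ (b : Null ⟦ br A h ⟧B) s → Act._≈_ ⟦ h ⟧H
          (app (fun (projB i) (fun G (fun F (proj₁ (put i b (zero₀ ⟦ Bs ⟧Bs)))))) s)
          (fun V (app (proj₁ b) (fun αₘ s)))
        eqAt b s = subst (λ φ → Act._≈_ ⟦ h ⟧H
          (app (fun (projB i) (fun G (fun F (proj₁ (put i b (zero₀ ⟦ Bs ⟧Bs)))))) s) (fun V (app φ (fun αₘ s))))
          (put-same i b (zero₀ ⟦ Bs ⟧Bs)) (eq _ s)

      -- On the indicator of `T` the composite takes one of two values at `s`, according to whether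
      -- `T` accepts `αₘ s`. Reading them through `V` and `H.W` is the identity on Booleans: zero is
      -- rejected, and something must be accepted, namely at `P.pt`.
      fixA : FixC A αₘ
      fixA = byCases A refl
        where
        byCases : ∀ A′ → A ≡ A′ → FixC A αₘ
        byCases [] refl T s refl = cong (θ T) (fix-one αₘ)
        byCases (N ∷ As) refl T s adm = ≡.trans (≡.sym (val-id (θ T (fun αₘ s)))) (≡.trans (step₁ T s adm)
            (val-id₀ (θ T s)))
          where
          module P = Point (pointC A okA)
          val₀ val : Bool → Bool
          val₀ c = wθ H.W (if c then proj₁ H.pt else Act.z ⟦ h ⟧H)
          val c = wθ H.W (fun V (if c then proj₁ H.pt else Act.z ⟦ h ⟧H))
          val-id₀ : ∀ c → val₀ c ≡ c
          val-id₀ true = H.hit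
          val-id₀ false = WeakTest.θ-z H.W
          step₁ : ∀ (T : Test ⟦ A ⟧C) s → Adm A s → val (θ T (fun αₘ s)) ≡ val₀ (θ T s)
          step₁ T s adm = ≡.trans
            (≡.sym (WeakTest.θ-≈ H.W (eqAt (ind T H.pt) s)))
            (value (ind T H.pt) (atTest s (adm-nonE′ A tt s adm) H.W))
          val-false : val false ≡ false
          val-false = ≡.trans (WeakTest.θ-≈ H.W (fz V)) (WeakTest.θ-z H.W)
          val-true : ∀ c → val c ≡ true → val true ≡ true
          val-true true q = q
          val-true false q = ⊥-elim (clash q val-false)
          val-id : ∀ c → val c ≡ c
          val-id true = val-true _ (≡.trans (step₁ P.T P.pt P.good) (≡.trans (cong val₀ P.hit) H.hit))
          val-id false = val-false

      -- By `fixA` the test at `P.pt` survives `αₘ`, so an indicator with value `x` evaluated there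
      -- isolates the effect of `V` on `x`. Such a value must be null, as it is when the head has
      -- two or more primes.
      fixQ : ∀ {Q} (q : h ≡ ten Q) → FixC Q (subst (λ k → ⟦ k ⟧H ⇒ ⟦ k ⟧H) q V)
      fixQ {[]} refl T x refl = cong (θ T) (fix-one V)
      fixQ {M ∷ []} refl T x adm with okh
      ... | _ , ()
      fixQ {M ∷ N ∷ Q} refl T x adm = ≡.trans
          (cong (λ y → θ T (fun V y)) (≡.sym (ind-true {B = ⟦ h ⟧H} P.T x₀ (fun αₘ P.pt)
            (≡.trans (fixA P.T P.pt P.good) P.hit))))
          (≡.trans (≡.sym (θ-≈ T (eqAt b P.pt)))
            (≡.trans (value b (atTest′ P.pt T))
              (cong (θ T) (ind-true {B = ⟦ h ⟧H} P.T x₀ P.pt P.hit))))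
        where
        module P = Point (pointC A okA)
        x₀ : Null ⟦ h ⟧H
        x₀ = x , adm-null M N Q x adm
        b : Null ⟦ br A h ⟧B
        b = ind P.T x₀

  -- `Δ` is quantified inside the property so that the induction can be structural in `Γ` alone.
  RigidC : Ctx → Set
  RigidC Γ = ∀ {Δ} → OkC Δ → (f : Γ ⊢H ten Δ) (g : Δ ⊢H ten Γ) →
    FixC Γ (evH g ∙ evH f) → FixC Δ (evH f ∙ evH g) → ⌜ Γ ⌝C =S ⌜ Δ ⌝C

  RigidH : Head → Set
  RigidH (at x) = ⊤
  RigidH (ten Q) = RigidC Q

  RigidB : Br → Set
  RigidB (br As h) = RigidC As × RigidH h

  -- With nothing left over, each composite acts on its branch by a map of arguments and a map of
  -- heads, to which `fixA` and `fixQ` apply. The type of `Full` makes the matched heads the same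
  -- atom or both tensors.
  link : ∀ {Bs Bs′ A h T h′} {i : br A h ∈ Bs} {j : br T h′ ∈ Bs′} →
    (there : Half Bs Bs′ i j) (back : Half Bs′ Bs j i) →
    Half.F back ≡ Half.G there → Half.G back ≡ Half.F there →
    (φg : Focus Bs′ A h j) (φf : Focus Bs T h′ i) →
    (∀ μ s → Act._≈_ ⟦ h ⟧H (app (fun (projB i) (fun (Half.G there) μ)) s) (fun (evF φg) (μ , s))) →
    (∀ ν u → Act._≈_ ⟦ h′ ⟧H (app (fun (projB j) (fun (Half.F there) ν)) u) (fun (evF φf) (ν , u))) →
    RigidB (br A h) → ⌜ br A h ⌝B =S ⌜ br T h′ ⌝B
  link {A = A} {h} {T} {h′} {i} {j} H₁ H₂ refl refl φg φf eqG eqF (rA , rh) =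
    finish (proj₁ ψg) (proj₁ ψf) eqGF eqFG
    where
    ψg = fill φg (Half.noRest H₁ φg φf eqG eqF)
    ψf = fill φf (Half.noRest H₂ φf φg eqF eqG)
    module Hd = Act ⟦ h ⟧H
    module Hd′ = Act ⟦ h′ ⟧H
    F = Half.F H₁
    G = Half.G H₁
    eqGF : ∀ ν s → app (fun (projB i) (fun G (fun F ν))) s Hd.≈
      fun (headM (proj₁ ψg) ∙ headM (proj₁ ψf))
          (app (fun (projB i) ν) (fun (argM (proj₁ ψf) ∙ argM (proj₁ ψg)) s))
    eqGF ν s = Hd.≈-trans (eqG (fun F ν) s) (Hd.≈-trans (proj₂ ψg (fun F ν) s)
      (resp (headM (proj₁ ψg)) (Hd′.≈-trans (eqF ν _) (proj₂ ψf ν _))))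
    eqFG : ∀ μ u → app (fun (projB j) (fun F (fun G μ))) u Hd′.≈
      fun (headM (proj₁ ψf) ∙ headM (proj₁ ψg))
          (app (fun (projB j) μ) (fun (argM (proj₁ ψg) ∙ argM (proj₁ ψf)) u))
    eqFG μ u = Hd′.≈-trans (eqF (fun G μ) u) (Hd′.≈-trans (proj₂ ψf (fun G μ) u)
      (resp (headM (proj₁ ψf)) (Hd.≈-trans (eqG μ _) (proj₂ ψg μ _))))
    finish : (g : Full _ A h j) (f : Full _ T h′ i) →
      (∀ ν s → app (fun (projB i) (fun G (fun F ν))) s Hd.≈
        fun (headM g ∙ headM f) (app (fun (projB i) ν) (fun (argM f ∙ argM g) s))) →
      (∀ μ u → app (fun (projB j) (fun F (fun G μ))) u Hd′.≈
        fun (headM f ∙ headM g) (app (fun (projB j) μ) (fun (argM g ∙ argM f) u))) →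
      ⌜ br A h ⌝B =S ⌜ br T h′ ⌝B
    finish (fat _ a) (fat _ b) q q′ = ⊸-cong
      (rA (proj₁ (okB j (proj₁ (Half.ok H₂)))) (split a) (split b)
          (Half.fixA H₁ idₐ (evT b ∙ evT a) q) (Half.fixA H₂ idₐ (evT a ∙ evT b) q′))
      refl
    finish (ften _ a r) (ften _ b r′) q q′ = ⊸-cong
      (rA (proj₁ okT) (split a) (split b)
          (Half.fixA H₁ (evH r ∙ evH r′) (evT b ∙ evT a) q)
          (Half.fixA H₂ (evH r′ ∙ evH r) (evT a ∙ evT b) q′))
      (rh (proj₁ (proj₂ okT)) r′ r
          (Half.fixQ H₁ (evH r ∙ evH r′) (evT b ∙ evT a) q refl)
          (Half.fixQ H₂ (evH r′ ∙ evH r) (evT a ∙ evT b) q′ refl))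
      where okT = okB j (proj₁ (Half.ok H₂))

  -- The bijection between the branches of two primes

  Pos : List Br → Set
  Pos Bs = Σ Br (_∈ Bs)

  pos : ∀ Bs → Fin (length Bs) → Pos Bs
  pos Bs k = lookup Bs k , ∈-lookup k

  idx : ∀ {Bs} → Pos Bs → Fin (length Bs)
  idx p = index (proj₂ p)

  idx-pos : ∀ Bs k → idx (pos Bs k) ≡ k
  idx-pos (B ∷ Bs) zero = refl
  idx-pos (B ∷ Bs) (suc k) = cong suc (idx-pos Bs k)

  pos-idx : ∀ {Bs} (p : Pos Bs) → pos Bs (idx p) ≡ p
  pos-idx (_ , here refl) = refl
  pos-idx (_ , there j) = cong (λ p → proj₁ p , there (proj₂ p)) (pos-idx (_ , j))

  idx-injective : ∀ {Bs} (p q : Pos Bs) → idx p ≡ idx q → p ≡ q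
  idx-injective {Bs} p q e = ≡.trans (≡.sym (pos-idx p)) (≡.trans (cong (pos Bs) e) (pos-idx q))

  &-commutativeMonoid : CommutativeMonoid _ _
  &-commutativeMonoid = record
    { Carrier = Formula X ; _≈_ = _=S_ ; _∙_ = _&_ ; ε = 𝟙⊤
    ; isCommutativeMonoid = record
      { isMonoid = record
        { isSemigroup = record
          { isMagma = record
            { isEquivalence = record { refl = refl ; sym = sym ; trans = trans } ; ∙-cong = &-cong }
          ; assoc = λ _ _ _ → sym &-assoc }
        ; identity = (λ _ → &-unitˡ) , (λ _ → &-unit) }
      ; comm = λ _ _ → &-comm } }

  open Sum &-commutativeMonoid using (sum; sum-permute; sum-cong-≋)

  ⌜⌝-sum : ∀ Bs → ⌜ Bs ⌝Bs ≡ sum (λ k → ⌜ lookup Bs k ⌝B)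
  ⌜⌝-sum [] = refl
  ⌜⌝-sum (B ∷ Bs) = cong (⌜ B ⌝B &_) (⌜⌝-sum Bs)

  bijection-=S : ∀ {Bs Bs′} (ψ : Pos Bs → Pos Bs′) (φ : Pos Bs′ → Pos Bs) →
    (∀ p → φ (ψ p) ≡ p) → (∀ p → ψ (φ p) ≡ p) →
    (∀ p → ⌜ proj₁ p ⌝B =S ⌜ proj₁ (ψ p) ⌝B) → ⌜ Bs ⌝Bs =S ⌜ Bs′ ⌝Bs
  bijection-=S {Bs} {Bs′} ψ φ φψ ψφ eq =
    subst (⌜ Bs ⌝Bs =S_) (≡.sym (⌜⌝-sum Bs′))
      (trans (subst (_=S sum (λ k → ⌜ lookup Bs′ (fwd k) ⌝B)) (≡.sym (⌜⌝-sum Bs))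
               (sum-cong-≋ λ k → subst (λ B → ⌜ lookup Bs k ⌝B =S ⌜ B ⌝B)
                  (≡.sym (cong proj₁ (pos-idx (ψ (pos Bs k))))) (eq (pos Bs k))))
             (sym (sum-permute (λ k → ⌜ lookup Bs′ k ⌝B) (permutation fwd bwd fwd-bwd bwd-fwd))))
    where
    fwd : Fin (length Bs) → Fin (length Bs′)
    fwd k = idx (ψ (pos Bs k))
    bwd : Fin (length Bs′) → Fin (length Bs)
    bwd k = idx (φ (pos Bs′ k))
    fwd-bwd : ∀ k → fwd (bwd k) ≡ k
    fwd-bwd k = ≡.trans (cong (λ p → idx (ψ p)) (pos-idx (φ (pos Bs′ k))))
      (≡.trans (cong idx (ψφ (pos Bs′ k))) (idx-pos Bs′ k))
    bwd-fwd : ∀ k → bwd (fwd k) ≡ k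
    bwd-fwd k = ≡.trans (cong (λ p → idx (φ p)) (pos-idx (ψ (pos Bs k))))
      (≡.trans (cong idx (φψ (pos Bs k))) (idx-pos Bs k))

  record Focused {Bs Bs′} (F : ⟦ Bs ⟧Bs ⇒ ⟦ Bs′ ⟧Bs) {T h} (j : br T h ∈ Bs′) : Set where
    field
      {As} : Ctx
      {h₀} : Head
      i    : br As h₀ ∈ Bs
      φ    : Focus Bs T h i
      eq   : ∀ ν u → Act._≈_ ⟦ h ⟧H (app (fun (projB j) (fun F ν)) u) (fun (evF φ) (ν , u))

  -- If the trip from branch `i` ended in another branch, two elements agreeing in that one would
  -- have images agreeing in branch `i`, which `unrecoverable` forbids.
  roundTrip : ∀ {Bs Bs′} → OkN (neg Bs) → (F : ⟦ Bs ⟧Bs ⇒ ⟦ Bs′ ⟧Bs) (G : ⟦ Bs′ ⟧Bs ⇒ ⟦ Bs ⟧Bs) →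
    FixN (neg Bs) (G ∙ F) → ∀ {A h T h′} (i : br A h ∈ Bs) {j : br T h′ ∈ Bs′} (φ : Focus Bs′ A h j) →
    (∀ μ s → Act._≈_ ⟦ h ⟧H (app (fun (projB i) (fun G μ)) s) (fun (evF φ) (μ , s))) →
    (foc : Focused F j) → idx (_ , Focused.i foc) ≡ idx (_ , i)
  roundTrip {Bs} {Bs′} (ok , _) F G fix {A} {h} {T} {h′} i {j} φ eqG foc with index (Focused.i foc) Fin.≟ index i
  ... | yes q = q
  ... | no ¬q = ⊥-elim (S.unrecoverable (G ∙ F) (λ U x → fix U (proj₁ x) (null-nonE ⟦ Bs ⟧Bs x))
      -- Equality of functions includes their degrees, both `d0` because the two elements are null.
      (≡.trans (degs S.ν) (≡.sym (degs S.ν′)) , λ s →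
        Hd.≈-trans (eqG (fun F (proj₁ S.ν)) s)
          (Hd.≈-trans (evF-cong φ s
            (Hd′.≈-trans (D.eq (proj₁ S.ν) _)
              (Hd′.≈-trans (evF-cong D.φ _ (Act.≈-reflexive ⟦ D.h₀ ⟧H (cong (λ w → app w _) S.same)))
                (Hd′.≈-sym (D.eq (proj₁ S.ν′) _)))))
            (Hd.≈-sym (eqG (fun F (proj₁ S.ν′)) s)))))
    where
    module D = Focused foc
    module S = SepOther (sepOther D.i i ¬q ok)
    module Hd = Act ⟦ h ⟧H
    module Hd′ = Act ⟦ h′ ⟧H
    degs : (x : Null ⟦ Bs ⟧Bs) → τ (fun (projB i) (fun G (fun F (proj₁ x)))) ≡ d0
    degs x = ≡.trans (dg (projB i) _) (≡.trans (dg G _) (≡.trans (dg F _) (proj₂ x)))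

  rigidNeg : ∀ {Bs} → OkN (neg Bs) → All RigidB Bs → RigidN (neg Bs)
  rigidNeg {Bs} ok rs {neg Bs′} ok′ (tup f) (tup g) fix fix′ =
    bijection-=S ψ φ φψ ψφ eq
    where
    F : ⟦ Bs ⟧Bs ⇒ ⟦ Bs′ ⟧Bs
    F = ⟪ tup f ⟫
    G : ⟦ Bs′ ⟧Bs ⇒ ⟦ Bs ⟧Bs
    G = ⟪ tup g ⟫
    focused : ∀ {Bs Bs′} (ok′ : OkN (neg Bs′)) (f : neg Bs ∷ [] ⊢B Bs′) (G : ⟦ Bs′ ⟧Bs ⇒ ⟦ Bs ⟧Bs) →
      FixN (neg Bs′) (⟪ tup f ⟫ ∙ G) → ∀ {T h} (j : br T h ∈ Bs′) → Focused ⟪ tup f ⟫ j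
    focused {Bs} {Bs′} ok′ f G fix {T} {h} j with focus ok′ ⟪ tup f ⟫ G fix j (lookupB f j) (λ ν s → lookupB-ev f j (ν , one) s)
    ... | br As h₀ , i , φ , eq = record
      { i = i ; φ = φ
      ; eq = λ ν u → Act.≈-trans ⟦ h ⟧H
          (Act.≈-reflexive ⟦ h ⟧H (lookupB-ev f j (ν , one) u)) (eq ν u) }
    FF : ∀ {T h} (j : br T h ∈ Bs′) → Focused F j
    FF = focused ok′ f G fix′
    GG : ∀ {A h} (i : br A h ∈ Bs) → Focused G i
    GG = focused ok g F fix
    -- A branch is matched with the one that its proof begins by eliminating.
    ψ : Pos Bs → Pos Bs′
    ψ (br A h , i) = _ , Focused.i (GG i)
    φ : Pos Bs′ → Pos Bs
    φ (br T h , j) = _ , Focused.i (FF j)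
    φψ : ∀ p → φ (ψ p) ≡ p
    φψ (br A h , i) = idx-injective _ _
      (roundTrip ok F G fix i (Focused.φ (GG i)) (Focused.eq (GG i)) (FF (Focused.i (GG i))))
    ψφ : ∀ p → ψ (φ p) ≡ p
    ψφ (br T h , j) = idx-injective _ _
      (roundTrip ok′ G F fix′ j (Focused.φ (FF j)) (Focused.eq (FF j)) (GG (Focused.i (FF j))))
    eq : ∀ p → ⌜ proj₁ p ⌝B =S ⌜ proj₁ (ψ p) ⌝B
    eq (br A h , i) = go (GG i) (FF (Focused.i (GG i))) (φψ (br A h , i))
      where
      -- Abstracting both focusings allows the round-trip equation to be matched, which identifies
      -- the branch returned to with `i`.
      go : (gi : Focused G i) (fj : Focused F (Focused.i gi)) →
        _≡_ {A = Pos Bs} (_ , Focused.i fj) (br A h , i) →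
        ⌜ br A h ⌝B =S ⌜ br (Focused.As gi) (Focused.h₀ gi) ⌝B
      go record { i = j ; φ = φg ; eq = eqG } record { φ = φf ; eq = eqF } refl =
        link (record { ok = ok ; F = F ; G = G ; fix = fix })
             (record { ok = ok′ ; F = G ; G = F ; fix = fix′ })
             refl refl φg φf eqG eqF (All.lookup rs i)

  -- Rigidity of all contexts and completeness

  rigidSplit : ∀ Γ → All RigidN Γ → OkC Γ → RigidC Γ
  rigidSplit Γ rs ok {Δ} ok′ f g fix fix′ with splits f (evH g) ok fix | splits g (evH f) ok′ fix′
  ... | a , refl | b , refl = rigidT Γ rs ok ok′ a b fix fix′

  mutual
    rigidC : ∀ Γ → OkC Γ → RigidC Γ
    rigidC Γ ok = rigidSplit Γ (rigidNs Γ ok) ok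

    rigidNs : ∀ Γ → OkC Γ → All RigidN Γ
    rigidNs [] _ = []
    rigidNs (neg Bs ∷ Γ) (ok , oks) = rigidNeg ok (rigidBs Bs (proj₁ ok)) ∷ rigidNs Γ oks

    rigidBs : ∀ Bs → OkBs Bs → All RigidB Bs
    rigidBs [] _ = []
    rigidBs (br As h ∷ Bs) ((a , b) , bs) = (rigidC As a , rigidH h b) ∷ rigidBs Bs bs

    rigidH : ∀ h → OkH h → RigidH h
    rigidH (at x) _ = tt
    rigidH (ten Q) (q , _) = rigidC Q q

  -- The identity is definable, so each half of the isomorphism, applied to it, is definable and
  -- hence the denotation of a proof.
  isoRigid : ∀ Γ Δ → OkC Γ → OkC Δ → Iso (SMCCProd.category gluing) (GC Γ) (GC Δ) → ⌜ Γ ⌝C =S ⌜ Δ ⌝C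
  isoRigid Γ Δ ok ok′ i = rigidC Γ ok ok′ F.proof G.proof
    (λ T x _ → Test.θ-≈ T (⟦Γ⟧.≈-trans (resp (evH G.proof) (⟦Δ⟧.≈-sym (F.sound x)))
      (⟦Γ⟧.≈-trans (⟦Γ⟧.≈-sym (G.sound (fun (under I.to) x))) (I.isoˡ x))))
    (λ T x _ → Test.θ-≈ T (⟦Δ⟧.≈-trans (resp (evH F.proof) (⟦Γ⟧.≈-sym (G.sound x)))
      (⟦Δ⟧.≈-trans (⟦Δ⟧.≈-sym (F.sound (fun (under I.from) x))) (I.isoʳ x))))
    where
    module I = _≅_[_] i
    module ⟦Γ⟧ = Act ⟦ Γ ⟧C
    module ⟦Δ⟧ = Act ⟦ Δ ⟧C
    module F = ReifiedH (reifyC Δ (pres I.to (reflectC Γ {idₐ} (λ _ → ⟦Γ⟧.≈-refl))))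
    module G = ReifiedH (reifyC Γ (pres I.from (reflectC Δ {idₐ} (λ _ → ⟦Δ⟧.≈-refl))))

  complete : ∀ {F G : Formula X} → IsoInAllModels F G → F =S G
  complete {F} {G} iso = trans (nf-=S F) (trans
    (isoRigid (nf F) (nf G) (nf-ok F) (nf-ok G)
      -- Soundness in the glued model replaces `F` and `G` by their normal forms; `interpC` is a
      -- propositional equality of objects, hence the transport.
      (subst₂ (Iso C) (interpC (nf F)) (interpC (nf G))
        (S.≅-trans (S.≅-sym (S.sound atomᴳ (nf-=S F)))
          (S.≅-trans (iso gluing atomᴳ) (S.sound atomᴳ (nf-=S G))))))
    (sym (nf-=S G)))
    where
    C = SMCCProd.category gluing
    module S = Soundness gluing

theorem9p3 : (X : Set) (F G : Formula X) → (F =S G) ⇔ω IsoInAllModels F G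
theorem9p3 X F G = record
  { to = λ q C ρ → Soundness.sound C ρ q
  ; from = Completeness.complete X
  }
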